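{- For integers $t>1$ and $k\ge 0$, $C_{2,2}(t+tk,k)=(t+tk-2)\varphi(t)$, where $\varphi$ is Euler's totient function. When $t=1$, $C_{2,2}(t+tk,k)=t+tk-1$, i.e. $C_{2,2}(1+k,k)=k$.
   Context: Work over $\mathbb{C}$. Let $e_1,\dots,e_n$ be the standard basis of $\mathbb{C}^n$. For positive integers $a,b,c,d$ with $a+b=c+d=n$, the seaweed of type $\frac{a|b}{c|d}$ is the Lie subalgebra of $\mathfrak{sl}(n,\mathbb C)$ consisting of traceless matrices $X$ with $X(\mathrm{span}\{e_1,\dots,e_a\})\subseteq \mathrm{span}\{e_1,\dots,e_a\}$ and $X(\mathrm{span}\{e_{c+1},\dots,e_n\})\subseteq \mathrm{span}\{e_{c+1},\dots,e_n\}$. The index of a finite-dimensional Lie algebra $\mathfrak g$ is $\min_{f\in\mathfrak g^*}\dim\ker B_f$, where $B_f(x,y)=f([x,y])$. $C_{2,2}(n,k)$ denotes the number of ordered pairs $((a,b),(c,d))$ of compositions of $n$ into exactly two positive parts such that the seaweed of type $\frac{a|b}{c|d}$ has index $k$. -}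

module Defs where

open import Level using (Level; _⊔_) renaming (suc to lsuc)
open import Algebra.Bundles using (CommutativeRing)
open import Data.Nat as ℕ using (ℕ; zero; suc; _≤_; _<_; _∸_)
open import Data.Nat.Coprimality using (coprime?)
open import Data.Fin using (Fin; toℕ)
import Data.Fin as Fin
open import Data.List using (List; filter; length; upTo; map)
open import Data.List.Membership.Propositional using (_∈_)
open import Data.List.Relation.Unary.Unique.Propositional using (Unique)
open import Data.Product using (Σ; _×_; _,_)
open import Function.Bundles using (_⇔_)
open import Relation.Binary.PropositionalEquality using (_≡_)
open import Relation.Nullary using (¬_)

φ : ℕ → ℕ
φ t = length (filter (λ m → coprime? m t) (map suc (upTo t)))

ringFromℕ : ∀ {o ℓ} (R : CommutativeRing o ℓ) → ℕ → CommutativeRing.Carrier R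
ringFromℕ R zero    = CommutativeRing.0# R
ringFromℕ R (suc n) = CommutativeRing._+_ R (CommutativeRing.1# R) (ringFromℕ R n)

record CharZeroField (o ℓ : Level) : Set (lsuc (o ⊔ ℓ)) where
  field
    cring : CommutativeRing o ℓ
  open CommutativeRing cring public
  field
    1≉0     : ¬ (1# ≈ 0#)
    inverse : ∀ x → ¬ (x ≈ 0#) → Σ Carrier (λ y → (x * y) ≈ 1#)
    char0   : ∀ n → ¬ (ringFromℕ cring (suc n) ≈ 0#)

-- Linear algebra with n×n matrices over a field F (entries are indexed
-- by Fin n, so index i corresponds to the basis vector e_{i+1}).

module Over {o ℓ : Level} (F : CharZeroField o ℓ) where
  open CharZeroField F

  Mat : ℕ → Set o
  Mat n = Fin n → Fin n → Carrier

  sumFin : ∀ {m} → (Fin m → Carrier) → Carrier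
  sumFin {zero}  g = 0#
  sumFin {suc m} g = g Fin.zero + sumFin (λ i → g (Fin.suc i))

  module _ {n : ℕ} where
    _≈ₘ_ : Mat n → Mat n → Set ℓ
    X ≈ₘ Y = ∀ i j → X i j ≈ Y i j

    0ₘ : Mat n
    0ₘ i j = 0#

    _+ₘ_ : Mat n → Mat n → Mat n
    (X +ₘ Y) i j = X i j + Y i j

    _·ₘ_ : Carrier → Mat n → Mat n
    (λ' ·ₘ X) i j = λ' * X i j

    _*ₘ_ : Mat n → Mat n → Mat n
    (X *ₘ Y) i j = sumFin (λ k → X i k * Y k j)

    ⁅_,_⁆ : Mat n → Mat n → Mat n
    ⁅ X , Y ⁆ i j = (X *ₘ Y) i j - (Y *ₘ X) i j

    trace : Mat n → Carrier
    trace X = sumFin (λ i → X i i)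

    lincomb : ∀ {d} → (Fin d → Carrier) → (Fin d → Mat n) → Mat n
    lincomb λs v i j = sumFin (λ k → λs k * v k i j)

    HasDim : (Mat n → Set (o ⊔ ℓ)) → ℕ → Set (o ⊔ ℓ)
    HasDim P d =
      Σ (Fin d → Mat n) λ v →
        (∀ k → P (v k))
        × (∀ λs → lincomb λs v ≈ₘ 0ₘ → ∀ k → λs k ≈ 0#)
        × (∀ X → P X → Σ (Fin d → Carrier) λ λs → X ≈ₘ lincomb λs v)

  -- The seaweed of type (a|b)/(c|d), b = n − a, d = n − c:
  -- traceless X with X(span{e_1..e_a}) ⊆ span{e_1..e_a} and
  -- X(span{e_{c+1}..e_n}) ⊆ span{e_{c+1}..e_n}.
  -- In coordinates: X e_j = Σ_i X i j e_i, so the conditions say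
  --   j ≤ a, i > a  ⇒ X_ij = 0     and     j > c, i ≤ c ⇒ X_ij = 0.

  InSeaweed : (n a c : ℕ) → Mat n → Set (o ⊔ ℓ)
  InSeaweed n a c' X =
    Level.Lift o
      ( (∀ i j → toℕ j < a → a ≤ toℕ i → X i j ≈ 0#)
      × (∀ i j → c' ≤ toℕ j → toℕ i < c' → X i j ≈ 0#)
      × (trace X ≈ 0#) )

  -- an element of the dual g* of the seaweed g: a function on g which is
  -- linear (and respects equality) on g; its values off g are irrelevant.
  record Dual (n a c' : ℕ) : Set (o ⊔ ℓ) where
    field
      fun   : Mat n → Carrier
      cong  : ∀ X Y → InSeaweed n a c' X → InSeaweed n a c' Y →
              X ≈ₘ Y → fun X ≈ fun Y
      additive : ∀ X Y → InSeaweed n a c' X → InSeaweed n a c' Y →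
                 fun (X +ₘ Y) ≈ fun X + fun Y
      homogeneous : ∀ λ' X → InSeaweed n a c' X →
                    fun (λ' ·ₘ X) ≈ λ' * fun X

  KerB : ∀ {n a c'} → Dual n a c' → Mat n → Set (o ⊔ ℓ)
  KerB {n} {a} {c'} f X =
    InSeaweed n a c' X × (∀ Y → InSeaweed n a c' Y → Dual.fun f ⁅ X , Y ⁆ ≈ 0#)

  SeaweedIndex : (n a c k : ℕ) → Set (o ⊔ ℓ)
  SeaweedIndex n a c' k =
    Σ (Dual n a c') (λ f → HasDim (KerB f) k)
    × (∀ (f : Dual n a c') d → HasDim (KerB f) d → k ≤ d)

  -- C_{2,2}(n,k) ≡ N : there is a duplicate-free list of exactly N pairs
  -- (a,c), which are exactly the pairs with 1 ≤ a,c ≤ n−1 (i.e. the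
  -- compositions (a,n−a),(c,n−c) into two positive parts) such that the
  -- seaweed (a|n−a)/(c|n−c) has index k.
  C22≡ : (n k N : ℕ) → Set (o ⊔ ℓ)
  C22≡ n k N =
    Σ (List (ℕ × ℕ)) λ L →
      Unique L × length L ≡ N ×
      (∀ a c' → ((a , c') ∈ L) ⇔
                 (1 ≤ a × a < n × 1 ≤ c' × c' < n × SeaweedIndex n a c' k))

-- The index of the seaweed of type a|b / c|d is gcd(n, a − c) − 1. By transposition let c ≤ a. In terms of
-- V = V₁ ⊕ V₂ ⊕ V₃ of dimensions c, m = a − c and n − a, the seaweed in 𝔤𝔩(n) is
-- 𝔤𝔩(V₁) × 𝔤𝔩(V₂) × 𝔤𝔩(V₃) acting on the abelian ideal Hom(V₁ ⊕ V₃, V₂). The restriction of a form f to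
-- this ideal is a pair of maps ξ₁ : V₂ → V₁ and ξ₃ : V₂ → V₃. When these are generic they can be brought to
-- a normal form, and then the kernel of B_f is isomorphic to that of a form on a smaller seaweed of the
-- same kind. On the dimensions this is a subtractive Euclidean algorithm for gcd(dim V₁ + dim V₃, dim V₂)
-- = gcd(n, m), which ends with V₂ = 0, where the kernel is the centraliser of a pair of matrices.
--
-- Followed backwards from diagonal matrices with distinct entries, the reductions produce a form whose
-- kernel has dimension gcd(n, m). Every form lies on a line whose generic member can be reduced, and kernels
-- do not shrink under specialisation; since the powers of a matrix commute with it and are generically
-- independent, no kernel has smaller dimension. Restricting from 𝔤𝔩(n) to 𝔰𝔩(n) splits off the identity
-- matrix, which accounts for the −1.
--
-- As gcd(n, r) depends only on r modulo n up to sign, for fixed a the differences a − c with 1 ≤ c < n run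
-- over all residues modulo n except that of a. Summing over a gives (n − 1) φ(t) minus the number of nonzero
-- residues r with gcd(n, r) = n / t.


module Submission where

open import Defs
open import Level using (Level; _⊔_; lift)
open import Algebra.Bundles using (RawRing; CommutativeRing)
open import Data.Nat as ℕ using (ℕ; zero; suc; _≤_; _<_; _∸_; z≤n; s≤s; z<s; s<s)
import Data.Nat.Properties as ℕₚ
open import Data.Nat.GCD
open import Data.Nat.Divisibility using (_∣_; ∣-antisym; ∣m+n∣m⇒∣n; ∣m∣n⇒∣m+n; >⇒∤; n∣m*n)
open import Data.Nat.Coprimality using (coprime?; coprime⇒gcd≡1; gcd≡1⇒coprime)
open import Data.Nat.Solver using (module +-*-Solver)
open import Data.Fin as Fin using (Fin; zero; suc; toℕ)
import Data.Fin.Properties as Finₚ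
open import Data.List using (List; length; filter; map; applyUpTo; cartesianProduct)
open import Data.List.Properties using (filter-++; length-++; map-applyUpTo)
open import Data.List.Membership.Propositional using (_∈_)
open import Data.List.Membership.Propositional.Properties
  using (∈-filter⁺; ∈-filter⁻; ∈-cartesianProduct⁺; ∈-cartesianProduct⁻; ∈-applyUpTo⁺; ∈-applyUpTo⁻)
open import Data.List.Relation.Unary.Unique.Propositional using (Unique)
open import Data.List.Relation.Unary.Unique.Propositional.Properties using (filter⁺; cartesianProduct⁺; applyUpTo⁺₁)
open import Data.Maybe using (Maybe; just; nothing)
open import Data.Product using (Σ; ∃; _×_; _,_; proj₁; proj₂)
open import Data.Vec.Functional using (_∷_)
open import Data.Sum using (_⊎_; inj₁; inj₂; [_,_]′)
open import Data.Unit using (⊤)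
open import Function using (_∘_; id)
open import Function.Bundles using (mk⇔)
open import Relation.Nullary using (¬_; Dec; yes; no; contradiction)
open import Relation.Binary.PropositionalEquality as ≡ using (_≡_; _≢_)
open import Algebra.Solver.Ring.AlmostCommutativeRing
  using (AlmostCommutativeRing; fromCommutativeRing; _-Raw-AlmostCommutative⟶_)
import Algebra.Solver.Ring as RingSolver

-- The field need not have decidable equality or be algebraically closed, so neither the rank nor
-- the eigenvalues of a given matrix can be computed. Genericity is therefore a statement about the
-- integer parameters of a line: a polynomial that is nonzero somewhere is nonzero at all large
-- integers, and the matrices to be inverted are polynomial in the parameter and equal to the
-- identity at 1.
--
-- The two bounds follow the reductions in opposite directions and carry different invariants. For
-- the form built backwards, certain diagonal entries are kept as coordinates on the kernel, since
-- they see the identity matrix and so allow the passage to trace zero. For an arbitrary form no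
-- basis of the kernel is at hand, so "dimension at least r" is phrased through functionals: fewer
-- than r of them never separate the kernel. This is a negative statement, which survives
-- isomorphisms of kernels and limits along a line, and may be proved under double negation.

infixr 5 _⊕_
infixr 6 _⊗_

-- Index types built from sums and products

data Dim : Set where
  fin     : ℕ → Dim
  _⊕_ _⊗_ : Dim → Dim → Dim

-- A data type rather than a function into `Set`: matching on `in₁`, `in₂`, `in₃` splits a matrix
-- into blocks. Vectors, matrices and whole seaweeds are all functions on such index types, so one
-- theory of sums serves them all.
data El : Dim → Set where
  ix  : ∀ {n} → Fin n → El (fin n)
  inl : ∀ {I J} → El I → El (I ⊕ J)
  inr : ∀ {I J} → El J → El (I ⊕ J)
  pr  : ∀ {I J} → El I → El J → El (I ⊗ J)

pattern in₁ i = inl i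
pattern in₂ i = inr (inl i)
pattern in₃ i = inr (inr i)

size : Dim → ℕ
size (fin n) = n
size (I ⊕ J) = size I ℕ.+ size J
size (I ⊗ J) = size I ℕ.* size J

index : ∀ {I} → El I → Fin (size I)
index (ix i)          = i
index (inl {I} {J} i) = index i Fin.↑ˡ size J
index (inr {I} {J} j) = size I Fin.↑ʳ index j
index (pr i j)        = Fin.combine (index i) (index j)

element : ∀ I → Fin (size I) → El I
element (fin n) i = ix i
element (I ⊕ J) i = [ inl ∘ element I , inr ∘ element J ]′ (Fin.splitAt (size I) i)
element (I ⊗ J) i = pr (element I (proj₁ (Fin.remQuot {size I} (size J) i)))
                       (element J (proj₂ (Fin.remQuot {size I} (size J) i)))

element-index : ∀ {I} (i : El I) → element I (index i) ≡ i
element-index (ix i) = ≡.refl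
element-index (inl {I} {J} i)
  rewrite Finₚ.splitAt-↑ˡ (size I) (index i) (size J) = ≡.cong inl (element-index i)
element-index (inr {I} {J} j)
  rewrite Finₚ.splitAt-↑ʳ (size I) (size J) (index j) = ≡.cong inr (element-index j)
element-index (pr {I} {J} i j) =
  ≡.trans (≡.cong (λ q → pr (element I (proj₁ q)) (element J (proj₂ q)))
                  (Finₚ.remQuot-combine (index i) (index j)))
          (≡.cong₂ pr (element-index i) (element-index j))

index-element : ∀ I (i : Fin (size I)) → index (element I i) ≡ i
index-element (fin n) i = ≡.refl
index-element (I ⊕ J) i with Fin.splitAt (size I) i in eq
... | inj₁ k = ≡.trans (≡.cong (Fin._↑ˡ size J) (index-element I k)) (Finₚ.splitAt⁻¹-↑ˡ eq)
... | inj₂ k = ≡.trans (≡.cong (size I Fin.↑ʳ_) (index-element J k)) (Finₚ.splitAt⁻¹-↑ʳ eq)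
index-element (I ⊗ J) i =
  ≡.trans (≡.cong₂ Fin.combine (index-element I _) (index-element J _))
          (Finₚ.combine-remQuot {size I} (size J) i)

_≟ᴱ_ : ∀ {I} (i j : El I) → Dec (i ≡ j)
i ≟ᴱ j with index i Fin.≟ index j
... | yes p = yes (≡.trans (≡.sym (element-index i)) (≡.trans (≡.cong (element _) p) (element-index j)))
... | no ¬p = no (¬p ∘ ≡.cong index)

SW : (D₁ D₂ D₃ : Dim) → Dim
SW D₁ D₂ D₃ = D₁ ⊗ D₁ ⊕ D₂ ⊗ D₁ ⊕ D₂ ⊗ D₂ ⊕ D₂ ⊗ D₃ ⊕ D₃ ⊗ D₃

pattern pP i j = inl (pr i j)
pattern pQ i j = inr (inl (pr i j))
pattern pR i j = inr (inr (inl (pr i j)))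
pattern pS i j = inr (inr (inr (inl (pr i j))))
pattern pT i j = inr (inr (inr (inr (pr i j))))

-- Finite sums over a field

module Sums {o ℓ : Level} (F : CharZeroField o ℓ) where
  open CharZeroField F public hiding (zero)
  open Over F public using (sumFin)
  open import Relation.Binary.Reasoning.Setoid setoid public
  open import Algebra.Properties.Ring ring public
    using (-0#≈0#; -‿distribˡ-*; -‿distribʳ-*; -‿involutive)
  open import Algebra.Properties.AbelianGroup +-abelianGroup public using (⁻¹-∙-comm)

  ι : ℕ → Carrier
  ι = ringFromℕ cring

  ι-+ : ∀ a b → ι (a ℕ.+ b) ≈ ι a + ι b
  ι-+ zero    b = sym (+-identityˡ _)
  ι-+ (suc a) b = trans (+-congˡ (ι-+ a b)) (sym (+-assoc _ _ _))

  ι-* : ∀ a b → ι (a ℕ.* b) ≈ ι a * ι b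
  ι-* zero    b = sym (zeroˡ _)
  ι-* (suc a) b = begin
    ι (b ℕ.+ a ℕ.* b)     ≈⟨ ι-+ b (a ℕ.* b) ⟩
    ι b + ι (a ℕ.* b)     ≈⟨ +-cong (sym (*-identityˡ _)) (ι-* a b) ⟩
    1# * ι b + ι a * ι b  ≈⟨ distribʳ _ _ _ ⟨
    (1# + ι a) * ι b      ∎

  -- Integer coefficients for the ring solver: (a , b) stands for a − b.
  private
    Diff : RawRing _ _
    Diff = record
      { Carrier = ℕ × ℕ
      ; _≈_ = _≡_
      ; _+_ = λ (a , b) (c , d) → a ℕ.+ c , b ℕ.+ d
      ; _*_ = λ (a , b) (c , d) → a ℕ.* c ℕ.+ b ℕ.* d , a ℕ.* d ℕ.+ b ℕ.* c
      ; -_  = λ (a , b) → b , a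
      ; 0#  = 0 , 0
      ; 1#  = 1 , 0
      }

    diff : ℕ × ℕ → Carrier
    diff (a , b) = ι a - ι b

    -- The values at `(0 , 0)` and `(1 , 0)` are literally `0#` and `1#`, so that `:0` and `:1` in a
    -- solver call match goals that contain these constants.
    ⟦_⟧ᵈ : ℕ × ℕ → Carrier
    ⟦ 0 , 0 ⟧ᵈ = 0#
    ⟦ 1 , 0 ⟧ᵈ = 1#
    ⟦ c ⟧ᵈ     = diff c

    ⟦⟧-diff : ∀ c → ⟦ c ⟧ᵈ ≈ diff c
    ⟦⟧-diff (0 , 0)           = sym (-‿inverseʳ _)
    ⟦⟧-diff (0 , suc b)       = refl
    ⟦⟧-diff (1 , 0)           = sym (trans (+-cong (+-identityʳ _) -0#≈0#) (+-identityʳ _))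
    ⟦⟧-diff (1 , suc b)       = refl
    ⟦⟧-diff (suc (suc a) , b) = refl

    interchange : ∀ a b c d → (a + b) + (c + d) ≈ (a + c) + (b + d)
    interchange a b c d = begin
      (a + b) + (c + d)  ≈⟨ +-assoc a b (c + d) ⟩
      a + (b + (c + d))  ≈⟨ +-congˡ (trans (sym (+-assoc b c d)) (+-congʳ (+-comm b c))) ⟩
      a + (c + b + d)    ≈⟨ +-congˡ (+-assoc c b d) ⟩
      a + (c + (b + d))  ≈⟨ +-assoc a c (b + d) ⟨
      (a + c) + (b + d)  ∎

    diff-+ : ∀ c d → diff (RawRing._+_ Diff c d) ≈ diff c + diff d
    diff-+ (a , b) (c , d) = begin
      ι (a ℕ.+ c) - ι (b ℕ.+ d)      ≈⟨ +-cong (ι-+ a c) (-‿cong (ι-+ b d)) ⟩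
      (ι a + ι c) - (ι b + ι d)      ≈⟨ +-congˡ (⁻¹-∙-comm _ _) ⟨
      (ι a + ι c) + (- ι b + - ι d)  ≈⟨ interchange _ _ _ _ ⟩
      (ι a - ι b) + (ι c - ι d)      ∎

    diff-* : ∀ c d → diff (RawRing._*_ Diff c d) ≈ diff c * diff d
    diff-* (a , b) (c , d) = begin
      ι (a ℕ.* c ℕ.+ b ℕ.* d) - ι (a ℕ.* d ℕ.+ b ℕ.* c)
        ≈⟨ diff-+ (a ℕ.* c , a ℕ.* d) (b ℕ.* d , b ℕ.* c) ⟩
      (ι (a ℕ.* c) - ι (a ℕ.* d)) + (ι (b ℕ.* d) - ι (b ℕ.* c))
        ≈⟨ +-cong (+-cong (ι-* a c) (-‿cong (ι-* a d))) (+-cong (ι-* b d) (-‿cong (ι-* b c))) ⟩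
      (ι a * ι c - ι a * ι d) + (ι b * ι d - ι b * ι c)
        ≈⟨ +-cong (+-congˡ (-‿distribʳ-* _ _)) (trans (+-comm _ _) (+-cong (-‿distribˡ-* _ _)
             (sym (trans (sym (-‿distribˡ-* _ _)) (trans (-‿cong (sym (-‿distribʳ-* _ _))) (-‿involutive _)))))) ⟩
      (ι a * ι c + ι a * - ι d) + (- ι b * ι c + - ι b * - ι d)
        ≈⟨ +-cong (distribˡ _ _ _) (distribˡ _ _ _) ⟨
      ι a * (ι c - ι d) + - ι b * (ι c - ι d)
        ≈⟨ distribʳ _ _ _ ⟨
      (ι a - ι b) * (ι c - ι d) ∎

    diff-neg : ∀ c → diff (RawRing.-_ Diff c) ≈ - diff c
    diff-neg (a , b) = begin
      ι b - ι a          ≈⟨ +-comm _ _ ⟩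
      - ι a + ι b        ≈⟨ +-congˡ (-‿involutive _) ⟨
      - ι a + - (- ι b)  ≈⟨ ⁻¹-∙-comm _ _ ⟩
      - (ι a - ι b)      ∎

    almost : AlmostCommutativeRing _ _
    almost = fromCommutativeRing cring

    morphism : Diff -Raw-AlmostCommutative⟶ almost
    morphism = record
      { ⟦_⟧    = ⟦_⟧ᵈ
      ; +-homo = λ c d → trans (⟦⟧-diff (RawRing._+_ Diff c d)) (trans (diff-+ c d) (sym (+-cong (⟦⟧-diff c) (⟦⟧-diff d))))
      ; *-homo = λ c d → trans (⟦⟧-diff (RawRing._*_ Diff c d)) (trans (diff-* c d) (sym (*-cong (⟦⟧-diff c) (⟦⟧-diff d))))
      ; -‿homo = λ c → trans (⟦⟧-diff (RawRing.-_ Diff c)) (trans (diff-neg c) (-‿cong (sym (⟦⟧-diff c))))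
      ; 0-homo = refl
      ; 1-homo = refl
      }

    diff-≡ : ∀ a b c d → a ℕ.+ d ≡ c ℕ.+ b → diff (a , b) ≈ diff (c , d)
    diff-≡ a b c d eq = begin
      ι a - ι b                      ≈⟨ +-identityʳ _ ⟨
      (ι a - ι b) + 0#               ≈⟨ +-congˡ (-‿inverseʳ (ι d)) ⟨
      (ι a - ι b) + (ι d - ι d)      ≈⟨ interchange _ _ _ _ ⟩
      (ι a + ι d) + (- ι b + - ι d)  ≈⟨ +-congʳ (trans (sym (ι-+ a d)) (trans (reflexive (≡.cong ι eq)) (ι-+ c b))) ⟩
      (ι c + ι b) + (- ι b + - ι d)  ≈⟨ +-congˡ (+-comm _ _) ⟩
      (ι c + ι b) + (- ι d + - ι b)  ≈⟨ interchange _ _ _ _ ⟩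
      (ι c - ι d) + (ι b - ι b)      ≈⟨ +-congˡ (-‿inverseʳ (ι b)) ⟩
      (ι c - ι d) + 0#               ≈⟨ +-identityʳ _ ⟩
      ι c - ι d                      ∎

    _coeff≟_ : (c d : ℕ × ℕ) → Maybe (⟦ c ⟧ᵈ ≈ ⟦ d ⟧ᵈ)
    (a , b) coeff≟ (c , d) with a ℕ.+ d ℕ.≟ c ℕ.+ b
    ... | yes p = just (trans (⟦⟧-diff (a , b)) (trans (diff-≡ a b c d p) (sym (⟦⟧-diff (c , d)))))
    ... | no _  = nothing

  open RingSolver Diff almost morphism _coeff≟_ public
    using (Polynomial; solve; _:=_; _:+_; _:*_; _:-_; :-_; con)

  :0 :1 : ∀ {n} → Polynomial n
  :0 = con (0 , 0)
  :1 = con (1 , 0)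

  ∑ : ∀ {I} → (El I → Carrier) → Carrier
  ∑ {fin n} f = sumFin (λ i → f (ix i))
  ∑ {I ⊕ J} f = ∑ (λ i → f (inl i)) + ∑ (λ j → f (inr j))
  ∑ {I ⊗ J} f = ∑ (λ i → ∑ (λ j → f (pr i j)))

  sumFin-cong : ∀ {n} {f g : Fin n → Carrier} → (∀ i → f i ≈ g i) → sumFin f ≈ sumFin g
  sumFin-cong {zero}  h = refl
  sumFin-cong {suc n} h = +-cong (h zero) (sumFin-cong (h ∘ suc))

  ∑-cong : ∀ {I} {f g : El I → Carrier} → (∀ i → f i ≈ g i) → ∑ f ≈ ∑ g
  ∑-cong {fin n} h = sumFin-cong (λ i → h (ix i))
  ∑-cong {I ⊕ J} h = +-cong (∑-cong (λ i → h (inl i))) (∑-cong (λ j → h (inr j)))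
  ∑-cong {I ⊗ J} h = ∑-cong (λ i → ∑-cong (λ j → h (pr i j)))

  ∑-0# : ∀ I → ∑ {I} (λ _ → 0#) ≈ 0#
  ∑-0# (fin zero)    = refl
  ∑-0# (fin (suc n)) = trans (+-identityˡ _) (∑-0# (fin n))
  ∑-0# (I ⊕ J)       = trans (+-cong (∑-0# I) (∑-0# J)) (+-identityˡ _)
  ∑-0# (I ⊗ J)       = trans (∑-cong {I} (λ _ → ∑-0# J)) (∑-0# I)

  ∑-0 : ∀ {I} {f : El I → Carrier} → (∀ i → f i ≈ 0#) → ∑ f ≈ 0#
  ∑-0 {I} h = trans (∑-cong h) (∑-0# I)

  ∑-+ : ∀ {I} (f g : El I → Carrier) → ∑ (λ i → f i + g i) ≈ ∑ f + ∑ g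
  ∑-+ {fin zero}    f g = sym (+-identityˡ _)
  ∑-+ {fin (suc n)} f g =
    trans (+-congˡ (∑-+ {fin n} (λ { (ix i) → f (ix (suc i)) }) (λ { (ix i) → g (ix (suc i)) })))
          (interchange _ _ _ _)
  ∑-+ {I ⊕ J} f g = trans (+-cong (∑-+ (f ∘ inl) (g ∘ inl)) (∑-+ (f ∘ inr) (g ∘ inr))) (interchange _ _ _ _)
  ∑-+ {I ⊗ J} f g = trans (∑-cong (λ i → ∑-+ (λ j → f (pr i j)) (λ j → g (pr i j))))
                          (∑-+ {I} (λ i → ∑ (λ j → f (pr i j))) (λ i → ∑ (λ j → g (pr i j))))

  ∑-*ˡ : ∀ {I} c (f : El I → Carrier) → ∑ (λ i → c * f i) ≈ c * ∑ f
  ∑-*ˡ {fin zero}    c f = sym (zeroʳ c)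
  ∑-*ˡ {fin (suc n)} c f =
    trans (+-congˡ (∑-*ˡ {fin n} c (λ { (ix i) → f (ix (suc i)) }))) (sym (distribˡ _ _ _))
  ∑-*ˡ {I ⊕ J} c f = trans (+-cong (∑-*ˡ c (f ∘ inl)) (∑-*ˡ c (f ∘ inr))) (sym (distribˡ _ _ _))
  ∑-*ˡ {I ⊗ J} c f = trans (∑-cong (λ i → ∑-*ˡ c (λ j → f (pr i j)))) (∑-*ˡ {I} c (λ i → ∑ (λ j → f (pr i j))))

  ∑-*ʳ : ∀ {I} c (f : El I → Carrier) → ∑ (λ i → f i * c) ≈ ∑ f * c
  ∑-*ʳ c f = trans (∑-cong (λ i → *-comm (f i) c)) (trans (∑-*ˡ c f) (*-comm c _))

  -≈-1* : ∀ x → - x ≈ (- 1#) * x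
  -≈-1* = solve 1 (λ x → :- x := (:- :1) :* x) refl

  ∑-neg : ∀ {I} (f : El I → Carrier) → ∑ (λ i → - f i) ≈ - ∑ f
  ∑-neg f = trans (∑-cong (λ i → -≈-1* (f i))) (trans (∑-*ˡ (- 1#) f) (sym (-≈-1* _)))

  ∑-minus : ∀ {I} (f g : El I → Carrier) → ∑ (λ i → f i - g i) ≈ ∑ f - ∑ g
  ∑-minus f g = trans (∑-+ f (λ i → - g i)) (+-congˡ (∑-neg g))

  ∑-swap : ∀ {I J} (f : El I → El J → Carrier) →
           ∑ (λ i → ∑ (λ j → f i j)) ≈ ∑ (λ j → ∑ (λ i → f i j))
  ∑-swap {fin zero}    {J} f = sym (∑-0# J)
  ∑-swap {fin (suc n)} {J} f =
    trans (+-congˡ (∑-swap {fin n} {J} (λ { (ix i) → f (ix (suc i)) })))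
          (sym (∑-+ {J} (f (ix zero)) (λ j → sumFin (λ i → f (ix (suc i)) j))))
  ∑-swap {I ⊕ I′} {J} f = trans (+-cong (∑-swap (f ∘ inl)) (∑-swap (f ∘ inr))) (sym (∑-+ {J} _ _))
  ∑-swap {I ⊗ I′} {J} f = trans (∑-cong (λ i → ∑-swap {I′} {J} (λ i′ → f (pr i i′))))
                                (∑-swap {I} {J} (λ i j → ∑ (λ i′ → f (pr i i′) j)))

  δᶠ : ∀ {n} → Fin n → Fin n → Carrier
  δᶠ zero    zero    = 1#
  δᶠ zero    (suc j) = 0#
  δᶠ (suc i) zero    = 0#
  δᶠ (suc i) (suc j) = δᶠ i j

  -- Recursion on the indices instead of a decision: the off-diagonal blocks of an identity matrix
  -- then reduce to `0#` by computation, on which the block calculations rely.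
  δ : ∀ {I} → El I → El I → Carrier
  δ (ix i)   (ix j)   = δᶠ i j
  δ (inl i)  (inl j)  = δ i j
  δ (inl i)  (inr j)  = 0#
  δ (inr i)  (inl j)  = 0#
  δ (inr i)  (inr j)  = δ i j
  δ (pr i j) (pr k l) = δ i k * δ j l

  δᶠ-refl : ∀ {n} (i : Fin n) → δᶠ i i ≈ 1#
  δᶠ-refl zero    = refl
  δᶠ-refl (suc i) = δᶠ-refl i

  δᶠ-≢ : ∀ {n} (i j : Fin n) → i ≢ j → δᶠ i j ≈ 0#
  δᶠ-≢ zero    zero    i≢j = contradiction ≡.refl i≢j
  δᶠ-≢ zero    (suc j) i≢j = refl
  δᶠ-≢ (suc i) zero    i≢j = refl
  δᶠ-≢ (suc i) (suc j) i≢j = δᶠ-≢ i j (i≢j ∘ ≡.cong suc)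

  δ-refl : ∀ {I} (i : El I) → δ i i ≈ 1#
  δ-refl (ix i)   = δᶠ-refl i
  δ-refl (inl i)  = δ-refl i
  δ-refl (inr i)  = δ-refl i
  δ-refl (pr i j) = trans (*-cong (δ-refl i) (δ-refl j)) (*-identityˡ _)

  δ-≢ : ∀ {I} (i j : El I) → i ≢ j → δ i j ≈ 0#
  δ-≢ (ix i)   (ix j)   i≢j = δᶠ-≢ i j (i≢j ∘ ≡.cong ix)
  δ-≢ (inl i)  (inl j)  i≢j = δ-≢ i j (i≢j ∘ ≡.cong inl)
  δ-≢ (inl i)  (inr j)  i≢j = refl
  δ-≢ (inr i)  (inl j)  i≢j = refl
  δ-≢ (inr i)  (inr j)  i≢j = δ-≢ i j (i≢j ∘ ≡.cong inr)
  δ-≢ (pr i j) (pr k l) i≢j with i ≟ᴱ k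
  ... | no i≢k     = trans (*-congʳ (δ-≢ i k i≢k)) (zeroˡ _)
  ... | yes ≡.refl = trans (*-congˡ (δ-≢ j l (i≢j ∘ ≡.cong (pr i)))) (zeroʳ _)

  δ-⇔ : ∀ {I J} (i j : El I) (k l : El J) → (i ≡ j → k ≡ l) → (k ≡ l → i ≡ j) → δ i j ≈ δ k l
  δ-⇔ i j k l to from with i ≟ᴱ j
  ... | yes ≡.refl with ≡.refl ← to ≡.refl = trans (δ-refl i) (sym (δ-refl k))
  ... | no i≢j = trans (δ-≢ i j i≢j) (sym (δ-≢ k l (i≢j ∘ from)))

  δ-sym : ∀ {I} (i j : El I) → δ i j ≈ δ j i
  δ-sym i j = δ-⇔ i j j i ≡.sym ≡.sym

  ∑-δˡ : ∀ {I} (i : El I) (f : El I → Carrier) → ∑ (λ j → δ i j * f j) ≈ f i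
  ∑-δˡ (ix i) f = fin-case i (f ∘ ix)
    where
    fin-case : ∀ {n} (i : Fin n) (f : Fin n → Carrier) → sumFin (λ j → δᶠ i j * f j) ≈ f i
    fin-case {suc n} zero    f =
      trans (+-cong (*-identityˡ _) (∑-0 {fin n} {λ { (ix j) → 0# * f (suc j) }} (λ { (ix j) → zeroˡ _ })))
            (+-identityʳ _)
    fin-case {suc n} (suc i) f = trans (+-cong (zeroˡ _) (fin-case i (f ∘ suc))) (+-identityˡ _)
  ∑-δˡ {I ⊕ J} (inl i)  f = trans (+-cong (∑-δˡ i (f ∘ inl)) (∑-0 {J} (λ _ → zeroˡ _))) (+-identityʳ _)
  ∑-δˡ {I ⊕ J} (inr i)  f = trans (+-cong (∑-0 {I} (λ _ → zeroˡ _)) (∑-δˡ i (f ∘ inr))) (+-identityˡ _)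
  ∑-δˡ {I ⊗ J} (pr i k) f = begin
    ∑ (λ j → ∑ (λ l → δ i j * δ k l * f (pr j l)))
      ≈⟨ ∑-cong {I} (λ j → trans (∑-cong {J} (λ l → *-assoc _ _ _)) (∑-*ˡ {J} (δ i j) _)) ⟩
    ∑ (λ j → δ i j * ∑ (λ l → δ k l * f (pr j l)))
      ≈⟨ ∑-cong (λ j → *-congˡ (∑-δˡ k (λ l → f (pr j l)))) ⟩
    ∑ (λ j → δ i j * f (pr j k))
      ≈⟨ ∑-δˡ i (λ j → f (pr j k)) ⟩
    f (pr i k) ∎

  ∑-δʳ : ∀ {I} (i : El I) (f : El I → Carrier) → ∑ (λ j → f j * δ j i) ≈ f i
  ∑-δʳ i f = trans (∑-cong (λ j → trans (*-comm _ _) (*-congʳ (δ-sym j i)))) (∑-δˡ i f)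

  -- No permutation argument: `f j` is expanded as a sum over i of `δ (from j) i * f (to i)`, the
  -- sums are exchanged, and `δ (from j) i` equals `δ (to i) j`.
  ∑-reindex : ∀ {I J} (to : El I → El J) (from : El J → El I) →
              (∀ j → to (from j) ≡ j) → (∀ i → from (to i) ≡ i) →
              ∀ (f : El J → Carrier) → ∑ f ≈ ∑ (λ i → f (to i))
  ∑-reindex {I} {J} to from to-from from-to f = begin
    ∑ f
      ≈⟨ ∑-cong (λ j → sym (trans (∑-δˡ (from j) (λ i → f (to i))) (reflexive (≡.cong f (to-from j))))) ⟩
    ∑ (λ j → ∑ (λ i → δ (from j) i * f (to i)))
      ≈⟨ ∑-swap (λ j i → δ (from j) i * f (to i)) ⟩
    ∑ (λ i → ∑ (λ j → δ (from j) i * f (to i)))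
      ≈⟨ ∑-cong (λ i → ∑-cong (λ j → trans (*-congʳ (δ-⇔ (from j) i (to i) j
           (λ e → ≡.trans (≡.cong to (≡.sym e)) (to-from j))
           (λ e → ≡.trans (≡.cong from (≡.sym e)) (from-to i)))) (*-congˡ refl))) ⟩
    ∑ (λ i → ∑ (λ j → δ (to i) j * f (to i)))
      ≈⟨ ∑-cong (λ i → ∑-δˡ (to i) (λ _ → f (to i))) ⟩
    ∑ (λ i → f (to i)) ∎

  ∑-flatten : ∀ {I} (f : El I → Carrier) → ∑ f ≈ sumFin (λ k → f (element I k))
  ∑-flatten {I} = ∑-reindex {fin (size I)} {I} (λ { (ix k) → element I k }) (λ i → ix (index i))
                        element-index (λ { (ix k) → ≡.cong ix (index-element I k) })

  sumFin-index : ∀ {I} (f : Fin (size I) → Carrier) → sumFin f ≈ ∑ (λ (i : El I) → f (index i))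
  sumFin-index {I} f = sym (trans (∑-flatten {I} (λ i → f (index i)))
    (sumFin-cong (λ k → reflexive (≡.cong f (index-element I k)))))

-- Linear forms on a seaweed in block form

module Kernels {o ℓ : Level} (F : CharZeroField o ℓ) where
  open Sums F public

  x-y≈0 : ∀ {a b} → a ≈ b → a - b ≈ 0#
  x-y≈0 {a} {b} p = trans (+-congʳ p) (-‿inverseʳ b)

  x-y≈0⁻¹ : ∀ {a b} → a - b ≈ 0# → a ≈ b
  x-y≈0⁻¹ {a} {b} p = trans (solve 2 (λ a b → a := (a :- b) :+ b) refl a b) (trans (+-congʳ p) (+-identityˡ b))

  Mtx : Dim → Dim → Set o
  Mtx I J = El I → El J → Carrier

  infixl 7 _·_
  infix 10 _ᵀ

  _·_ : ∀ {I J K} → Mtx I J → Mtx J K → Mtx I K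
  (A · B) i k = ∑ (λ j → A i j * B j k)

  _ᵀ : ∀ {I J} → Mtx I J → Mtx J I
  (A ᵀ) i j = A j i

  infix 4 _≋_
  _≋_ : ∀ {I J} → Mtx I J → Mtx I J → Set ℓ
  A ≋ B = ∀ i j → A i j ≈ B i j

  ≋-refl : ∀ {I J} {A : Mtx I J} → A ≋ A
  ≋-refl _ _ = refl

  ·-cong : ∀ {I J K} {A A′ : Mtx I J} {B B′ : Mtx J K} → A ≋ A′ → B ≋ B′ → A · B ≋ A′ · B′
  ·-cong {J = J} p q i k = ∑-cong {J} (λ j → *-cong (p i j) (q j k))

  ·-assoc : ∀ {I J K L} (A : Mtx I J) (B : Mtx J K) (C : Mtx K L) → (A · B) · C ≋ A · (B · C)
  ·-assoc {I} {J} {K} A B C i l = begin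
    ∑ {K} (λ k → ∑ {J} (λ j → A i j * B j k) * C k l)
      ≈⟨ ∑-cong {K} (λ k → trans (sym (∑-*ʳ {J} (C k l) _)) (∑-cong {J} (λ j → *-assoc _ _ _))) ⟩
    ∑ {K} (λ k → ∑ {J} (λ j → A i j * (B j k * C k l)))
      ≈⟨ ∑-swap {K} {J} _ ⟩
    ∑ {J} (λ j → ∑ {K} (λ k → A i j * (B j k * C k l)))
      ≈⟨ ∑-cong {J} (λ j → ∑-*ˡ {K} _ _) ⟩
    ∑ {J} (λ j → A i j * ∑ {K} (λ k → B j k * C k l)) ∎

  ·-idˡ : ∀ {I J} (A : Mtx I J) → δ · A ≋ A
  ·-idˡ A i j = ∑-δˡ i (λ k → A k j)

  ·-idʳ : ∀ {I J} (A : Mtx I J) → A · δ ≋ A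
  ·-idʳ A i j = ∑-δʳ j (A i)

  ·-distribˡ : ∀ {I J K} (A : Mtx I J) (B C : Mtx J K) i k →
               ∑ {J} (λ j → A i j * (B j k + C j k)) ≈ (A · B) i k + (A · C) i k
  ·-distribˡ {J = J} A B C i k = trans (∑-cong {J} (λ j → distribˡ _ _ _)) (∑-+ {J} _ _)

  ·-distribʳ : ∀ {I J K} (A B : Mtx I J) (C : Mtx J K) i k →
               ∑ {J} (λ j → (A i j + B i j) * C j k) ≈ (A · C) i k + (B · C) i k
  ·-distribʳ {J = J} A B C i k = trans (∑-cong {J} (λ j → distribʳ _ _ _)) (∑-+ {J} _ _)

  ∑-zeroˡ : ∀ {I} (f : El I → Carrier) → ∑ {I} (λ i → 0# * f i) ≈ 0#
  ∑-zeroˡ {I} f = ∑-0 {I} (λ i → zeroˡ (f i))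

  ∑-zeroʳ : ∀ {I} (f : El I → Carrier) → ∑ {I} (λ i → f i * 0#) ≈ 0#
  ∑-zeroʳ {I} f = ∑-0 {I} (λ i → zeroʳ (f i))

  -- Functionals are bare functions on coordinate vectors, so compatibility with pointwise `_≈_` is
  -- part of linearity.
  record Lin {I : Dim} (φ : (El I → Carrier) → Carrier) : Set (o ⊔ ℓ) where
    field
      cong-lin  : ∀ {x y} → (∀ i → x i ≈ y i) → φ x ≈ φ y
      add-lin   : ∀ x y → φ (λ i → x i + y i) ≈ φ x + φ y
      scale-lin : ∀ c x → φ (λ i → c * x i) ≈ c * φ x
  open Lin public

  Linear : ∀ {I J} → ((El I → Carrier) → (El J → Carrier)) → Set (o ⊔ ℓ)
  Linear L = ∀ j → Lin (λ x → L x j)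

  module _ {I : Dim} where
    lin-at : ∀ i → Lin {I} (λ x → x i)
    lin-at i .cong-lin h    = h i
    lin-at i .add-lin _ _   = refl
    lin-at i .scale-lin _ _ = refl

    lin-0 : Lin {I} (λ _ → 0#)
    lin-0 .cong-lin _    = refl
    lin-0 .add-lin _ _   = sym (+-identityˡ 0#)
    lin-0 .scale-lin c _ = sym (zeroʳ c)

    lin-+ : ∀ {φ ψ} → Lin {I} φ → Lin ψ → Lin (λ x → φ x + ψ x)
    lin-+ p q .cong-lin h  = +-cong (cong-lin p h) (cong-lin q h)
    lin-+ p q .add-lin x y = trans (+-cong (add-lin p x y) (add-lin q x y))
      (solve 4 (λ a b c d → (a :+ b) :+ (c :+ d) := (a :+ c) :+ (b :+ d)) refl _ _ _ _)
    lin-+ p q .scale-lin c x = trans (+-cong (scale-lin p c x) (scale-lin q c x)) (sym (distribˡ _ _ _))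

    lin-neg : ∀ {φ} → Lin {I} φ → Lin (λ x → - φ x)
    lin-neg p .cong-lin h    = -‿cong (cong-lin p h)
    lin-neg p .add-lin x y   = trans (-‿cong (add-lin p x y)) (sym (⁻¹-∙-comm _ _))
    lin-neg p .scale-lin c x = trans (-‿cong (scale-lin p c x)) (-‿distribʳ-* _ _)

    lin-minus : ∀ {φ ψ} → Lin {I} φ → Lin ψ → Lin (λ x → φ x - ψ x)
    lin-minus p q = lin-+ p (lin-neg q)

    lin-*ˡ : ∀ {φ} a → Lin {I} φ → Lin (λ x → a * φ x)
    lin-*ˡ a p .cong-lin h    = *-congˡ (cong-lin p h)
    lin-*ˡ a p .add-lin x y   = trans (*-congˡ (add-lin p x y)) (distribˡ _ _ _)
    lin-*ˡ a p .scale-lin c x = trans (*-congˡ (scale-lin p c x))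
      (solve 3 (λ a c x → a :* (c :* x) := c :* (a :* x)) refl _ _ _)

    lin-*ʳ : ∀ {φ} a → Lin {I} φ → Lin (λ x → φ x * a)
    lin-*ʳ a p .cong-lin h    = *-congʳ (cong-lin p h)
    lin-*ʳ a p .add-lin x y   = trans (*-congʳ (add-lin p x y)) (distribʳ _ _ _)
    lin-*ʳ a p .scale-lin c x = trans (*-congʳ (scale-lin p c x)) (*-assoc _ _ _)

    lin-∑ : ∀ {J} {φ : El J → (El I → Carrier) → Carrier} →
            (∀ j → Lin (φ j)) → Lin (λ x → ∑ {J} (λ j → φ j x))
    lin-∑ {J} p .cong-lin h    = ∑-cong {J} (λ j → cong-lin (p j) h)
    lin-∑ {J} p .add-lin x y   = trans (∑-cong {J} (λ j → add-lin (p j) x y)) (∑-+ {J} _ _)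
    lin-∑ {J} p .scale-lin c x = trans (∑-cong {J} (λ j → scale-lin (p j) c x)) (∑-*ˡ {J} c _)

    lin-·ˡ : ∀ {J K L} (A : Mtx J K) {B : (El I → Carrier) → Mtx K L} →
             (∀ j k → Lin (λ x → B x j k)) → ∀ i k → Lin (λ x → (A · B x) i k)
    lin-·ˡ {K = K} A p i k = lin-∑ {K} (λ j → lin-*ˡ (A i j) (p j k))

    lin-·ʳ : ∀ {J K L} {A : (El I → Carrier) → Mtx J K} (B : Mtx K L) →
             (∀ j k → Lin (λ x → A x j k)) → ∀ i k → Lin (λ x → (A x · B) i k)
    lin-·ʳ {K = K} B p i k = lin-∑ {K} (λ j → lin-*ʳ (B j k) (p i j))

    lin-zero : ∀ {φ} → Lin {I} φ → ∀ {x} → (∀ i → x i ≈ 0#) → φ x ≈ 0#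
    lin-zero {φ} p {x} h = begin
      φ x                  ≈⟨ cong-lin p (λ i → trans (h i) (sym (zeroˡ (x i)))) ⟩
      φ (λ i → 0# * x i)   ≈⟨ scale-lin p 0# x ⟩
      0# * φ x             ≈⟨ zeroˡ _ ⟩
      0#                   ∎

    lin-lincomb : ∀ {φ} → Lin {I} φ → ∀ {J} (c : El J → Carrier) (v : El J → El I → Carrier) →
                  φ (λ i → ∑ (λ j → c j * v j i)) ≈ ∑ (λ j → c j * φ (v j))
    lin-lincomb {φ} p {fin zero}    c v = lin-zero p (λ _ → refl)
    lin-lincomb {φ} p {fin (suc n)} c v = trans (add-lin p _ _)
      (+-cong (scale-lin p _ _)
        (lin-lincomb p {fin n} (λ { (ix j) → c (ix (suc j)) }) (λ { (ix j) → v (ix (suc j)) })))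
    lin-lincomb p {J ⊕ K} c v = trans (add-lin p _ _)
      (+-cong (lin-lincomb p (λ j → c (inl j)) (λ j → v (inl j)))
              (lin-lincomb p (λ j → c (inr j)) (λ j → v (inr j))))
    lin-lincomb {φ} p {J ⊗ K} c v = begin
      φ (λ i → ∑ {J} (λ j → ∑ {K} (λ k → c (pr j k) * v (pr j k) i)))
        ≈⟨ cong-lin p (λ i → ∑-cong {J} (λ j → sym (*-identityˡ _))) ⟩
      φ (λ i → ∑ {J} (λ j → 1# * ∑ {K} (λ k → c (pr j k) * v (pr j k) i)))
        ≈⟨ lin-lincomb p {J} (λ _ → 1#) (λ j i → ∑ {K} (λ k → c (pr j k) * v (pr j k) i)) ⟩
      ∑ {J} (λ j → 1# * φ (λ i → ∑ {K} (λ k → c (pr j k) * v (pr j k) i)))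
        ≈⟨ ∑-cong {J} (λ j → trans (*-identityˡ _)
             (lin-lincomb p {K} (λ k → c (pr j k)) (λ k → v (pr j k)))) ⟩
      ∑ {J} (λ j → ∑ {K} (λ k → c (pr j k) * φ (v (pr j k)))) ∎

    lin-expand : ∀ {φ} → Lin {I} φ → ∀ x → φ x ≈ ∑ (λ i → x i * φ (δ i))
    lin-expand {φ} p x = trans (cong-lin p (λ i → sym (∑-δʳ i x))) (lin-lincomb p x δ)

  lin-∘ : ∀ {I J} {φ : (El J → Carrier) → Carrier} {L : (El I → Carrier) → El J → Carrier} →
          Lin φ → Linear L → Lin (λ x → φ (L x))
  lin-∘ p q .cong-lin h    = cong-lin p (λ j → cong-lin (q j) h)
  lin-∘ p q .add-lin x y   = trans (cong-lin p (λ j → add-lin (q j) x y)) (add-lin p _ _)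
  lin-∘ p q .scale-lin c x = trans (cong-lin p (λ j → scale-lin (q j) c x)) (scale-lin p _ _)

  -- With respect to V = V₁ ⊕ V₂ ⊕ V₃ of dimensions c, a − c, n − a (for c ≤ a), the seaweed is
  --   P 0 0
  --   Q R S
  --   0 0 T
  -- A linear form pairs P, Q, R, S, T with M₁, ξ₁, M₂, ξ₃, M₃ by the trace.
  record Form (D₁ D₂ D₃ : Dim) : Set o where
    constructor form
    field
      M₁ : Mtx D₁ D₁
      M₂ : Mtx D₂ D₂
      M₃ : Mtx D₃ D₃
      ξ₁ : Mtx D₁ D₂
      ξ₃ : Mtx D₃ D₂
  open Form public

  Seaweed : (D₁ D₂ D₃ : Dim) → Set o
  Seaweed D₁ D₂ D₃ = El (SW D₁ D₂ D₃) → Carrier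

  module _ {D₁ D₂ D₃ : Dim} where
    blocks : Mtx D₁ D₁ → Mtx D₂ D₁ → Mtx D₂ D₂ → Mtx D₂ D₃ → Mtx D₃ D₃ → Seaweed D₁ D₂ D₃
    blocks p q r s t (pP i j) = p i j
    blocks p q r s t (pQ i j) = q i j
    blocks p q r s t (pR i j) = r i j
    blocks p q r s t (pS i j) = s i j
    blocks p q r s t (pT i j) = t i j

    module _ (x : Seaweed D₁ D₂ D₃) where
      P : Mtx D₁ D₁
      P i j = x (pP i j)
      Q : Mtx D₂ D₁
      Q i j = x (pQ i j)
      R : Mtx D₂ D₂
      R i j = x (pR i j)
      S : Mtx D₂ D₃
      S i j = x (pS i j)
      T : Mtx D₃ D₃
      T i j = x (pT i j)

    lin-P : ∀ i j → Lin (λ x → P x i j)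
    lin-P i j = lin-at (pP i j)
    lin-Q : ∀ i j → Lin (λ x → Q x i j)
    lin-Q i j = lin-at (pQ i j)
    lin-R : ∀ i j → Lin (λ x → R x i j)
    lin-R i j = lin-at (pR i j)
    lin-S : ∀ i j → Lin (λ x → S x i j)
    lin-S i j = lin-at (pS i j)
    lin-T : ∀ i j → Lin (λ x → T x i j)
    lin-T i j = lin-at (pT i j)

    by-blocks : ∀ {x y : Seaweed D₁ D₂ D₃} → P x ≋ P y → Q x ≋ Q y → R x ≋ R y → S x ≋ S y → T x ≋ T y →
                ∀ i → x i ≈ y i
    by-blocks p q r s t (pP i j) = p i j
    by-blocks p q r s t (pQ i j) = q i j
    by-blocks p q r s t (pR i j) = r i j
    by-blocks p q r s t (pS i j) = s i j
    by-blocks p q r s t (pT i j) = t i j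

    -- The vanishing of f on all brackets [x, y], sorted by the block of y: `e₁` to `e₅` are the
    -- coefficients of `P y`, `Q y`, `R y`, `S y`, `T y`. Thus `e₂` and `e₄` say that (P, R, T)
    -- intertwines ξ₁ and ξ₃, and the others that it commutes with M₁, M₂, M₃ up to terms in Q and
    -- S.
    record Ker (f : Form D₁ D₂ D₃) (x : Seaweed D₁ D₂ D₃) : Set ℓ where
      constructor ker
      field
        e₁ : ∀ i j → (M₁ f · P x) i j + (ξ₁ f · Q x) i j ≈ (P x · M₁ f) i j
        e₂ : ∀ i j → (ξ₁ f · R x) i j ≈ (P x · ξ₁ f) i j
        e₃ : ∀ i j → (M₂ f · R x) i j ≈ (R x · M₂ f) i j + ((Q x · ξ₁ f) i j + (S x · ξ₃ f) i j)
        e₄ : ∀ i j → (ξ₃ f · R x) i j ≈ (T x · ξ₃ f) i j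
        e₅ : ∀ i j → (M₃ f · T x) i j + (ξ₃ f · S x) i j ≈ (T x · M₃ f) i j
    open Ker public

    -- The matrix of the form y ↦ f([x, y]) with respect to the coordinates of y.
    ad* : Form D₁ D₂ D₃ → Seaweed D₁ D₂ D₃ → Seaweed D₁ D₂ D₃
    ad* f x = blocks
      (λ i j → ((M₁ f · P x) j i + (ξ₁ f · Q x) j i) - (P x · M₁ f) j i)
      (λ i j → (ξ₁ f · R x) j i - (P x · ξ₁ f) j i)
      (λ i j → (M₂ f · R x) j i - ((R x · M₂ f) j i + ((Q x · ξ₁ f) j i + (S x · ξ₃ f) j i)))
      (λ i j → (ξ₃ f · R x) j i - (T x · ξ₃ f) j i)
      (λ i j → ((M₃ f · T x) j i + (ξ₃ f · S x) j i) - (T x · M₃ f) j i)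

    ker⇒ad* : ∀ {f x} → Ker f x → ∀ i → ad* f x i ≈ 0#
    ker⇒ad* k (pP i j) = x-y≈0 (e₁ k j i)
    ker⇒ad* k (pQ i j) = x-y≈0 (e₂ k j i)
    ker⇒ad* k (pR i j) = x-y≈0 (e₃ k j i)
    ker⇒ad* k (pS i j) = x-y≈0 (e₄ k j i)
    ker⇒ad* k (pT i j) = x-y≈0 (e₅ k j i)

    ad*⇒ker : ∀ {f x} → (∀ i → ad* f x i ≈ 0#) → Ker f x
    ad*⇒ker h = ker (λ i j → x-y≈0⁻¹ (h (pP j i))) (λ i j → x-y≈0⁻¹ (h (pQ j i)))
      (λ i j → x-y≈0⁻¹ (h (pR j i))) (λ i j → x-y≈0⁻¹ (h (pS j i))) (λ i j → x-y≈0⁻¹ (h (pT j i)))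

    ad*-linear : ∀ f → Linear (ad* f)
    ad*-linear f (pP i j) = lin-minus (lin-+ (lin-·ˡ (M₁ f) lin-P j i)
      (lin-·ˡ (ξ₁ f) lin-Q j i)) (lin-·ʳ (M₁ f) lin-P j i)
    ad*-linear f (pQ i j) = lin-minus (lin-·ˡ (ξ₁ f) lin-R j i)
      (lin-·ʳ (ξ₁ f) lin-P j i)
    ad*-linear f (pR i j) = lin-minus (lin-·ˡ (M₂ f) lin-R j i)
      (lin-+ (lin-·ʳ (M₂ f) lin-R j i)
        (lin-+ (lin-·ʳ (ξ₁ f) lin-Q j i) (lin-·ʳ (ξ₃ f) lin-S j i)))
    ad*-linear f (pS i j) = lin-minus (lin-·ˡ (ξ₃ f) lin-R j i)
      (lin-·ʳ (ξ₃ f) lin-T j i)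
    ad*-linear f (pT i j) = lin-minus (lin-+ (lin-·ˡ (M₃ f) lin-T j i)
      (lin-·ˡ (ξ₃ f) lin-S j i)) (lin-·ʳ (M₃ f) lin-T j i)

    Ker-congˣ : ∀ {f x y} → (∀ i → x i ≈ y i) → Ker f x → Ker f y
    Ker-congˣ {f} h k = ad*⇒ker (λ i → trans (sym (cong-lin (ad*-linear f i) h)) (ker⇒ad* k i))

    record _≈ᶠ_ (f g : Form D₁ D₂ D₃) : Set ℓ where
      constructor form≈
      field
        M₁≈ : M₁ f ≋ M₁ g
        M₂≈ : M₂ f ≋ M₂ g
        M₃≈ : M₃ f ≋ M₃ g
        ξ₁≈ : ξ₁ f ≋ ξ₁ g
        ξ₃≈ : ξ₃ f ≋ ξ₃ g

    Ker-congᶠ : ∀ {f g x} → f ≈ᶠ g → Ker f x → Ker g x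
    Ker-congᶠ {x = x} (form≈ m₁ m₂ m₃ x₁ x₃) (ker k₁ k₂ k₃ k₄ k₅) = ker
      (λ i j → via (+-cong (l m₁ (P x) i j) (l x₁ (Q x) i j)) (k₁ i j) (r (P x) m₁ i j))
      (λ i j → via (l x₁ (R x) i j) (k₂ i j) (r (P x) x₁ i j))
      (λ i j → via (l m₂ (R x) i j) (k₃ i j) (+-cong (r (R x) m₂ i j) (+-cong (r (Q x) x₁ i j) (r (S x) x₃ i j))))
      (λ i j → via (l x₃ (R x) i j) (k₄ i j) (r (T x) x₃ i j))
      (λ i j → via (+-cong (l m₃ (T x) i j) (l x₃ (S x) i j)) (k₅ i j) (r (T x) m₃ i j))
      where
      via : ∀ {a b c d} → a ≈ b → a ≈ c → c ≈ d → b ≈ d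
      via p q s = trans (sym p) (trans q s)
      l : ∀ {I J K} {A A′ : Mtx I J} → A ≋ A′ → (B : Mtx J K) → A · B ≋ A′ · B
      l p B = ·-cong p (λ _ _ → refl)
      r : ∀ {I J K} (A : Mtx I J) {B B′ : Mtx J K} → B ≋ B′ → A · B ≋ A · B′
      r A p = ·-cong {A = A} (λ _ _ → refl) p

-- Reductions between seaweeds

module Reductions {o ℓ : Level} (F : CharZeroField o ℓ) where
  open Kernels F public

  -- An isomorphism of kernels by linear maps of the ambient spaces. Extending after restricting is
  -- the identity only on the kernel, because it is the kernel equations that recover the
  -- coordinates forgotten by `restrict`.
  record _≅_ {D₁ D₂ D₃ E₁ E₂ E₃} (f : Form D₁ D₂ D₃) (g : Form E₁ E₂ E₃) : Set (o ⊔ ℓ) where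
    field
      restrict    : Seaweed D₁ D₂ D₃ → Seaweed E₁ E₂ E₃
      extend      : Seaweed E₁ E₂ E₃ → Seaweed D₁ D₂ D₃
      restrict-linear : Linear restrict
      extend-linear   : Linear extend
      restrict-extend : ∀ y i → restrict (extend y) i ≈ y i
      extend-restrict : ∀ {x} → Ker f x → ∀ i → x i ≈ extend (restrict x) i
      restrict-ker    : ∀ {x} → Ker f x → Ker g (restrict x)
      extend-ker      : ∀ {y} → Ker g y → Ker f (extend y)

  +0 : ∀ {a b} → b ≈ 0# → a + b ≈ a
  +0 p = trans (+-congˡ p) (+-identityʳ _)

  0+ : ∀ {a b} → a ≈ 0# → a + b ≈ b
  0+ p = trans (+-congʳ p) (+-identityˡ _)

  ∑-distribʳ-comm : ∀ {I} (a b c : El I → Carrier) →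
    ∑ {I} (λ i → (a i + b i) * c i) ≈ ∑ {I} (λ i → c i * a i) + ∑ {I} (λ i → c i * b i)
  ∑-distribʳ-comm {I} a b c = trans (∑-cong {I} (λ i → trans (*-comm _ _) (distribˡ _ _ _))) (∑-+ {I} _ _)

  ∑-distribˡ-comm : ∀ {I} (a b c : El I → Carrier) →
    ∑ {I} (λ i → c i * (a i + b i)) ≈ ∑ {I} (λ i → a i * c i) + ∑ {I} (λ i → b i * c i)
  ∑-distribˡ-comm {I} a b c = trans (∑-cong {I} (λ i → trans (*-comm _ _) (distribʳ _ _ _))) (∑-+ {I} _ _)

  ∑-distribˡ : ∀ {I} (a b c : El I → Carrier) →
    ∑ {I} (λ i → c i * (a i + b i)) ≈ ∑ {I} (λ i → c i * a i) + ∑ {I} (λ i → c i * b i)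
  ∑-distribˡ {I} a b c = trans (∑-cong {I} (λ i → distribˡ _ _ _)) (∑-+ {I} _ _)

  ∑-distribʳ : ∀ {I} (a b c : El I → Carrier) →
    ∑ {I} (λ i → (a i + b i) * c i) ≈ ∑ {I} (λ i → a i * c i) + ∑ {I} (λ i → b i * c i)
  ∑-distribʳ {I} a b c = trans (∑-cong {I} (λ i → distribʳ _ _ _)) (∑-+ {I} _ _)

  swapᶠ : ∀ {D₁ D₂ D₃} → Form D₁ D₂ D₃ → Form D₃ D₂ D₁
  swapᶠ f = form (M₃ f) (M₂ f) (M₁ f) (ξ₃ f) (ξ₁ f)

  swapˢ : ∀ {D₁ D₂ D₃} → Seaweed D₁ D₂ D₃ → Seaweed D₃ D₂ D₁
  swapˢ x = blocks (T x) (S x) (R x) (Q x) (P x)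

  swap-linear : ∀ {D₁ D₂ D₃} → Linear (swapˢ {D₁} {D₂} {D₃})
  swap-linear (pP i j) = lin-T i j
  swap-linear (pQ i j) = lin-S i j
  swap-linear (pR i j) = lin-R i j
  swap-linear (pS i j) = lin-Q i j
  swap-linear (pT i j) = lin-P i j

  swap-≅ : ∀ {D₁ D₂ D₃} (f : Form D₁ D₂ D₃) → f ≅ swapᶠ f
  swap-≅ f = record
    { restrict = swapˢ ; extend = swapˢ ; restrict-linear = swap-linear ; extend-linear = swap-linear
    ; restrict-extend = λ y → by-blocks {x = swapˢ (swapˢ y)} {y} ≋-refl ≋-refl ≋-refl ≋-refl ≋-refl
    ; extend-restrict = λ {x} _ → by-blocks {x = x} {swapˢ (swapˢ x)} ≋-refl ≋-refl ≋-refl ≋-refl ≋-refl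
    ; restrict-ker = λ (ker k₁ k₂ k₃ k₄ k₅) → ker k₅ k₄ (λ i j → trans (k₃ i j) (+-congˡ (+-comm _ _))) k₂ k₁
    ; extend-ker = λ (ker k₁ k₂ k₃ k₄ k₅) → ker k₅ k₄ (λ i j → trans (k₃ i j) (+-congˡ (+-comm _ _))) k₂ k₁ }

  -- Generic ξ₁ : V₂ → V₁ is injective when dim V₂ ≤ dim V₁: here V₁ = V₂ ⊕ C and ξ₁ is the inclusion.
  module Inclusion {C D₂ : Dim} where
    ξ⁰ : Mtx (D₂ ⊕ C) D₂
    ξ⁰ (inl i) j = δ i j
    ξ⁰ (inr i) j = 0#

  module Injective {C D₂ D₃ : Dim} (M₁ : Mtx (D₂ ⊕ C) (D₂ ⊕ C)) (M₂ : Mtx D₂ D₂) (M₃ : Mtx D₃ D₃)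
                   (ξ₃ : Mtx D₃ D₂) where
    open Inclusion {C} {D₂}

    full : Form (D₂ ⊕ C) D₂ D₃
    full = form M₁ M₂ M₃ ξ⁰ ξ₃

    A : Mtx D₂ D₂
    A i j = M₁ (inl i) (inl j)

    -- By `e₂` the matrix `P x` is block upper triangular with `R x` as its first diagonal block,
    -- and the rows `inl` of `e₁` solve for `Q x`. Substituted into `e₃`, this adds `A` to M₂; the
    -- rows `inr` of `e₁` become the new `e₁` and `e₂`, with the lower left block of M₁ as the new
    -- ξ₁.
    reduced : Form C D₂ D₃
    reduced = form (λ i j → M₁ (inr i) (inr j)) (λ i j → M₂ i j + M₁ (inl i) (inl j)) M₃
                   (λ i j → M₁ (inr i) (inl j)) ξ₃

    restr : Seaweed (D₂ ⊕ C) D₂ D₃ → Seaweed C D₂ D₃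
    restr x = blocks (λ i j → P x (inr i) (inr j)) (λ i j → P x (inl i) (inr j)) (R x) (S x) (T x)

    restr-linear : Linear restr
    restr-linear (pP i j) = lin-P (inr i) (inr j)
    restr-linear (pQ i j) = lin-P (inl i) (inr j)
    restr-linear (pR i j) = lin-R i j
    restr-linear (pS i j) = lin-S i j
    restr-linear (pT i j) = lin-T i j

    module _ (y : Seaweed C D₂ D₃) where
      P⁺ : Mtx (D₂ ⊕ C) (D₂ ⊕ C)
      P⁺ (inl i) (inl j) = R y i j
      P⁺ (inl i) (inr j) = Q y i j
      P⁺ (inr i) (inl j) = 0#
      P⁺ (inr i) (inr j) = P y i j

      Q⁺ : Mtx D₂ (D₂ ⊕ C)
      Q⁺ i (inl j) = (∑ {D₂} (λ k → R y i k * M₁ (inl k) (inl j)) + ∑ {C} (λ k → Q y i k * M₁ (inr k) (inl j)))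
                     - ∑ {D₂} (λ k → M₁ (inl i) (inl k) * R y k j)
      Q⁺ i (inr j) = (∑ {D₂} (λ k → R y i k * M₁ (inl k) (inr j)) + ∑ {C} (λ k → Q y i k * M₁ (inr k) (inr j)))
                     - (∑ {D₂} (λ k → M₁ (inl i) (inl k) * Q y k j) + ∑ {C} (λ k → M₁ (inl i) (inr k) * P y k j))

      ext : Seaweed (D₂ ⊕ C) D₂ D₃
      ext = blocks P⁺ Q⁺ (R y) (S y) (T y)

    ext-linear : Linear ext
    ext-linear (pP (inl i) (inl j)) = lin-R i j
    ext-linear (pP (inl i) (inr j)) = lin-Q i j
    ext-linear (pP (inr i) (inl j)) = lin-0
    ext-linear (pP (inr i) (inr j)) = lin-P i j
    ext-linear (pQ i (inl j)) = lin-minus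
      (lin-+ (lin-∑ {J = D₂} (λ k → lin-*ʳ _ (lin-R i k))) (lin-∑ {J = C} (λ k → lin-*ʳ _ (lin-Q i k))))
      (lin-∑ {J = D₂} (λ k → lin-*ˡ _ (lin-R k j)))
    ext-linear (pQ i (inr j)) = lin-minus
      (lin-+ (lin-∑ {J = D₂} (λ k → lin-*ʳ _ (lin-R i k))) (lin-∑ {J = C} (λ k → lin-*ʳ _ (lin-Q i k))))
      (lin-+ (lin-∑ {J = D₂} (λ k → lin-*ˡ _ (lin-Q k j))) (lin-∑ {J = C} (λ k → lin-*ˡ _ (lin-P k j))))
    ext-linear (pR i j) = lin-R i j
    ext-linear (pS i j) = lin-S i j
    ext-linear (pT i j) = lin-T i j

    -- Where the equations of `reduced` sit among those of `full`; the zeros are the equations that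
    -- `ext` satisfies identically.
    spread : Seaweed C D₂ D₃ → Seaweed (D₂ ⊕ C) D₂ D₃
    spread z (pP (inl i) (inl j)) = 0#
    spread z (pP (inr i) (inl j)) = 0#
    spread z (pP (inl i) (inr j)) = z (pQ i j)
    spread z (pP (inr i) (inr j)) = z (pP i j)
    spread z (inr (inl _))        = 0#
    spread z (inr (inr i))        = z (inr (inr i))

    -- An identity for every `y`, not only on the kernel: `ext-ker` follows from it, and so does
    -- `restr-ker` by way of `ext-restr`.
    ad*-ext : ∀ y i → ad* full (ext y) i ≈ spread (ad* reduced y) i
    ad*-ext y (pP (inl j) (inl i)) =
      trans (+-congʳ (+-cong (+0 (∑-zeroʳ {C} _)) (∑-δˡ i _)))
            (solve 3 (λ a u v → (a :+ ((u :+ v) :- a)) :- (u :+ v) := :0) refl _ _ _)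
    ad*-ext y (pP (inr j) (inl i)) =
      trans (+-congʳ (+-congˡ (∑-δˡ i _)))
            (solve 4 (λ a b u v → ((a :+ b) :+ ((u :+ v) :- (a :+ b))) :- (u :+ v) := :0) refl _ _ _ _)
    ad*-ext y (pP (inl j) (inr i)) =
      +-cong (trans (+-cong (+0 (∑-zeroʳ {C} _)) (∑-zeroˡ {D₂} _)) (+-identityʳ _)) (-‿cong (0+ (∑-zeroˡ {D₂} _)))
    ad*-ext y (pP (inr j) (inr i)) =
      trans (+-cong (+-congˡ (∑-zeroˡ {D₂} _)) (-‿cong (0+ (∑-zeroˡ {D₂} _))))
            (solve 3 (λ a b c → ((a :+ b) :+ :0) :- c := (b :+ a) :- c) refl _ _ _)
    ad*-ext y (pQ j (inl i)) =
      trans (+-cong (∑-δˡ i _) (-‿cong (trans (+0 (∑-zeroʳ {C} _)) (∑-δʳ j _)))) (-‿inverseʳ _)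
    ad*-ext y (pQ j (inr i)) =
      trans (+-cong (∑-zeroˡ {D₂} _) (-‿cong (trans (+0 (∑-zeroʳ {C} _)) (∑-zeroˡ {D₂} _)))) (-‿inverseʳ _)
    ad*-ext y (pR j i) =
      trans (+-congˡ (-‿cong (+-congˡ (+-congʳ (trans (+0 (∑-zeroʳ {C} _)) (∑-δʳ j _))))))
      (trans (solve 6 (λ a b u v w s → a :- (b :+ (((u :+ v) :- w) :+ s)) := (a :+ w) :- ((b :+ u) :+ (v :+ s))) refl _ _ _ _ _ _)
        (sym (+-cong (·-distribʳ M₂ A (R y) i j) (-‿cong (+-congʳ (·-distribˡ (R y) M₂ A i j))))))
    ad*-ext y (pS j i) = refl
    ad*-ext y (pT j i) = refl

    ext-restr : ∀ {x} → Ker full x → ∀ i → x i ≈ ext (restr x) i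
    ext-restr {x} k = by-blocks {x = x} {ext (restr x)} p q ≋-refl ≋-refl ≋-refl
      where
      p : P x ≋ P⁺ (restr x)
      p (inl i) (inl j) = sym (trans (sym (∑-δˡ i _)) (trans (e₂ k (inl i) j) (trans (+0 (∑-zeroʳ {C} _)) (∑-δʳ j _))))
      p (inl i) (inr j) = refl
      p (inr i) (inl j) = sym (trans (sym (∑-zeroˡ {D₂} _)) (trans (e₂ k (inr i) j) (trans (+0 (∑-zeroʳ {C} _)) (∑-δʳ j _))))
      p (inr i) (inr j) = refl
      from-e₁ : ∀ {a b c q} → (a + b) + q ≈ c → b ≈ 0# → q ≈ c - a
      from-e₁ {a} {b} {c} {q} h b≈0 = trans (solve 3 (λ a b q → q := ((a :+ b) :+ q) :- (a :+ b)) refl a b q)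
                                            (+-cong h (-‿cong (+0 b≈0)))
      q : Q x ≋ Q⁺ (restr x)
      q i (inl j) = trans (from-e₁ (trans (+-congˡ (sym (∑-δˡ i _))) (e₁ k (inl i) (inl j)))
                                   (∑-0 {C} (λ c → trans (*-congˡ (p (inr c) (inl j))) (zeroʳ _))))
        (+-cong (+-congʳ (∑-cong {D₂} (λ d → *-congʳ (p (inl i) (inl d)))))
                (-‿cong (∑-cong {D₂} (λ d → *-congˡ (p (inl d) (inl j))))))
      q i (inr j) = trans (solve 2 (λ a q → q := (a :+ q) :- a) refl _ _)
        (+-congʳ (trans (trans (+-congˡ (sym (∑-δˡ i _))) (e₁ k (inl i) (inr j)))
                        (+-congʳ (∑-cong {D₂} (λ d → *-congʳ (p (inl i) (inl d)))))))

    ext-ker : ∀ {y} → Ker reduced y → Ker full (ext y)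
    ext-ker {y} k = ad*⇒ker (λ i → trans (ad*-ext y i) (z i))
      where
      z : ∀ i → spread (ad* reduced y) i ≈ 0#
      z (pP (inl i) (inl j)) = refl
      z (pP (inr i) (inl j)) = refl
      z (pP (inl i) (inr j)) = ker⇒ad* k (pQ i j)
      z (pP (inr i) (inr j)) = ker⇒ad* k (pP i j)
      z (inr (inl _))        = refl
      z (inr (inr i))        = ker⇒ad* k (inr (inr i))

    restr-ker : ∀ {x} → Ker full x → Ker reduced (restr x)
    restr-ker {x} k = ad*⇒ker z
      where
      k′ : ∀ i → spread (ad* reduced (restr x)) i ≈ 0#
      k′ i = trans (sym (ad*-ext (restr x) i)) (ker⇒ad* (Ker-congˣ (ext-restr k) k) i)
      z : ∀ i → ad* reduced (restr x) i ≈ 0#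
      z (pP i j)      = k′ (pP (inr i) (inr j))
      z (pQ i j)      = k′ (pP (inl i) (inr j))
      z (inr (inr i)) = k′ (inr (inr i))

    full≅reduced : full ≅ reduced
    full≅reduced = record
      { restrict = restr ; extend = ext ; restrict-linear = restr-linear ; extend-linear = ext-linear
      ; restrict-extend = λ y → by-blocks {x = restr (ext y)} {y} ≋-refl ≋-refl ≋-refl ≋-refl ≋-refl
      ; extend-restrict = ext-restr ; restrict-ker = restr-ker ; extend-ker = ext-ker }

  -- Generic V₂ → V₁ ⊕ V₃ is surjective when dim V₂ ≥ dim V₁ + dim V₃: here V₂ = V₁ ⊕ V₃ ⊕ Z and
  -- ξ₁, ξ₃ are the projections.
  module Projections {D₁ Z D₃ : Dim} where
    ξ₁⁰ : Mtx D₁ (D₁ ⊕ D₃ ⊕ Z)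
    ξ₁⁰ i (inl j) = δ i j
    ξ₁⁰ i (inr j) = 0#

    ξ₃⁰ : Mtx D₃ (D₁ ⊕ D₃ ⊕ Z)
    ξ₃⁰ i (in₁ j) = 0#
    ξ₃⁰ i (in₂ j) = δ i j
    ξ₃⁰ i (in₃ j) = 0#

    Qξ₁⁰ : ∀ (A : Mtx (D₁ ⊕ D₃ ⊕ Z) D₁) i j → (A · ξ₁⁰) i (in₁ j) ≈ A i j
    Qξ₁⁰ A i j = ∑-δʳ j (A i)
    Sξ₃⁰ : ∀ (A : Mtx (D₁ ⊕ D₃ ⊕ Z) D₃) i j → (A · ξ₃⁰) i (in₂ j) ≈ A i j
    Sξ₃⁰ A i j = ∑-δʳ j (A i)
    ξ₁⁰· : ∀ {K} (A : Mtx (D₁ ⊕ D₃ ⊕ Z) K) i j → (ξ₁⁰ · A) i j ≈ A (in₁ i) j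
    ξ₁⁰· A i j = trans (+0 (∑-zeroˡ {D₃ ⊕ Z} (λ k → A (inr k) j))) (∑-δˡ i (λ k → A (in₁ k) j))
    ξ₃⁰· : ∀ {K} (A : Mtx (D₁ ⊕ D₃ ⊕ Z) K) i j → (ξ₃⁰ · A) i j ≈ A (in₂ i) j
    ξ₃⁰· A i j = trans (0+ (∑-zeroˡ {D₁} _)) (trans (+0 (∑-zeroˡ {Z} _)) (∑-δˡ i (λ k → A (in₂ k) j)))

  module Surjective {D₁ Z D₃ : Dim} (M₁ : Mtx D₁ D₁) (M₂ : Mtx (D₁ ⊕ D₃ ⊕ Z) (D₁ ⊕ D₃ ⊕ Z))
                    (M₃ : Mtx D₃ D₃) where
    open Projections {D₁} {Z} {D₃}

    full : Form D₁ (D₁ ⊕ D₃ ⊕ Z) D₃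
    full = form M₁ M₂ M₃ ξ₁⁰ ξ₃⁰

    A₁ : Mtx D₁ D₁
    A₁ i j = M₂ (in₁ i) (in₁ j)
    A₃ : Mtx D₃ D₃
    A₃ i j = M₂ (in₂ i) (in₂ j)

    -- Here `e₂` and `e₄` express the rows `in₁` and `in₂` of `R x` by `P x` and `T x`, and the
    -- columns `in₁` and `in₂` of `e₃` solve for `Q x` and `S x`. The column `in₃` of `e₃` carries
    -- the new `e₂`, `e₃`, `e₄`; substituting into `e₁` and `e₅` adds diagonal blocks of M₂ to M₁
    -- and M₃.
    reduced : Form D₁ Z D₃
    reduced = form (λ i j → M₁ i j + A₁ i j) (λ i j → M₂ (in₃ i) (in₃ j)) (λ i j → M₃ i j + A₃ i j)
                   (λ i j → M₂ (in₁ i) (in₃ j)) (λ i j → M₂ (in₂ i) (in₃ j))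

    restr : Seaweed D₁ (D₁ ⊕ D₃ ⊕ Z) D₃ → Seaweed D₁ Z D₃
    restr x = blocks (P x) (λ i j → R x (in₃ i) (in₁ j)) (λ i j → R x (in₃ i) (in₃ j))
                     (λ i j → R x (in₃ i) (in₂ j)) (T x)

    restr-linear : Linear restr
    restr-linear (pP i j) = lin-P i j
    restr-linear (pQ i j) = lin-R (in₃ i) (in₁ j)
    restr-linear (pR i j) = lin-R (in₃ i) (in₃ j)
    restr-linear (pS i j) = lin-R (in₃ i) (in₂ j)
    restr-linear (pT i j) = lin-T i j

    module _ (y : Seaweed D₁ Z D₃) where
      R⁺ : Mtx (D₁ ⊕ D₃ ⊕ Z) (D₁ ⊕ D₃ ⊕ Z)
      R⁺ (in₁ i) (in₁ j) = P y i j
      R⁺ (in₁ i) (inr _) = 0#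
      R⁺ (in₂ i) (in₁ j) = 0#
      R⁺ (in₂ i) (in₂ j) = T y i j
      R⁺ (in₂ i) (in₃ j) = 0#
      R⁺ (in₃ i) (in₁ j) = Q y i j
      R⁺ (in₃ i) (in₂ j) = S y i j
      R⁺ (in₃ i) (in₃ j) = R y i j

      Q⁺ : Mtx (D₁ ⊕ D₃ ⊕ Z) D₁
      Q⁺ i j = (M₂ · R⁺) i (in₁ j) - (R⁺ · M₂) i (in₁ j)

      S⁺ : Mtx (D₁ ⊕ D₃ ⊕ Z) D₃
      S⁺ i j = (M₂ · R⁺) i (in₂ j) - (R⁺ · M₂) i (in₂ j)

      ext : Seaweed D₁ (D₁ ⊕ D₃ ⊕ Z) D₃
      ext = blocks (P y) Q⁺ R⁺ S⁺ (T y)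

    R⁺-linear : ∀ i j → Lin (λ y → R⁺ y i j)
    R⁺-linear (in₁ i) (in₁ j) = lin-P i j
    R⁺-linear (in₁ i) (inr _) = lin-0
    R⁺-linear (in₂ i) (in₁ j) = lin-0
    R⁺-linear (in₂ i) (in₂ j) = lin-T i j
    R⁺-linear (in₂ i) (in₃ j) = lin-0
    R⁺-linear (in₃ i) (in₁ j) = lin-Q i j
    R⁺-linear (in₃ i) (in₂ j) = lin-S i j
    R⁺-linear (in₃ i) (in₃ j) = lin-R i j

    ext-linear : Linear ext
    ext-linear (pP i j) = lin-P i j
    ext-linear (pQ i j) =
      lin-minus (lin-·ˡ M₂ R⁺-linear i (in₁ j)) (lin-·ʳ M₂ R⁺-linear i (in₁ j))
    ext-linear (pR i j) = R⁺-linear i j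
    ext-linear (pS i j) =
      lin-minus (lin-·ˡ M₂ R⁺-linear i (in₂ j)) (lin-·ʳ M₂ R⁺-linear i (in₂ j))
    ext-linear (pT i j) = lin-T i j

    spread : Seaweed D₁ Z D₃ → Seaweed D₁ (D₁ ⊕ D₃ ⊕ Z) D₃
    spread z = blocks (P z) (λ _ _ → 0#)
      (λ { (in₃ i) (in₁ j) → Q z i j
         ; (in₃ i) (in₂ j) → S z i j
         ; (in₃ i) (in₃ j) → R z i j
         ; (in₁ i) j → 0#
         ; (in₂ i) j → 0# })
      (λ _ _ → 0#) (T z)

    ad*-ext : ∀ y i → ad* full (ext y) i ≈ spread (ad* reduced y) i
    ad*-ext y (pP j i) =
      trans (+-congʳ (+-congˡ (trans (ξ₁⁰· (Q⁺ y) i j)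
              (+-cong (+-congˡ (0+ (∑-zeroʳ {D₃} _))) (-‿cong (+0 (∑-zeroˡ {D₃ ⊕ Z} (λ k → M₂ (inr k) (in₁ j)))))))))
      (trans (solve 5 (λ m a q r s → (m :+ ((a :+ q) :- r)) :- s := ((m :+ a) :+ q) :- (s :+ r)) refl _ _ _ _ _)
        (sym (+-cong (+-congʳ (·-distribʳ M₁ A₁ (P y) i j)) (-‿cong (·-distribˡ (P y) M₁ A₁ i j)))))
    ad*-ext y (pT j i) =
      trans (+-congʳ (+-congˡ (trans (ξ₃⁰· (S⁺ y) i j)
              (+-cong (0+ (∑-zeroʳ {D₁} _)) (-‿cong (trans (0+ (∑-zeroˡ {D₁} _)) (+0 (∑-zeroˡ {Z} _))))))))
      (trans (solve 5 (λ m a q r s → (m :+ ((a :+ q) :- r)) :- s := ((m :+ a) :+ q) :- (s :+ r)) refl _ _ _ _ _)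
        (sym (+-cong (+-congʳ (·-distribʳ M₃ A₃ (T y) i j)) (-‿cong (·-distribˡ (T y) M₃ A₃ i j)))))
    ad*-ext y (pQ (in₁ j) i) = x-y≈0 (trans (ξ₁⁰· (R⁺ y) i (in₁ j)) (sym (∑-δʳ j (P y i))))
    ad*-ext y (pQ (inr j) i) = x-y≈0 (trans (ξ₁⁰· (R⁺ y) i (inr j)) (sym (∑-zeroʳ {D₁} _)))
    ad*-ext y (pS (in₁ j) i) =
      x-y≈0 (trans (ξ₃⁰· (R⁺ y) i (in₁ j)) (sym (∑-zeroʳ {D₃} _)))
    ad*-ext y (pS (in₂ j) i) =
      x-y≈0 (trans (ξ₃⁰· (R⁺ y) i (in₂ j)) (sym (∑-δʳ j (T y i))))
    ad*-ext y (pS (in₃ j) i) =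
      x-y≈0 (trans (ξ₃⁰· (R⁺ y) i (in₃ j)) (sym (∑-zeroʳ {D₃} _)))
    ad*-ext y (pR (in₁ j) i) =
      trans (+-congˡ (-‿cong (+-congˡ (+-cong (Qξ₁⁰ (Q⁺ y) i j) (∑-zeroʳ {D₃} _)))))
            (solve 2 (λ a b → a :- (b :+ ((a :- b) :+ :0)) := :0) refl _ _)
    ad*-ext y (pR (in₂ j) i) =
      trans (+-congˡ (-‿cong (+-congˡ (+-cong (∑-zeroʳ {D₁} _) (Sξ₃⁰ (S⁺ y) i j)))))
            (solve 2 (λ a b → a :- (b :+ (:0 :+ (a :- b))) := :0) refl _ _)
    ad*-ext y (pR (in₃ j) (in₁ i)) =
      trans (+-cong (trans (0+ (∑-zeroʳ {D₁} _)) (0+ (∑-zeroʳ {D₃} _)))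
                    (-‿cong (+-cong (+0 (∑-zeroˡ {D₃ ⊕ Z} (λ k → M₂ (inr k) (in₃ j)))) (+-cong (∑-zeroʳ {D₁} _) (∑-zeroʳ {D₃} _)))))
            (solve 2 (λ a b → a :- (b :+ (:0 :+ :0)) := a :- b) refl _ _)
    ad*-ext y (pR (in₃ j) (in₂ i)) =
      trans (+-cong (trans (0+ (∑-zeroʳ {D₁} _)) (0+ (∑-zeroʳ {D₃} _)))
                    (-‿cong (+-cong (trans (0+ (∑-zeroˡ {D₁} _)) (+0 (∑-zeroˡ {Z} _)))
                                    (+-cong (∑-zeroʳ {D₁} _) (∑-zeroʳ {D₃} _)))))
            (solve 2 (λ a b → a :- (b :+ (:0 :+ :0)) := a :- b) refl _ _)
    ad*-ext y (pR (in₃ j) (in₃ i)) =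
      trans (+-cong (trans (0+ (∑-zeroʳ {D₁} _)) (0+ (∑-zeroʳ {D₃} _)))
                    (-‿cong (+-congˡ (+-cong (∑-zeroʳ {D₁} _) (∑-zeroʳ {D₃} _)))))
            (solve 4 (λ a b c d → a :- ((b :+ (c :+ d)) :+ (:0 :+ :0)) := a :- (d :+ (b :+ c))) refl _ _ _ _)

    ext-restr : ∀ {x} → Ker full x → ∀ i → x i ≈ ext (restr x) i
    ext-restr {x} k = by-blocks {x = x} {ext (restr x)} ≋-refl q r s ≋-refl
      where
      r : R x ≋ R⁺ (restr x)
      r (in₁ i) (in₁ j) = trans (sym (ξ₁⁰· (R x) i (in₁ j))) (trans (e₂ k i (in₁ j)) (∑-δʳ j (P x i)))
      r (in₁ i) (inr j) = trans (sym (ξ₁⁰· (R x) i (inr j))) (trans (e₂ k i (inr j)) (∑-zeroʳ {D₁} _))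
      r (in₂ i) (in₁ j) = trans (sym (ξ₃⁰· (R x) i (in₁ j))) (trans (e₄ k i (in₁ j)) (∑-zeroʳ {D₃} _))
      r (in₂ i) (in₂ j) = trans (sym (ξ₃⁰· (R x) i (in₂ j))) (trans (e₄ k i (in₂ j)) (∑-δʳ j (T x i)))
      r (in₂ i) (in₃ j) = trans (sym (ξ₃⁰· (R x) i (in₃ j))) (trans (e₄ k i (in₃ j)) (∑-zeroʳ {D₃} _))
      r (in₃ i) (in₁ j) = refl
      r (in₃ i) (in₂ j) = refl
      r (in₃ i) (in₃ j) = refl
      commutator : ∀ i j → (M₂ · R x) i j - (R x · M₂) i j ≈ (M₂ · R⁺ (restr x)) i j - (R⁺ (restr x) · M₂) i j
      commutator i j = +-cong (·-cong {A = M₂} ≋-refl r i j) (-‿cong (·-cong r (≋-refl {A = M₂}) i j))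
      from-e₃ : ∀ {a b c} → a ≈ b + c → c ≈ a - b
      from-e₃ {a} {b} {c} h = trans (solve 2 (λ b c → c := (b :+ c) :- b) refl b c) (+-congʳ (sym h))
      q : Q x ≋ Q⁺ (restr x)
      q i j = trans (from-e₃ (trans (e₃ k i (in₁ j)) (+-congˡ (trans (+0 (∑-zeroʳ {D₃} _)) (Qξ₁⁰ (Q x) i j)))))
                    (commutator i (in₁ j))
      s : S x ≋ S⁺ (restr x)
      s i j = trans (from-e₃ (trans (e₃ k i (in₂ j)) (+-congˡ (trans (0+ (∑-zeroʳ {D₁} _)) (Sξ₃⁰ (S x) i j)))))
                    (commutator i (in₂ j))

    ext-ker : ∀ {y} → Ker reduced y → Ker full (ext y)
    ext-ker {y} k = ad*⇒ker (λ i → trans (ad*-ext y i) (z i))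
      where
      z : ∀ i → spread (ad* reduced y) i ≈ 0#
      z (pP i j)             = ker⇒ad* k (pP i j)
      z (pQ i j)             = refl
      z (pR (in₃ i) (in₁ j)) = ker⇒ad* k (pQ i j)
      z (pR (in₃ i) (in₂ j)) = ker⇒ad* k (pS i j)
      z (pR (in₃ i) (in₃ j)) = ker⇒ad* k (pR i j)
      z (pR (in₁ i) j)       = refl
      z (pR (in₂ i) j)       = refl
      z (pS i j)             = refl
      z (pT i j)             = ker⇒ad* k (pT i j)

    restr-ker : ∀ {x} → Ker full x → Ker reduced (restr x)
    restr-ker {x} k = ad*⇒ker z
      where
      k′ : ∀ i → spread (ad* reduced (restr x)) i ≈ 0#
      k′ i = trans (sym (ad*-ext (restr x) i)) (ker⇒ad* (Ker-congˣ (ext-restr k) k) i)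
      z : ∀ i → ad* reduced (restr x) i ≈ 0#
      z (pP i j) = k′ (pP i j)
      z (pQ i j) = k′ (pR (in₃ i) (in₁ j))
      z (pR i j) = k′ (pR (in₃ i) (in₃ j))
      z (pS i j) = k′ (pR (in₃ i) (in₂ j))
      z (pT i j) = k′ (pT i j)

    full≅reduced : full ≅ reduced
    full≅reduced = record
      { restrict = restr ; extend = ext ; restrict-linear = restr-linear ; extend-linear = ext-linear
      ; restrict-extend = λ y → by-blocks {x = restr (ext y)} {y} ≋-refl ≋-refl ≋-refl ≋-refl ≋-refl
      ; extend-restrict = ext-restr ; restrict-ker = restr-ker ; extend-ker = ext-ker }

  -- When dim V₁, dim V₃ ≤ dim V₂ ≤ dim V₁ + dim V₃, generic kernels K = ker ξ₃ and J = ker ξ₁ are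
  -- independent: here V₂ = K ⊕ J ⊕ L, V₁ = K ⊕ L, V₃ = J ⊕ L and ξ₁, ξ₃ are the projections. The roles
  -- of source and target are exchanged in the reduced problem, whence the transposes.
  module TransverseProjections {K L J : Dim} where
    ξ₁⁰ : Mtx (K ⊕ L) (K ⊕ J ⊕ L)
    ξ₁⁰ (inl i) (in₁ j) = δ i j
    ξ₁⁰ (inl i) (inr j) = 0#
    ξ₁⁰ (inr i) (in₁ j) = 0#
    ξ₁⁰ (inr i) (in₂ j) = 0#
    ξ₁⁰ (inr i) (in₃ j) = δ i j

    ξ₃⁰ : Mtx (J ⊕ L) (K ⊕ J ⊕ L)
    ξ₃⁰ i (inl j) = 0#
    ξ₃⁰ i (inr j) = δ i j

    ξ₁⁰·₁ : ∀ {N} (A : Mtx (K ⊕ J ⊕ L) N) i j → (ξ₁⁰ · A) (inl i) j ≈ A (in₁ i) j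
    ξ₁⁰·₁ A i j = trans (+0 (∑-zeroˡ {J ⊕ L} (λ k → A (inr k) j))) (∑-δˡ i (λ k → A (in₁ k) j))
    ξ₁⁰·₂ : ∀ {N} (A : Mtx (K ⊕ J ⊕ L) N) i j → (ξ₁⁰ · A) (inr i) j ≈ A (in₃ i) j
    ξ₁⁰·₂ A i j = trans (0+ (∑-zeroˡ {K} _)) (trans (0+ (∑-zeroˡ {J} _)) (∑-δˡ i (λ k → A (in₃ k) j)))
    ξ₃⁰· : ∀ {N} (A : Mtx (K ⊕ J ⊕ L) N) i j → (ξ₃⁰ · A) i j ≈ A (inr i) j
    ξ₃⁰· A i j = trans (0+ (∑-zeroˡ {K} _)) (∑-δˡ i (λ k → A (inr k) j))
    ·ξ₁⁰₁ : ∀ {N} (A : Mtx N (K ⊕ L)) i j → (A · ξ₁⁰) i (in₁ j) ≈ A i (inl j)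
    ·ξ₁⁰₁ A i j = trans (+0 (∑-zeroʳ {L} _)) (∑-δʳ j (λ k → A i (inl k)))
    ·ξ₁⁰₂ : ∀ {N} (A : Mtx N (K ⊕ L)) i j → (A · ξ₁⁰) i (in₂ j) ≈ 0#
    ·ξ₁⁰₂ A i j = trans (+0 (∑-zeroʳ {L} _)) (∑-zeroʳ {K} _)
    ·ξ₁⁰₃ : ∀ {N} (A : Mtx N (K ⊕ L)) i j → (A · ξ₁⁰) i (in₃ j) ≈ A i (inr j)
    ·ξ₁⁰₃ A i j = trans (0+ (∑-zeroʳ {K} _)) (∑-δʳ j (λ k → A i (inr k)))
    ·ξ₃⁰₁ : ∀ {N} (A : Mtx N (J ⊕ L)) i j → (A · ξ₃⁰) i (in₁ j) ≈ 0#
    ·ξ₃⁰₁ A i j = ∑-zeroʳ {J ⊕ L} (A i)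
    ·ξ₃⁰₂ : ∀ {N} (A : Mtx N (J ⊕ L)) i j → (A · ξ₃⁰) i (inr j) ≈ A i j
    ·ξ₃⁰₂ A i j = ∑-δʳ j (A i)

  module Transverse {K L J : Dim} (M₁ : Mtx (K ⊕ L) (K ⊕ L)) (M₂ : Mtx (K ⊕ J ⊕ L) (K ⊕ J ⊕ L))
                    (M₃ : Mtx (J ⊕ L) (J ⊕ L)) where
    open TransverseProjections {K} {L} {J}

    full : Form (K ⊕ L) (K ⊕ J ⊕ L) (J ⊕ L)
    full = form M₁ M₂ M₃ ξ₁⁰ ξ₃⁰

    -- Row `in₃` of `R x` is given by `e₂` through `P x` and by `e₄` through `T x`. Agreement forces
    -- `P x` and `T x` to be block upper triangular with the same L block. The free off-diagonal
    -- data are then maps L → K and L → J, opposite in direction to the blocks Q and S.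
    reduced : Form K L J
    reduced = form
      (λ i j → M₁ (inl j) (inl i) + M₂ (in₁ j) (in₁ i))
      (λ i j → M₁ (inr j) (inr i) + (M₃ (inr j) (inr i) + M₂ (in₃ j) (in₃ i)))
      (λ i j → M₃ (inl j) (inl i) + M₂ (in₂ j) (in₂ i))
      (λ i j → M₁ (inr j) (inl i) + M₂ (in₃ j) (in₁ i))
      (λ i j → M₃ (inr j) (inl i) + M₂ (in₃ j) (in₂ i))

    restr : Seaweed (K ⊕ L) (K ⊕ J ⊕ L) (J ⊕ L) → Seaweed K L J
    restr x = blocks (λ i j → P x (inl j) (inl i)) (λ i j → P x (inl j) (inr i))
                     (λ i j → R x (in₃ j) (in₃ i))
                     (λ i j → T x (inl j) (inr i)) (λ i j → T x (inl j) (inl i))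

    restr-linear : Linear restr
    restr-linear (pP i j) = lin-P (inl j) (inl i)
    restr-linear (pQ i j) = lin-P (inl j) (inr i)
    restr-linear (pR i j) = lin-R (in₃ j) (in₃ i)
    restr-linear (pS i j) = lin-T (inl j) (inr i)
    restr-linear (pT i j) = lin-T (inl j) (inl i)

    module _ (y : Seaweed K L J) where
      P⁺ : Mtx (K ⊕ L) (K ⊕ L)
      P⁺ (inl i) (inl j) = P y j i
      P⁺ (inl i) (inr j) = Q y j i
      P⁺ (inr i) (inl j) = 0#
      P⁺ (inr i) (inr j) = R y j i

      T⁺ : Mtx (J ⊕ L) (J ⊕ L)
      T⁺ (inl i) (inl j) = T y j i
      T⁺ (inl i) (inr j) = S y j i
      T⁺ (inr i) (inl j) = 0#
      T⁺ (inr i) (inr j) = R y j i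

      R⁺ : Mtx (K ⊕ J ⊕ L) (K ⊕ J ⊕ L)
      R⁺ (in₁ i) (in₁ j) = P y j i
      R⁺ (in₁ i) (in₂ j) = 0#
      R⁺ (in₁ i) (in₃ j) = Q y j i
      R⁺ (in₂ i) (in₁ j) = 0#
      R⁺ (in₂ i) (in₂ j) = T y j i
      R⁺ (in₂ i) (in₃ j) = S y j i
      R⁺ (in₃ i) (in₁ j) = 0#
      R⁺ (in₃ i) (in₂ j) = 0#
      R⁺ (in₃ i) (in₃ j) = R y j i

      -- Some blocks are determined twice: the columns `inl` of Q in the rows `in₁` and `in₃` by
      -- `e₁` and `e₃`, those of S in the rows `in₂` and `in₃` by `e₃` and `e₅`; and at (`in₃`,
      -- `in₃`) `e₃` gives the sum of two blocks known from `e₁` and `e₅`. These five agreements are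
      -- the equations of `reduced`.
      Q⁺ : Mtx (K ⊕ J ⊕ L) (K ⊕ L)
      Q⁺ i       (inl j) = (M₂ · R⁺) i (in₁ j) - (R⁺ · M₂) i (in₁ j)
      Q⁺ (in₁ i) (inr j) = - ((M₁ · P⁺) (inl i) (inr j) - (P⁺ · M₁) (inl i) (inr j))
      Q⁺ (in₂ i) (inr j) = ((M₂ · R⁺) (in₂ i) (in₃ j) - (R⁺ · M₂) (in₂ i) (in₃ j))
                           + ((M₃ · T⁺) (inl i) (inr j) - (T⁺ · M₃) (inl i) (inr j))
      Q⁺ (in₃ i) (inr j) = - ((M₁ · P⁺) (inr i) (inr j) - (P⁺ · M₁) (inr i) (inr j))

      S⁺ : Mtx (K ⊕ J ⊕ L) (J ⊕ L)
      S⁺ i       (inl j) = (M₂ · R⁺) i (in₂ j) - (R⁺ · M₂) i (in₂ j)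
      S⁺ (in₁ i) (inr j) = ((M₂ · R⁺) (in₁ i) (in₃ j) - (R⁺ · M₂) (in₁ i) (in₃ j))
                           + ((M₁ · P⁺) (inl i) (inr j) - (P⁺ · M₁) (inl i) (inr j))
      S⁺ (in₂ i) (inr j) = - ((M₃ · T⁺) (inl i) (inr j) - (T⁺ · M₃) (inl i) (inr j))
      S⁺ (in₃ i) (inr j) = - ((M₃ · T⁺) (inr i) (inr j) - (T⁺ · M₃) (inr i) (inr j))

      ext : Seaweed (K ⊕ L) (K ⊕ J ⊕ L) (J ⊕ L)
      ext = blocks P⁺ Q⁺ R⁺ S⁺ T⁺

    P⁺-linear : ∀ i j → Lin (λ y → P⁺ y i j)
    P⁺-linear (inl i) (inl j) = lin-P j i
    P⁺-linear (inl i) (inr j) = lin-Q j i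
    P⁺-linear (inr i) (inl j) = lin-0
    P⁺-linear (inr i) (inr j) = lin-R j i

    T⁺-linear : ∀ i j → Lin (λ y → T⁺ y i j)
    T⁺-linear (inl i) (inl j) = lin-T j i
    T⁺-linear (inl i) (inr j) = lin-S j i
    T⁺-linear (inr i) (inl j) = lin-0
    T⁺-linear (inr i) (inr j) = lin-R j i

    R⁺-linear : ∀ i j → Lin (λ y → R⁺ y i j)
    R⁺-linear (in₁ i) (in₁ j) = lin-P j i
    R⁺-linear (in₁ i) (in₂ j) = lin-0
    R⁺-linear (in₁ i) (in₃ j) = lin-Q j i
    R⁺-linear (in₂ i) (in₁ j) = lin-0
    R⁺-linear (in₂ i) (in₂ j) = lin-T j i
    R⁺-linear (in₂ i) (in₃ j) = lin-S j i
    R⁺-linear (in₃ i) (in₁ j) = lin-0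
    R⁺-linear (in₃ i) (in₂ j) = lin-0
    R⁺-linear (in₃ i) (in₃ j) = lin-R j i

    private
      lin-[M₁,P] : ∀ i j → Lin (λ y → (M₁ · P⁺ y) i j - (P⁺ y · M₁) i j)
      lin-[M₁,P] i j = lin-minus (lin-·ˡ M₁ P⁺-linear i j) (lin-·ʳ M₁ P⁺-linear i j)
      lin-[M₂,R] : ∀ i j → Lin (λ y → (M₂ · R⁺ y) i j - (R⁺ y · M₂) i j)
      lin-[M₂,R] i j = lin-minus (lin-·ˡ M₂ R⁺-linear i j) (lin-·ʳ M₂ R⁺-linear i j)
      lin-[M₃,T] : ∀ i j → Lin (λ y → (M₃ · T⁺ y) i j - (T⁺ y · M₃) i j)
      lin-[M₃,T] i j = lin-minus (lin-·ˡ M₃ T⁺-linear i j) (lin-·ʳ M₃ T⁺-linear i j)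

    ext-linear : Linear ext
    ext-linear (pP i j)             = P⁺-linear i j
    ext-linear (pQ i (inl j))       = lin-[M₂,R] i (in₁ j)
    ext-linear (pQ (in₁ i) (inr j)) = lin-neg (lin-[M₁,P] (inl i) (inr j))
    ext-linear (pQ (in₂ i) (inr j)) =
      lin-+ (lin-[M₂,R] (in₂ i) (in₃ j)) (lin-[M₃,T] (inl i) (inr j))
    ext-linear (pQ (in₃ i) (inr j)) = lin-neg (lin-[M₁,P] (inr i) (inr j))
    ext-linear (pR i j)             = R⁺-linear i j
    ext-linear (pS i (inl j))       = lin-[M₂,R] i (in₂ j)
    ext-linear (pS (in₁ i) (inr j)) =
      lin-+ (lin-[M₂,R] (in₁ i) (in₃ j)) (lin-[M₁,P] (inl i) (inr j))
    ext-linear (pS (in₂ i) (inr j)) = lin-neg (lin-[M₃,T] (inl i) (inr j))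
    ext-linear (pS (in₃ i) (inr j)) = lin-neg (lin-[M₃,T] (inr i) (inr j))
    ext-linear (pT i j)             = T⁺-linear i j

    -- The signs arise because transposition turns a commutator [M, X] into -[Mᵀ, Xᵀ].
    spread : Seaweed K L J → Seaweed (K ⊕ L) (K ⊕ J ⊕ L) (J ⊕ L)
    spread z = blocks
      (λ { (inl j) (inl i) → - P z i j
         ; (inl j) (inr i) → - Q z i j
         ; (inr j) i → 0# })
      (λ _ _ → 0#)
      (λ { (in₃ j) (in₃ i) → - R z i j
         ; (in₃ j) (in₁ i) → 0#
         ; (in₃ j) (in₂ i) → 0#
         ; (in₁ j) i → 0#
         ; (in₂ j) i → 0# })
      (λ _ _ → 0#)
      (λ { (inl j) (inl i) → - T z i j
         ; (inl j) (inr i) → - S z i j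
         ; (inr j) i → 0# })

    private
      -- The ring identities behind the surviving equations: `corner` for the blocks P and T, `edge`
      -- for Q and S, `face` for R. The z are sums against zero blocks, the t are products with a
      -- sum of matrices, to be split by distributivity.
      corner : ∀ {a₁ a₂ b₁ b₂ d₁ d₂ z₁ z₂ z₃ z₄ t₁ t₂ t₃} →
               z₁ ≈ 0# → z₂ ≈ 0# → z₃ ≈ 0# → z₄ ≈ 0# →
               t₁ ≈ b₁ + b₂ → t₂ ≈ d₁ + d₂ → t₃ ≈ a₁ + a₂ →
               ((a₁ + z₁) + ((a₂ + (z₂ + z₃)) - (b₂ + (z₄ + d₂)))) - (b₁ + d₁) ≈ - ((t₁ + t₂) - t₃)
      corner h₁ h₂ h₃ h₄ k₁ k₂ k₃ = trans
        (+-congʳ (+-cong (+-congˡ h₁) (+-cong (+-congˡ (+-cong h₂ h₃)) (-‿cong (+-congˡ (+-congʳ h₄))))))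
        (trans (solve 6 (λ a₁ a₂ b₁ b₂ d₁ d₂ →
                 ((a₁ :+ :0) :+ ((a₂ :+ (:0 :+ :0)) :- (b₂ :+ (:0 :+ d₂)))) :- (b₁ :+ d₁)
                 := :- (((b₁ :+ b₂) :+ (d₁ :+ d₂)) :- (a₁ :+ a₂))) refl _ _ _ _ _ _)
          (sym (-‿cong (+-cong (+-cong k₁ k₂) (-‿cong k₃)))))

      edge : ∀ {a₁ a₂ d₁ d₂ z₁ z₂ z₃ z₄ z₅ z₆ t₁ t₂} →
             z₁ ≈ 0# → z₂ ≈ 0# → z₃ ≈ 0# → z₄ ≈ 0# → z₅ ≈ 0# → z₆ ≈ 0# →
             t₁ ≈ d₁ + d₂ → t₂ ≈ a₁ + a₂ →
             ((a₁ + z₁) + ((a₂ + (z₂ + z₃)) - (z₄ + (z₅ + d₂)))) - (z₆ + d₁) ≈ - (t₁ - t₂)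
      edge h₁ h₂ h₃ h₄ h₅ h₆ k₁ k₂ = trans
        (+-cong (+-cong (+-congˡ h₁) (+-cong (+-congˡ (+-cong h₂ h₃)) (-‿cong (+-cong h₄ (+-congʳ h₅)))))
                (-‿cong (+-congʳ h₆)))
        (trans (solve 4 (λ a₁ a₂ d₁ d₂ →
                 ((a₁ :+ :0) :+ ((a₂ :+ (:0 :+ :0)) :- (:0 :+ (:0 :+ d₂)))) :- (:0 :+ d₁)
                 := :- ((d₁ :+ d₂) :- (a₁ :+ a₂))) refl _ _ _ _)
          (sym (-‿cong (+-cong k₁ (-‿cong k₂)))))

      face : ∀ {x₁ x₂ y₂ y₃ l₁ l₂ l₃ b₁ b₂ b₃ z₁ z₂ z₃ z₄ q s t₁ t₂ t₃ t₄} →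
             z₁ ≈ 0# → z₂ ≈ 0# → z₃ ≈ 0# → z₄ ≈ 0# →
             q ≈ - ((x₁ + l₁) - (z₃ + b₁)) → s ≈ - ((y₃ + l₃) - (z₄ + b₃)) →
             t₁ ≈ b₁ + (b₃ + b₂) → t₂ ≈ l₁ + (l₃ + l₂) → t₃ ≈ x₁ + x₂ → t₄ ≈ y₃ + y₂ →
             (x₂ + (y₂ + l₂)) - ((z₁ + (z₂ + b₂)) + (q + s)) ≈ - (t₁ - (t₂ + (t₃ + t₄)))
      face {x₁} {x₂} {y₂} {y₃} {l₁} {l₂} {l₃} {b₁} {b₂} {b₃} h₁ h₂ h₃ h₄ hq hs k₁ k₂ k₃ k₄ = trans
        (+-congˡ (-‿cong (+-cong (+-cong h₁ (+-congʳ h₂))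
          (+-cong (trans hq (-‿cong (+-congˡ (-‿cong (+-congʳ h₃)))))
                  (trans hs (-‿cong (+-congˡ (-‿cong (+-congʳ h₄)))))))))
        (trans (solve 10 (λ x₁ x₂ y₂ y₃ l₁ l₂ l₃ b₁ b₂ b₃ →
            (x₂ :+ (y₂ :+ l₂)) :- ((:0 :+ (:0 :+ b₂)) :+ ((:- ((x₁ :+ l₁) :- (:0 :+ b₁))) :+ (:- ((y₃ :+ l₃) :- (:0 :+ b₃)))))
            := :- ((b₁ :+ (b₃ :+ b₂)) :- ((l₁ :+ (l₃ :+ l₂)) :+ ((x₁ :+ x₂) :+ (y₃ :+ y₂)))))
            refl x₁ x₂ y₂ y₃ l₁ l₂ l₃ b₁ b₂ b₃)
          (sym (-‿cong (+-cong k₁ (-‿cong (+-cong k₂ (+-cong k₃ k₄)))))))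

    ad*-ext : ∀ y i → ad* full (ext y) i ≈ spread (ad* reduced y) i
    ad*-ext y (pP (inl j) (inl i)) =
      trans (+-congʳ (+-congˡ (ξ₁⁰·₁ (Q⁺ y) i (inl j))))
        (corner (∑-zeroʳ {L} _) (∑-zeroʳ {J} _) (∑-zeroʳ {L} _) (∑-zeroˡ {J} _)
          (∑-distribʳ-comm {K} _ _ _) (∑-distribʳ-comm {L} _ _ _) (∑-distribˡ-comm {K} _ _ _))
    ad*-ext y (pP (inl j) (inr i)) =
      trans (+-congʳ (+-congˡ (ξ₁⁰·₂ (Q⁺ y) i (inl j))))
        (edge (∑-zeroʳ {L} _) (∑-zeroʳ {J} _) (∑-zeroʳ {L} _) (∑-zeroˡ {K} _) (∑-zeroˡ {J} _) (∑-zeroˡ {K} _)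
          (∑-distribʳ-comm {L} _ _ _) (∑-distribˡ-comm {K} _ _ _))
    ad*-ext y (pP (inr j) (inl i)) =
      trans (+-congʳ (+-congˡ (ξ₁⁰·₁ (Q⁺ y) i (inr j))))
            (solve 2 (λ a b → (a :+ (:- (a :- b))) :- b := :0) refl _ _)
    ad*-ext y (pP (inr j) (inr i)) =
      trans (+-congʳ (+-congˡ (ξ₁⁰·₂ (Q⁺ y) i (inr j))))
            (solve 2 (λ a b → (a :+ (:- (a :- b))) :- b := :0) refl _ _)
    ad*-ext y (pQ (in₁ j) (inl i)) = x-y≈0 (trans (ξ₁⁰·₁ (R⁺ y) i (in₁ j)) (sym (·ξ₁⁰₁ (P⁺ y) (inl i) j)))
    ad*-ext y (pQ (in₂ j) (inl i)) = x-y≈0 (trans (ξ₁⁰·₁ (R⁺ y) i (in₂ j)) (sym (·ξ₁⁰₂ (P⁺ y) (inl i) j)))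
    ad*-ext y (pQ (in₃ j) (inl i)) = x-y≈0 (trans (ξ₁⁰·₁ (R⁺ y) i (in₃ j)) (sym (·ξ₁⁰₃ (P⁺ y) (inl i) j)))
    ad*-ext y (pQ (in₁ j) (inr i)) = x-y≈0 (trans (ξ₁⁰·₂ (R⁺ y) i (in₁ j)) (sym (·ξ₁⁰₁ (P⁺ y) (inr i) j)))
    ad*-ext y (pQ (in₂ j) (inr i)) = x-y≈0 (trans (ξ₁⁰·₂ (R⁺ y) i (in₂ j)) (sym (·ξ₁⁰₂ (P⁺ y) (inr i) j)))
    ad*-ext y (pQ (in₃ j) (inr i)) = x-y≈0 (trans (ξ₁⁰·₂ (R⁺ y) i (in₃ j)) (sym (·ξ₁⁰₃ (P⁺ y) (inr i) j)))
    ad*-ext y (pR (in₁ j) i) =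
      trans (+-congˡ (-‿cong (+-congˡ (+-cong (·ξ₁⁰₁ (Q⁺ y) i j) (·ξ₃⁰₁ (S⁺ y) i j)))))
            (solve 2 (λ a b → a :- (b :+ ((a :- b) :+ :0)) := :0) refl _ _)
    ad*-ext y (pR (in₂ j) i) =
      trans (+-congˡ (-‿cong (+-congˡ (+-cong (·ξ₁⁰₂ (Q⁺ y) i j) (·ξ₃⁰₂ (S⁺ y) i (inl j))))))
            (solve 2 (λ a b → a :- (b :+ (:0 :+ (a :- b))) := :0) refl _ _)
    ad*-ext y (pR (in₃ j) (in₁ i)) =
      trans (+-congˡ (-‿cong (+-congˡ (+-cong (·ξ₁⁰₃ (Q⁺ y) (in₁ i) j) (·ξ₃⁰₂ (S⁺ y) (in₁ i) (inr j))))))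
            (solve 3 (λ a b g → a :- (b :+ ((:- g) :+ ((a :- b) :+ g))) := :0) refl _ _ _)
    ad*-ext y (pR (in₃ j) (in₂ i)) =
      trans (+-congˡ (-‿cong (+-congˡ (+-cong (·ξ₁⁰₃ (Q⁺ y) (in₂ i) j) (·ξ₃⁰₂ (S⁺ y) (in₂ i) (inr j))))))
            (solve 3 (λ a b g → a :- (b :+ (((a :- b) :+ g) :+ (:- g))) := :0) refl _ _ _)
    ad*-ext y (pR (in₃ j) (in₃ i)) =
      face (∑-zeroˡ {K} _) (∑-zeroˡ {J} _) (∑-zeroˡ {K} _) (∑-zeroˡ {J} _)
        (·ξ₁⁰₃ (Q⁺ y) (in₃ i) j) (·ξ₃⁰₂ (S⁺ y) (in₃ i) (inr j))
        (trans (∑-distribʳ-comm {L} _ _ _) (+-congˡ {_} {∑ {L} _} (∑-distribˡ {L} _ _ _)))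
        (trans (∑-distribˡ-comm {L} _ _ _) (+-congˡ {_} {∑ {L} _} (∑-distribʳ {L} _ _ _)))
        (∑-distribˡ-comm {K} _ _ _) (∑-distribˡ-comm {J} _ _ _)
    ad*-ext y (pS (in₁ j) (inl i)) = x-y≈0 (trans (ξ₃⁰· (R⁺ y) (inl i) (in₁ j)) (sym (·ξ₃⁰₁ (T⁺ y) (inl i) j)))
    ad*-ext y (pS (in₂ j) (inl i)) = x-y≈0 (trans (ξ₃⁰· (R⁺ y) (inl i) (in₂ j)) (sym (·ξ₃⁰₂ (T⁺ y) (inl i) (inl j))))
    ad*-ext y (pS (in₃ j) (inl i)) = x-y≈0 (trans (ξ₃⁰· (R⁺ y) (inl i) (in₃ j)) (sym (·ξ₃⁰₂ (T⁺ y) (inl i) (inr j))))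
    ad*-ext y (pS (in₁ j) (inr i)) = x-y≈0 (trans (ξ₃⁰· (R⁺ y) (inr i) (in₁ j)) (sym (·ξ₃⁰₁ (T⁺ y) (inr i) j)))
    ad*-ext y (pS (in₂ j) (inr i)) = x-y≈0 (trans (ξ₃⁰· (R⁺ y) (inr i) (in₂ j)) (sym (·ξ₃⁰₂ (T⁺ y) (inr i) (inl j))))
    ad*-ext y (pS (in₃ j) (inr i)) = x-y≈0 (trans (ξ₃⁰· (R⁺ y) (inr i) (in₃ j)) (sym (·ξ₃⁰₂ (T⁺ y) (inr i) (inr j))))
    ad*-ext y (pT (inl j) (inl i)) =
      -- The J side has its zero blocks in other places than the K side; zeros are removed and
      -- inserted until the sums have the shape that `corner` and `edge` expect.
      trans (+-congʳ (+-congˡ (trans (ξ₃⁰· (S⁺ y) (inl i) (inl j)) (+-cong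
              (trans (0+ (∑-zeroʳ {K} _)) (sym (+-congˡ (+-identityˡ _)))) (-‿cong (trans (0+ (∑-zeroˡ {K} _)) (sym (+-congˡ (+-identityˡ _)))))))))
        (corner (∑-zeroʳ {L} _) refl (∑-zeroʳ {L} _) refl
          (∑-distribʳ-comm {J} _ _ _) (∑-distribʳ-comm {L} _ _ _) (∑-distribˡ-comm {J} _ _ _))
    ad*-ext y (pT (inl j) (inr i)) =
      trans (+-congʳ (+-congˡ (trans (ξ₃⁰· (S⁺ y) (inr i) (inl j)) (+-congʳ
              (trans (0+ (∑-zeroʳ {K} _)) (sym (+-congˡ (+-identityˡ _))))))))
        (edge (∑-zeroʳ {L} _) refl (∑-zeroʳ {L} _) (∑-zeroˡ {K} _) (∑-zeroˡ {J} _) (∑-zeroˡ {J} _)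
          (∑-distribʳ-comm {L} _ _ _) (∑-distribˡ-comm {J} _ _ _))
    ad*-ext y (pT (inr j) (inl i)) =
      trans (+-congʳ (+-congˡ (ξ₃⁰· (S⁺ y) (inl i) (inr j))))
            (solve 2 (λ a b → (a :+ (:- (a :- b))) :- b := :0) refl _ _)
    ad*-ext y (pT (inr j) (inr i)) =
      trans (+-congʳ (+-congˡ (ξ₃⁰· (S⁺ y) (inr i) (inr j))))
            (solve 2 (λ a b → (a :+ (:- (a :- b))) :- b := :0) refl _ _)

    ext-restr : ∀ {x} → Ker full x → ∀ i → x i ≈ ext (restr x) i
    ext-restr {x} k = by-blocks {x = x} {ext (restr x)} p q r s t
      where
      ξ₁R : ∀ i j → R x (in₁ i) j ≈ (P x · ξ₁⁰) (inl i) j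
      ξ₁R i j = trans (sym (ξ₁⁰·₁ (R x) i j)) (e₂ k (inl i) j)
      ξ₁R′ : ∀ i j → R x (in₃ i) j ≈ (P x · ξ₁⁰) (inr i) j
      ξ₁R′ i j = trans (sym (ξ₁⁰·₂ (R x) i j)) (e₂ k (inr i) j)
      ξ₃R : ∀ i j → R x (inr i) j ≈ (T x · ξ₃⁰) i j
      ξ₃R i j = trans (sym (ξ₃⁰· (R x) i j)) (e₄ k i j)
      r : R x ≋ R⁺ (restr x)
      r (in₁ i) (in₁ j) = trans (ξ₁R i (in₁ j)) (·ξ₁⁰₁ (P x) (inl i) j)
      r (in₁ i) (in₂ j) = trans (ξ₁R i (in₂ j)) (·ξ₁⁰₂ (P x) (inl i) j)
      r (in₁ i) (in₃ j) = trans (ξ₁R i (in₃ j)) (·ξ₁⁰₃ (P x) (inl i) j)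
      r (in₂ i) (in₁ j) = trans (ξ₃R (inl i) (in₁ j)) (·ξ₃⁰₁ (T x) (inl i) j)
      r (in₂ i) (in₂ j) = trans (ξ₃R (inl i) (in₂ j)) (·ξ₃⁰₂ (T x) (inl i) (inl j))
      r (in₂ i) (in₃ j) = trans (ξ₃R (inl i) (in₃ j)) (·ξ₃⁰₂ (T x) (inl i) (inr j))
      r (in₃ i) (in₁ j) = trans (ξ₃R (inr i) (in₁ j)) (·ξ₃⁰₁ (T x) (inr i) j)
      r (in₃ i) (in₂ j) = trans (ξ₁R′ i (in₂ j)) (·ξ₁⁰₂ (P x) (inr i) j)
      r (in₃ i) (in₃ j) = refl
      p : P x ≋ P⁺ (restr x)
      p (inl i) (inl j) = refl
      p (inl i) (inr j) = refl
      p (inr i) (inl j) = trans (sym (trans (ξ₁R′ i (in₁ j)) (·ξ₁⁰₁ (P x) (inr i) j))) (r (in₃ i) (in₁ j))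
      p (inr i) (inr j) = sym (trans (ξ₁R′ i (in₃ j)) (·ξ₁⁰₃ (P x) (inr i) j))
      t : T x ≋ T⁺ (restr x)
      t (inl i) (inl j) = refl
      t (inl i) (inr j) = refl
      t (inr i) (inl j) = trans (sym (trans (ξ₃R (inr i) (in₂ j)) (·ξ₃⁰₂ (T x) (inr i) (inl j)))) (r (in₃ i) (in₂ j))
      t (inr i) (inr j) = sym (trans (ξ₃R (inr i) (in₃ j)) (·ξ₃⁰₂ (T x) (inr i) (inr j)))
      [M₁,P] : ∀ i j → (M₁ · P x) i j - (P x · M₁) i j ≈ (M₁ · P⁺ (restr x)) i j - (P⁺ (restr x) · M₁) i j
      [M₁,P] i j = +-cong (·-cong {A = M₁} ≋-refl p i j) (-‿cong (·-cong p (≋-refl {A = M₁}) i j))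
      [M₂,R] : ∀ i j → (M₂ · R x) i j - (R x · M₂) i j ≈ (M₂ · R⁺ (restr x)) i j - (R⁺ (restr x) · M₂) i j
      [M₂,R] i j = +-cong (·-cong {A = M₂} ≋-refl r i j) (-‿cong (·-cong r (≋-refl {A = M₂}) i j))
      [M₃,T] : ∀ i j → (M₃ · T x) i j - (T x · M₃) i j ≈ (M₃ · T⁺ (restr x)) i j - (T⁺ (restr x) · M₃) i j
      [M₃,T] i j = +-cong (·-cong {A = M₃} ≋-refl t i j) (-‿cong (·-cong t (≋-refl {A = M₃}) i j))
      from-e₁ : ∀ {a b c} → a + c ≈ b → c ≈ - (a - b)
      from-e₁ {a} {b} {c} h = trans (solve 2 (λ a c → c := :- (a :- (a :+ c))) refl a c) (-‿cong (+-congˡ (-‿cong h)))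
      from-e₃ : ∀ {a b c d} → a ≈ b + (c + d) → c ≈ (a - b) - d
      from-e₃ {a} {b} {c} {d} h =
        trans (solve 3 (λ b c d → c := ((b :+ (c :+ d)) :- b) :- d) refl b c d) (+-congʳ (+-congʳ (sym h)))
      from-e₃′ : ∀ {a b c d} → a ≈ b + (c + d) → d ≈ (a - b) - c
      from-e₃′ h = from-e₃ (trans h (+-congˡ (+-comm _ _)))
      q₁ : ∀ i j → Q x (in₁ i) j ≈ - ((M₁ · P⁺ (restr x)) (inl i) j - (P⁺ (restr x) · M₁) (inl i) j)
      q₁ i j = trans (from-e₁ (trans (+-congˡ (sym (ξ₁⁰·₁ (Q x) i j))) (e₁ k (inl i) j))) (-‿cong ([M₁,P] (inl i) j))
      q₃ : ∀ i j → Q x (in₃ i) j ≈ - ((M₁ · P⁺ (restr x)) (inr i) j - (P⁺ (restr x) · M₁) (inr i) j)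
      q₃ i j = trans (from-e₁ (trans (+-congˡ (sym (ξ₁⁰·₂ (Q x) i j))) (e₁ k (inr i) j))) (-‿cong ([M₁,P] (inr i) j))
      s₃ : ∀ i j → S x (inr i) j ≈ - ((M₃ · T⁺ (restr x)) i j - (T⁺ (restr x) · M₃) i j)
      s₃ i j = trans (from-e₁ (trans (+-congˡ (sym (ξ₃⁰· (S x) i j))) (e₅ k i j))) (-‿cong ([M₃,T] i j))
      e₃-in₃ : ∀ i j → (M₂ · R x) i (in₃ j) ≈ (R x · M₂) i (in₃ j) + (Q x i (inr j) + S x i (inr j))
      e₃-in₃ i j = trans (e₃ k i (in₃ j)) (+-congˡ (+-cong (·ξ₁⁰₃ (Q x) i j) (·ξ₃⁰₂ (S x) i (inr j))))
      a-b--c : ∀ {a b c d} → a ≈ b → c ≈ - d → a - c ≈ b + d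
      a-b--c h k = +-cong h (trans (-‿cong k) (-‿involutive _))
      q : Q x ≋ Q⁺ (restr x)
      q i (inl j) = trans (from-e₃ (trans (e₃ k i (in₁ j)) (+-congˡ (+-cong (·ξ₁⁰₁ (Q x) i j) (·ξ₃⁰₁ (S x) i j)))))
                          (trans (trans (+-congˡ -0#≈0#) (+-identityʳ _)) ([M₂,R] i (in₁ j)))
      q (in₁ i) (inr j) = q₁ i (inr j)
      q (in₂ i) (inr j) = trans (from-e₃ (e₃-in₃ (in₂ i) j)) (a-b--c ([M₂,R] (in₂ i) (in₃ j)) (s₃ (inl i) (inr j)))
      q (in₃ i) (inr j) = q₃ i (inr j)
      s : S x ≋ S⁺ (restr x)
      s i (inl j) = trans (from-e₃′ (trans (e₃ k i (in₂ j)) (+-congˡ (+-cong (·ξ₁⁰₂ (Q x) i j) (·ξ₃⁰₂ (S x) i (inl j))))))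
                          (trans (trans (+-congˡ -0#≈0#) (+-identityʳ _)) ([M₂,R] i (in₂ j)))
      s (in₁ i) (inr j) = trans (from-e₃′ (e₃-in₃ (in₁ i) j)) (a-b--c ([M₂,R] (in₁ i) (in₃ j)) (q₁ i (inr j)))
      s (in₂ i) (inr j) = s₃ (inl i) (inr j)
      s (in₃ i) (inr j) = s₃ (inr i) (inr j)

    ext-ker : ∀ {y} → Ker reduced y → Ker full (ext y)
    ext-ker {y} k = ad*⇒ker (λ i → trans (ad*-ext y i) (z i))
      where
      k⁻ : ∀ i → - ad* reduced y i ≈ 0#
      k⁻ i = trans (-‿cong (ker⇒ad* k i)) -0#≈0#
      z : ∀ i → spread (ad* reduced y) i ≈ 0#
      z (pP (inl j) (inl i)) = k⁻ (pP i j)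
      z (pP (inl j) (inr i)) = k⁻ (pQ i j)
      z (pP (inr j) i)       = refl
      z (pQ i j)             = refl
      z (pR (in₃ j) (in₃ i)) = k⁻ (pR i j)
      z (pR (in₃ j) (in₁ i)) = refl
      z (pR (in₃ j) (in₂ i)) = refl
      z (pR (in₁ j) i)       = refl
      z (pR (in₂ j) i)       = refl
      z (pS i j)             = refl
      z (pT (inl j) (inl i)) = k⁻ (pT i j)
      z (pT (inl j) (inr i)) = k⁻ (pS i j)
      z (pT (inr j) i)       = refl

    restr-ker : ∀ {x} → Ker full x → Ker reduced (restr x)
    restr-ker {x} k = ad*⇒ker z
      where
      k′ : ∀ i → spread (ad* reduced (restr x)) i ≈ 0#
      k′ i = trans (sym (ad*-ext (restr x) i)) (ker⇒ad* (Ker-congˣ (ext-restr k) k) i)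
      neg : ∀ {a} → - a ≈ 0# → a ≈ 0#
      neg h = trans (sym (-‿involutive _)) (trans (-‿cong h) -0#≈0#)
      z : ∀ i → ad* reduced (restr x) i ≈ 0#
      z (pP i j) = neg (k′ (pP (inl j) (inl i)))
      z (pQ i j) = neg (k′ (pP (inl j) (inr i)))
      z (pR i j) = neg (k′ (pR (in₃ j) (in₃ i)))
      z (pS i j) = neg (k′ (pT (inl j) (inr i)))
      z (pT i j) = neg (k′ (pT (inl j) (inl i)))

    full≅reduced : full ≅ reduced
    full≅reduced = record
      { restrict = restr ; extend = ext ; restrict-linear = restr-linear ; extend-linear = ext-linear
      ; restrict-extend = λ y → by-blocks {x = restr (ext y)} {y} ≋-refl ≋-refl ≋-refl ≋-refl ≋-refl
      ; extend-restrict = ext-restr ; restrict-ker = restr-ker ; extend-ker = ext-ker }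

  -- Change of basis

  record Inverses {I : Dim} (g h : Mtx I I) : Set ℓ where
    constructor inverses
    field
      gh≋1 : g · h ≋ δ
      hg≋1 : h · g ≋ δ
  open Inverses public

  Inverses-sym : ∀ {I} {g h : Mtx I I} → Inverses g h → Inverses h g
  Inverses-sym (inverses p q) = inverses q p

  Inverses-δ : ∀ {I} → Inverses {I} δ δ
  Inverses-δ = inverses (·-idˡ δ) (·-idˡ δ)

  ≋-trans : ∀ {I J} {A B C : Mtx I J} → A ≋ B → B ≋ C → A ≋ C
  ≋-trans p q i j = trans (p i j) (q i j)

  ≋-sym : ∀ {I J} {A B : Mtx I J} → A ≋ B → B ≋ A
  ≋-sym p i j = sym (p i j)

  ·-congˡ : ∀ {I J K} (A : Mtx I J) {B B′ : Mtx J K} → B ≋ B′ → A · B ≋ A · B′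
  ·-congˡ A = ·-cong {A = A} ≋-refl

  ·-congʳ : ∀ {I J K} {A A′ : Mtx I J} (B : Mtx J K) → A ≋ A′ → A · B ≋ A′ · B
  ·-congʳ B p = ·-cong p (≋-refl {A = B})

  cancelˡ : ∀ {I J} {g h : Mtx I I} → Inverses g h → (A : Mtx I J) → h · (g · A) ≋ A
  cancelˡ {g = g} {h} i A = ≋-trans (≋-sym (·-assoc h g A)) (≋-trans (·-congʳ A (hg≋1 i)) (·-idˡ A))

  cancelʳ : ∀ {I J} {g h : Mtx I I} → Inverses g h → (A : Mtx J I) → (A · g) · h ≋ A
  cancelʳ {g = g} {h} i A = ≋-trans (·-assoc A g h) (≋-trans (·-congˡ A (gh≋1 i)) (·-idʳ A))

  intertwine⁻¹ : ∀ {I J} {g h : Mtx I I} {g′ h′ : Mtx J J} → Inverses g h → Inverses g′ h′ →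
                 {A B : Mtx I J} → A · g′ ≋ g · B → B · h′ ≋ h · A
  intertwine⁻¹ {g = g} {h} {g′} {h′} i j {A} {B} e =
    ≋-trans (·-congʳ h′ (≋-sym (cancelˡ i B)))
    (≋-trans (·-congʳ h′ (·-congˡ h (≋-sym e)))
    (≋-trans (·-assoc h (A · g′) h′) (·-congˡ h (cancelʳ j A))))

  module _ {D₁ D₂ D₃ : Dim} where
    move : (g₁ h₁ : Mtx D₁ D₁) (g₂ h₂ : Mtx D₂ D₂) (g₃ h₃ : Mtx D₃ D₃) → Seaweed D₁ D₂ D₃ → Seaweed D₁ D₂ D₃
    move g₁ h₁ g₂ h₂ g₃ h₃ y = blocks (g₁ · (P y · h₁)) (g₂ · (Q y · h₁)) (g₂ · (R y · h₂))
                                      (g₂ · (S y · h₃)) (g₃ · (T y · h₃))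

    move-linear : ∀ g₁ h₁ g₂ h₂ g₃ h₃ → Linear (move g₁ h₁ g₂ h₂ g₃ h₃)
    move-linear g₁ h₁ g₂ h₂ g₃ h₃ (pP i j) = lin-·ˡ g₁ (lin-·ʳ h₁ lin-P) i j
    move-linear g₁ h₁ g₂ h₂ g₃ h₃ (pQ i j) = lin-·ˡ g₂ (lin-·ʳ h₁ lin-Q) i j
    move-linear g₁ h₁ g₂ h₂ g₃ h₃ (pR i j) = lin-·ˡ g₂ (lin-·ʳ h₂ lin-R) i j
    move-linear g₁ h₁ g₂ h₂ g₃ h₃ (pS i j) = lin-·ˡ g₂ (lin-·ʳ h₃ lin-S) i j
    move-linear g₁ h₁ g₂ h₂ g₃ h₃ (pT i j) = lin-·ˡ g₃ (lin-·ʳ h₃ lin-T) i j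

  -- The relation f = g f′ g⁻¹ with the inverse cleared. Together with its mirror image from
  -- `intertwines⁻¹` it reduces `move-ker` to associativity and distributivity.
  record Intertwines {D₁ D₂ D₃} (g₁ : Mtx D₁ D₁) (g₂ : Mtx D₂ D₂) (g₃ : Mtx D₃ D₃)
                     (f f′ : Form D₁ D₂ D₃) : Set ℓ where
    constructor intertwines
    field
      iM₁ : M₁ f · g₁ ≋ g₁ · M₁ f′
      iM₂ : M₂ f · g₂ ≋ g₂ · M₂ f′
      iM₃ : M₃ f · g₃ ≋ g₃ · M₃ f′
      iξ₁ : ξ₁ f · g₂ ≋ g₁ · ξ₁ f′
      iξ₃ : ξ₃ f · g₂ ≋ g₃ · ξ₃ f′

  module _ {D₁ D₂ D₃ : Dim} where

    intertwines⁻¹ : ∀ {g₁ h₁ : Mtx D₁ D₁} {g₂ h₂ : Mtx D₂ D₂} {g₃ h₃ : Mtx D₃ D₃} {f f′ : Form D₁ D₂ D₃} →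
      Inverses g₁ h₁ → Inverses g₂ h₂ → Inverses g₃ h₃ →
      Intertwines g₁ g₂ g₃ f f′ → Intertwines h₁ h₂ h₃ f′ f
    intertwines⁻¹ i₁ i₂ i₃ (intertwines a b c d e) = intertwines (intertwine⁻¹ i₁ i₁ a)
      (intertwine⁻¹ i₂ i₂ b) (intertwine⁻¹ i₃ i₃ c) (intertwine⁻¹ i₁ i₂ d) (intertwine⁻¹ i₃ i₂ e)

    private
      push : ∀ {I J K N} {A A′ : Mtx I J} {g : Mtx I I} {g′ : Mtx J J} (B : Mtx J K) (h : Mtx K N) →
             A · g′ ≋ g · A′ → A · (g′ · (B · h)) ≋ g · ((A′ · B) · h)
      push {A = A} {A′} {g} {g′} B h e =
        ≋-trans (≋-sym (·-assoc A g′ (B · h)))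
        (≋-trans (·-congʳ (B · h) e)
        (≋-trans (·-assoc g A′ (B · h)) (·-congˡ g (≋-sym (·-assoc A′ B h)))))

      pull : ∀ {I J K N} {A A′ : Mtx J K} {h : Mtx J J} {h′ : Mtx K K} (g : Mtx N I) (B : Mtx I J) →
             A′ · h′ ≋ h · A → (g · (B · h)) · A ≋ g · ((B · A′) · h′)
      pull {A = A} {A′} {h} {h′} g B e =
        ≋-trans (·-assoc g (B · h) A)
        (·-congˡ g (≋-trans (·-assoc B h A) (≋-trans (·-congˡ B (≋-sym e)) (≋-sym (·-assoc B A′ h′)))))

      sandwich-+ : ∀ {I J K N} (g : Mtx I J) (A B : Mtx J K) (h : Mtx K N) i j →
        (g · ((λ i j → A i j + B i j) · h)) i j ≈ (g · (A · h)) i j + (g · (B · h)) i j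
      sandwich-+ g A B h i j = trans (·-congˡ g (·-distribʳ A B h) i j) (·-distribˡ g (A · h) (B · h) i j)

      sandwich : ∀ {I J K N} (g : Mtx I J) {A B : Mtx J K} (h : Mtx K N) → A ≋ B → g · (A · h) ≋ g · (B · h)
      sandwich g h e = ·-congˡ g (·-congʳ h e)

    move-ker : ∀ {g₁ h₁ : Mtx D₁ D₁} {g₂ h₂ : Mtx D₂ D₂} {g₃ h₃ : Mtx D₃ D₃} {f f′ : Form D₁ D₂ D₃} →
      Intertwines g₁ g₂ g₃ f f′ → Intertwines h₁ h₂ h₃ f′ f →
      ∀ {y} → Ker f′ y → Ker f (move g₁ h₁ g₂ h₂ g₃ h₃ y)
    move-ker {g₁} {h₁} {g₂} {h₂} {g₃} {h₃} {f} {f′} (intertwines a b c d e) (intertwines a′ b′ c′ d′ e′) {y} k = ker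
      (λ i j → trans (+-cong (push (P y) h₁ a i j) (push (Q y) h₁ d i j))
        (trans (sym (sandwich-+ g₁ _ _ h₁ i j))
          (trans (sandwich g₁ h₁ (e₁ k) i j) (sym (pull g₁ (P y) a′ i j)))))
      (λ i j → trans (push (R y) h₂ d i j) (trans (sandwich g₁ h₂ (e₂ k) i j) (sym (pull g₁ (P y) d′ i j))))
      (λ i j → trans (push (R y) h₂ b i j) (trans (sandwich g₂ h₂ (e₃ k) i j)
        (trans (sandwich-+ g₂ (R y · M₂ f′) _ h₂ i j) (+-cong (sym (pull g₂ (R y) b′ i j))
          (trans (sandwich-+ g₂ (Q y · ξ₁ f′) (S y · ξ₃ f′) h₂ i j)
            (+-cong (sym (pull g₂ (Q y) d′ i j)) (sym (pull g₂ (S y) e′ i j))))))))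
      (λ i j → trans (push (R y) h₂ e i j) (trans (sandwich g₃ h₂ (e₄ k) i j) (sym (pull g₃ (T y) e′ i j))))
      (λ i j → trans (+-cong (push (T y) h₃ c i j) (push (S y) h₃ e i j))
        (trans (sym (sandwich-+ g₃ _ _ h₃ i j))
          (trans (sandwich g₃ h₃ (e₅ k) i j) (sym (pull g₃ (T y) c′ i j)))))

    move-move : ∀ {g₁ h₁ : Mtx D₁ D₁} {g₂ h₂ : Mtx D₂ D₂} {g₃ h₃ : Mtx D₃ D₃} →
      Inverses g₁ h₁ → Inverses g₂ h₂ → Inverses g₃ h₃ →
      ∀ y i → move h₁ g₁ h₂ g₂ h₃ g₃ (move g₁ h₁ g₂ h₂ g₃ h₃ y) i ≈ y i
    move-move {g₁} {h₁} {g₂} {h₂} {g₃} {h₃} i₁ i₂ i₃ y =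
      by-blocks {x = move h₁ g₁ h₂ g₂ h₃ g₃ (move g₁ h₁ g₂ h₂ g₃ h₃ y)} {y}
        (both i₁ i₁ (P y)) (both i₂ i₁ (Q y)) (both i₂ i₂ (R y)) (both i₂ i₃ (S y)) (both i₃ i₃ (T y))
      where
      both : ∀ {I J} {g h : Mtx I I} {g′ h′ : Mtx J J} → Inverses g h → Inverses g′ h′ →
             (A : Mtx I J) → h · ((g · (A · h′)) · g′) ≋ A
      both {g = g} {h} {g′} {h′} i j A =
        ≋-trans (·-congˡ h (≋-trans (·-assoc g (A · h′) g′) (·-congˡ g (cancelʳ (Inverses-sym j) A)))) (cancelˡ i A)

    conj-≅ : ∀ {g₁ h₁ : Mtx D₁ D₁} {g₂ h₂ : Mtx D₂ D₂} {g₃ h₃ : Mtx D₃ D₃} {f f′ : Form D₁ D₂ D₃} →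
      Inverses g₁ h₁ → Inverses g₂ h₂ → Inverses g₃ h₃ → Intertwines g₁ g₂ g₃ f f′ → f ≅ f′
    conj-≅ {g₁} {h₁} {g₂} {h₂} {g₃} {h₃} i₁ i₂ i₃ e = record
      { restrict = move h₁ g₁ h₂ g₂ h₃ g₃ ; extend = move g₁ h₁ g₂ h₂ g₃ h₃
      ; restrict-linear = move-linear h₁ g₁ h₂ g₂ h₃ g₃ ; extend-linear = move-linear g₁ h₁ g₂ h₂ g₃ h₃
      ; restrict-extend = move-move i₁ i₂ i₃
      ; extend-restrict = λ {x} _ i → sym (move-move (Inverses-sym i₁) (Inverses-sym i₂) (Inverses-sym i₃) x i)
      ; restrict-ker = move-ker (intertwines⁻¹ i₁ i₂ i₃ e) e
      ; extend-ker = move-ker e (intertwines⁻¹ i₁ i₂ i₃ e) }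

-- Red D₁ D₂ D₃ G: the reductions, read backwards, lead from a pair gl(c) × gl(b) (for which D₂ = 0) to
-- (D₁, D₂, D₃), and the kernels of generic forms are parametrised by G.
data Red : Dim → Dim → Dim → Dim → Set where
  base       : ∀ c b → Red (fin c) (fin 0) (fin b) (fin c ⊕ fin b)
  swap       : ∀ {D₁ D₂ D₃ G} → Red D₁ D₂ D₃ G → Red D₃ D₂ D₁ G
  injective  : ∀ {C D₂ D₃ G} → Red C D₂ D₃ G → Red (D₂ ⊕ C) D₂ D₃ G
  surjective : ∀ {D₁ Z D₃ G} → Red D₁ Z D₃ G → Red D₁ (D₁ ⊕ D₃ ⊕ Z) D₃ G
  transverse : ∀ {K L J G} → Red K L J G → Red (K ⊕ L) (K ⊕ J ⊕ L) (J ⊕ L) G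

-- A form whose kernel is known exactly

module UpperBound {o ℓ : Level} (F : CharZeroField o ℓ) where
  open Reductions F public

  ι-injective : ∀ {m n} → ι m ≈ ι n → m ≡ n
  ι-injective {zero}  {zero}  _ = ≡.refl
  ι-injective {zero}  {suc n} e = contradiction (sym e) (char0 n)
  ι-injective {suc m} {zero}  e = contradiction e (char0 m)
  ι-injective {suc m} {suc n} e = ≡.cong suc (ι-injective (begin
    ι m               ≈⟨ solve 2 (λ o a → a := (:- o) :+ (o :+ a)) refl 1# _ ⟩
    - 1# + (1# + ι m) ≈⟨ +-congˡ e ⟩
    - 1# + (1# + ι n) ≈⟨ solve 2 (λ o a → (:- o) :+ (o :+ a) := a) refl 1# _ ⟩
    ι n               ∎))

  *-cancel-≉0 : ∀ {a b} → ¬ (a ≈ 0#) → a * b ≈ 0# → b ≈ 0#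
  *-cancel-≉0 {a} {b} a≉0 ab≈0 with a⁻¹ , aa⁻¹≈1 ← inverse a a≉0 = begin
    b              ≈⟨ *-identityˡ b ⟨
    1# * b         ≈⟨ *-congʳ aa⁻¹≈1 ⟨
    (a * a⁻¹) * b  ≈⟨ solve 3 (λ a c b → (a :* c) :* b := c :* (a :* b)) refl _ _ _ ⟩
    a⁻¹ * (a * b)  ≈⟨ *-congˡ ab≈0 ⟩
    a⁻¹ * 0#       ≈⟨ zeroʳ _ ⟩
    0#             ∎

  module _ {D₁ D₂ D₃ : Dim} where
    diag : Seaweed D₁ D₂ D₃ → El (D₁ ⊕ D₂ ⊕ D₃) → Carrier
    diag x (in₁ i) = P x i i
    diag x (in₂ i) = R x i i
    diag x (in₃ i) = T x i i

    -- Some diagonal entries are coordinates on the kernel of f. The identity matrix then has all its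
    -- coordinates equal to 1, so the traceless part of the kernel is easily split off.
    record DiagonalCoordinates (f : Form D₁ D₂ D₃) (G : Dim) : Set (o ⊔ ℓ) where
      field
        position : El G → El (D₁ ⊕ D₂ ⊕ D₃)
        vector   : El G → Seaweed D₁ D₂ D₃
        vector-ker  : ∀ v → Ker f (vector v)
        vector-diag : ∀ v w → diag (vector v) (position w) ≈ δ v w
        diag-zero   : ∀ {x} → Ker f x → (∀ v → diag x (position v) ≈ 0#) → ∀ i → x i ≈ 0#

  open DiagonalCoordinates

  coordinates-cong : ∀ {D₁ D₂ D₃ G} {f f′ : Form D₁ D₂ D₃} → f ≈ᶠ f′ →
                     DiagonalCoordinates f G → DiagonalCoordinates f′ G
  coordinates-cong {f = f} {f′} e c = record
    { position = position c ; vector = vector c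
    ; vector-ker = λ v → Ker-congᶠ e (vector-ker c v) ; vector-diag = vector-diag c
    ; diag-zero = λ k → diag-zero c (Ker-congᶠ (sym-≈ᶠ e) k) }
    where
    sym-≈ᶠ : f ≈ᶠ f′ → f′ ≈ᶠ f
    sym-≈ᶠ (form≈ p q r s t) = form≈ (≋-sym p) (≋-sym q) (≋-sym r) (≋-sym s) (≋-sym t)

  -- Each reduction copies the diagonal of the smaller seaweed to diagonal entries of the larger
  -- one, along π. So the coordinates survive with the same `G`, where a bare dimension count would
  -- lose sight of the identity matrix.
  coordinates-≅ : ∀ {D₁ D₂ D₃ E₁ E₂ E₃ G} {f : Form D₁ D₂ D₃} {f′ : Form E₁ E₂ E₃} (iso : f ≅ f′)
    (π : El (E₁ ⊕ E₂ ⊕ E₃) → El (D₁ ⊕ D₂ ⊕ D₃)) →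
    (∀ y p → diag (_≅_.extend iso y) (π p) ≈ diag y p) →
    (∀ x p → diag (_≅_.restrict iso x) p ≈ diag x (π p)) →
    DiagonalCoordinates f′ G → DiagonalCoordinates f G
  coordinates-≅ iso π extend-diag restrict-diag c = record
    { position = λ v → π (position c v)
    ; vector = λ v → extend (vector c v)
    ; vector-ker = λ v → extend-ker (vector-ker c v)
    ; vector-diag = λ v w → trans (extend-diag (vector c v) (position c w)) (vector-diag c v w)
    ; diag-zero = λ {x} k h i → trans (extend-restrict k i)
        (lin-zero (extend-linear i) (diag-zero c (restrict-ker k)
          (λ v → trans (restrict-diag x (position c v)) (h v)))) }
    where open _≅_ iso

  module Base (c b : ℕ) where
    -- The entries 0, 1, 2, ... are distinct in characteristic zero. M₁ and M₃ may share them, as no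
    -- block links V₁ and V₃ when V₂ = 0.
    a : ∀ {n} → El (fin n) → Carrier
    a (ix i) = ι (toℕ i)

    a-distinct : ∀ {n} (i j : El (fin n)) → i ≢ j → ¬ (a i - a j ≈ 0#)
    a-distinct (ix i) (ix j) i≢j h = i≢j (≡.cong ix (Finₚ.toℕ-injective (ι-injective (x-y≈0⁻¹ h))))

    diagonal : ∀ {I} → (El I → Carrier) → Mtx I I
    diagonal u i j = u i * δ i j

    diagonal-· : ∀ {I J} (u : El I → Carrier) (A : Mtx I J) i j → (diagonal u · A) i j ≈ u i * A i j
    diagonal-· {I} u A i j = trans (∑-cong {I} (λ k → *-assoc _ _ _))
                                   (trans (∑-*ˡ {I} (u i) _) (*-congˡ (∑-δˡ i (λ k → A k j))))

    ·-diagonal : ∀ {I J} (u : El J → Carrier) (A : Mtx I J) i j → (A · diagonal u) i j ≈ u j * A i j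
    ·-diagonal {I} {J} u A i j = trans
      (∑-cong {J} (λ k → solve 3 (λ a u d → a :* (u :* d) := (u :* a) :* d) refl _ _ _))
      (∑-δʳ j (λ k → u k * A i k))

    diagonals-commute : ∀ {I} (u w : El I → Carrier) → diagonal u · diagonal w ≋ diagonal w · diagonal u
    diagonals-commute u w i j = trans (diagonal-· u (diagonal w) i j)
      (trans (solve 3 (λ a b d → a :* (b :* d) := b :* (a :* d)) refl _ _ _) (sym (diagonal-· w (diagonal u) i j)))

    f : Form (fin c) (fin 0) (fin b)
    f = form (diagonal a) (λ _ _ → 0#) (diagonal a) (λ _ _ → 0#) (λ _ _ → 0#)

    -- Off the diagonal, (aᵢ - aⱼ) Aᵢⱼ = 0. The summand `0#` is the empty sum ξ₁ · Q of `e₁`, or ξ₃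
    -- · S of `e₅`, for V₂ = 0.
    commutant-diagonal : ∀ {n} (A : Mtx (fin n) (fin n)) →
      (∀ i j → (diagonal a · A) i j + 0# ≈ (A · diagonal a) i j) → (∀ i → A i i ≈ 0#) → ∀ i j → A i j ≈ 0#
    commutant-diagonal A comm h i j with i ≟ᴱ j
    ... | yes ≡.refl = h i
    ... | no i≢j = *-cancel-≉0 (a-distinct i j i≢j) (begin
      (a i - a j) * A i j         ≈⟨ solve 3 (λ x y z → (x :- y) :* z := x :* z :- y :* z) refl _ _ _ ⟩
      a i * A i j - a j * A i j   ≈⟨ x-y≈0 (trans (sym (diagonal-· a A i j))
        (trans (sym (+-identityʳ _)) (trans (comm i j) (·-diagonal a A i j)))) ⟩
      0#                          ∎)

    coordinates : DiagonalCoordinates f (fin c ⊕ fin b)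
    coordinates = record
      { position = λ { (inl i) → in₁ i ; (inr j) → in₃ j }
      ; vector = λ v → blocks (diagonal (λ i → δ v (inl i))) (λ _ _ → 0#) (λ _ _ → 0#) (λ _ _ → 0#)
                              (diagonal (λ j → δ v (inr j)))
      ; vector-ker = λ v → ker
          (λ i j → trans (+-identityʳ _) (diagonals-commute a (λ i → δ v (inl i)) i j))
          (λ { i (ix ()) }) (λ { (ix ()) }) (λ { i (ix ()) })
          (λ i j → trans (+-identityʳ _) (diagonals-commute a (λ j → δ v (inr j)) i j))
      ; vector-diag = λ { v (inl i) → trans (*-congˡ (δ-refl i)) (*-identityʳ _)
                        ; v (inr j) → trans (*-congˡ (δ-refl j)) (*-identityʳ _) }
      ; diag-zero = λ {x} k h → by-blocks {x = x} {λ _ → 0#}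
          (commutant-diagonal (P x) (e₁ k) (λ i → h (inl i)))
          (λ { (ix ()) }) (λ { (ix ()) }) (λ { (ix ()) })
          (commutant-diagonal (T x) (e₅ k) (λ j → h (inr j))) }

  -- `reduced` reads its matrices off as blocks, or sums of blocks, of the larger ones. Putting the
  -- given matrix into one summand, transposed in the transverse case, and zeros into the others
  -- returns the given form up to added zeros, which `coordinates-cong` absorbs.
  good-form : ∀ {D₁ D₂ D₃ G} → Red D₁ D₂ D₃ G → Σ (Form D₁ D₂ D₃) (λ f → DiagonalCoordinates f G)
  good-form (base c b) = Base.f c b , Base.coordinates c b
  good-form (swap {D₁} {D₂} {D₃} r) with f , co ← good-form r =
    -- `swapᶠ (swapᶠ f)` is `f` itself by eta, so `co` fits.
    swapᶠ f , coordinates-≅ (swap-≅ (swapᶠ f))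
      (λ { (in₁ i) → in₃ i ; (in₂ i) → in₂ i ; (in₃ i) → in₁ i })
      (λ { y (in₁ i) → refl ; y (in₂ i) → refl ; y (in₃ i) → refl })
      (λ { y (in₁ i) → refl ; y (in₂ i) → refl ; y (in₃ i) → refl }) co
  good-form (injective {C} {D₂} r) with f , co ← good-form r =
    full , coordinates-≅ full≅reduced
      (λ { (in₁ i) → in₁ (inr i) ; (in₂ i) → in₂ i ; (in₃ i) → in₃ i })
      (λ { y (in₁ i) → refl ; y (in₂ i) → refl ; y (in₃ i) → refl })
      (λ { y (in₁ i) → refl ; y (in₂ i) → refl ; y (in₃ i) → refl })
      (coordinates-cong (form≈ ≋-refl (λ _ _ → sym (+-identityʳ _)) ≋-refl ≋-refl ≋-refl) co)
    where
    M₁′ : Mtx (D₂ ⊕ C) (D₂ ⊕ C)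
    M₁′ (inl i) j       = 0#
    M₁′ (inr i) (inl j) = ξ₁ f i j
    M₁′ (inr i) (inr j) = M₁ f i j
    open Injective {C} {D₂} M₁′ (M₂ f) (M₃ f) (ξ₃ f)
  good-form (surjective {D₁} {Z} {D₃} r) with f , co ← good-form r =
    full , coordinates-≅ full≅reduced
      (λ { (in₁ i) → in₁ i ; (in₂ i) → in₂ (in₃ i) ; (in₃ i) → in₃ i })
      (λ { y (in₁ i) → refl ; y (in₂ i) → refl ; y (in₃ i) → refl })
      (λ { y (in₁ i) → refl ; y (in₂ i) → refl ; y (in₃ i) → refl })
      (coordinates-cong (form≈ (λ _ _ → sym (+-identityʳ _)) ≋-refl (λ _ _ → sym (+-identityʳ _)) ≋-refl ≋-refl) co)
    where
    M₂′ : Mtx (D₁ ⊕ D₃ ⊕ Z) (D₁ ⊕ D₃ ⊕ Z)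
    M₂′ i       (in₁ j) = 0#
    M₂′ i       (in₂ j) = 0#
    M₂′ (in₁ i) (in₃ j) = ξ₁ f i j
    M₂′ (in₂ i) (in₃ j) = ξ₃ f i j
    M₂′ (in₃ i) (in₃ j) = M₂ f i j
    open Surjective {D₁} {Z} {D₃} (M₁ f) M₂′ (M₃ f)
  good-form (transverse {K} {L} {J} r) with f , co ← good-form r =
    full , coordinates-≅ full≅reduced
      (λ { (in₁ i) → in₁ (inl i) ; (in₂ i) → in₂ (in₃ i) ; (in₃ i) → in₃ (inl i) })
      (λ { y (in₁ i) → refl ; y (in₂ i) → refl ; y (in₃ i) → refl })
      (λ { y (in₁ i) → refl ; y (in₂ i) → refl ; y (in₃ i) → refl })
      (coordinates-cong (form≈ (λ _ _ → sym (+-identityˡ _))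
        (λ _ _ → sym (trans (+-identityˡ _) (+-identityˡ _))) (λ _ _ → sym (+-identityˡ _))
        (λ _ _ → sym (+-identityˡ _)) (λ _ _ → sym (+-identityˡ _))) co)
    where
    M₂′ : Mtx (K ⊕ J ⊕ L) (K ⊕ J ⊕ L)
    M₂′ (in₁ i) (in₁ j) = M₁ f j i
    M₂′ (in₁ i) (inr j) = 0#
    M₂′ (in₂ i) (in₁ j) = 0#
    M₂′ (in₂ i) (in₂ j) = M₃ f j i
    M₂′ (in₂ i) (in₃ j) = 0#
    M₂′ (in₃ i) (in₁ j) = ξ₁ f j i
    M₂′ (in₃ i) (in₂ j) = ξ₃ f j i
    M₂′ (in₃ i) (in₃ j) = M₂ f j i
    open Transverse {K} {L} {J} (λ _ _ → 0#) M₂′ (λ _ _ → 0#)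

-- Generic ranks, and the lower bound for kernels

Stable : ∀ {o ℓ} → CharZeroField o ℓ → Set (o ⊔ ℓ)
Stable F = ∀ {x y} → ¬ ¬ (x ≈ y) → x ≈ y
  where open CharZeroField F

infixl 1 _>>=_
-- The double negation monad, for `do` blocks: finding a pivot or deciding whether a polynomial has
-- an integer root is possible only inside it.
_>>=_ : ∀ {a b} {A : Set a} {B : Set b} → ¬ ¬ A → (A → ¬ ¬ B) → ¬ ¬ B
(m >>= f) k = m (λ a → f a k)

¬¬-return : ∀ {a} {A : Set a} → A → ¬ ¬ A
¬¬-return a k = k a

¬¬-em : ∀ {a} {A : Set a} → ¬ ¬ (A ⊎ ¬ A)
¬¬-em k = k (inj₂ (λ a → k (inj₁ a)))

-- Double negation passes through the quantifier because the index set is finite.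
¬¬-choiceᶠ : ∀ {n b} {B : Fin n → Set b} → (∀ i → ¬ ¬ B i) → ¬ ¬ (∀ i → B i)
¬¬-choiceᶠ {zero}  h = ¬¬-return λ ()
¬¬-choiceᶠ {suc n} h = do
  b  ← h zero
  bs ← ¬¬-choiceᶠ (h ∘ suc)
  ¬¬-return λ { zero → b ; (suc i) → bs i }

¬¬-choice : ∀ {I b} {B : El I → Set b} → (∀ i → ¬ ¬ B i) → ¬ ¬ (∀ i → B i)
¬¬-choice {I} {B = B} h = do
  bs ← ¬¬-choiceᶠ (λ i → h (element I i))
  ¬¬-return λ i → ≡.subst B (element-index i) (bs (index i))

module LowerBound {o ℓ : Level} (F : CharZeroField o ℓ) (stable : Stable F) where
  open UpperBound F public

  -- Polynomialᶠ n f: f is a polynomial function of degree less than n.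
  data Polynomialᶠ : ℕ → (Carrier → Carrier) → Set (o ⊔ ℓ) where
    null   : ∀ {f} → (∀ s → f s ≈ 0#) → Polynomialᶠ 0 f
    horner : ∀ {n f g} c → Polynomialᶠ n g → (∀ s → f s ≈ c + s * g s) → Polynomialᶠ (suc n) f

  IsPolynomial : (Carrier → Carrier) → Set (o ⊔ ℓ)
  IsPolynomial f = ∃ λ n → Polynomialᶠ n f

  poly-resp : ∀ {n f g} → (∀ s → g s ≈ f s) → Polynomialᶠ n f → Polynomialᶠ n g
  poly-resp e (null h)       = null (λ s → trans (e s) (h s))
  poly-resp e (horner c p h) = horner c p (λ s → trans (e s) (h s))

  poly-+ : ∀ {m n f g} → Polynomialᶠ m f → Polynomialᶠ n g → Polynomialᶠ (m ℕ.⊔ n) (λ s → f s + g s)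
  poly-+ (null h) q = poly-resp (λ s → 0+ (h s)) q
  poly-+ p@(horner _ _ _) (null k) = poly-resp (λ s → +0 (k s)) p
  poly-+ (horner c p h) (horner d q k) = horner (c + d) (poly-+ p q) (λ s → trans (+-cong (h s) (k s))
    (solve 5 (λ c d s f g → (c :+ s :* f) :+ (d :+ s :* g) := (c :+ d) :+ s :* (f :+ g)) refl _ _ _ _ _))

  poly-scale : ∀ {n f} a → Polynomialᶠ n f → Polynomialᶠ n (λ s → a * f s)
  poly-scale a (null h)       = null (λ s → trans (*-congˡ (h s)) (zeroʳ a))
  poly-scale a (horner c p h) = horner (a * c) (poly-scale a p) (λ s → trans (*-congˡ (h s))
    (solve 4 (λ a c s f → a :* (c :+ s :* f) := a :* c :+ s :* (a :* f)) refl _ _ _ _))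

  isPoly-resp : ∀ {f g} → (∀ s → g s ≈ f s) → IsPolynomial f → IsPolynomial g
  isPoly-resp e (n , p) = n , poly-resp e p

  isPoly-+ : ∀ {f g} → IsPolynomial f → IsPolynomial g → IsPolynomial (λ s → f s + g s)
  isPoly-+ (_ , p) (_ , q) = _ , poly-+ p q

  isPoly-const : ∀ a → IsPolynomial (λ _ → a)
  isPoly-const a = 1 , horner a (null {λ _ → 0#} (λ _ → refl)) (λ s → sym (+0 (zeroʳ s)))

  isPoly-id : IsPolynomial (λ s → s)
  isPoly-id = 2 , horner 0# (proj₂ (isPoly-const 1#)) (λ s → sym (trans (+-identityˡ _) (*-identityʳ s)))

  isPoly-* : ∀ {f g} → IsPolynomial f → IsPolynomial g → IsPolynomial (λ s → f s * g s)
  isPoly-* (_ , null h) _ = 0 , null (λ s → trans (*-congʳ (h s)) (zeroˡ _))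
  isPoly-* {f} {g} (_ , horner {g = f′} c p h) q = isPoly-resp
    (λ s → trans (*-congʳ (h s)) (solve 4 (λ c s f g → (c :+ s :* f) :* g := c :* g :+ (:0 :+ s :* (f :* g))) refl _ _ _ _))
    (isPoly-+ (_ , poly-scale c (proj₂ q)) (_ , horner 0# (proj₂ (isPoly-* (_ , p) q)) (λ s → refl)))

  isPoly-neg : ∀ {f} → IsPolynomial f → IsPolynomial (λ s → - f s)
  isPoly-neg p = isPoly-resp (λ s → -≈-1* _) (isPoly-* (isPoly-const (- 1#)) p)

  isPoly-sumFin : ∀ {n} {f : Fin n → Carrier → Carrier} → (∀ i → IsPolynomial (f i)) →
                  IsPolynomial (λ s → sumFin (λ i → f i s))
  isPoly-sumFin {zero}  h = isPoly-const 0#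
  isPoly-sumFin {suc n} h = isPoly-+ (h zero) (isPoly-sumFin (h ∘ suc))

  isPoly-∑ : ∀ {I} {f : El I → Carrier → Carrier} → (∀ i → IsPolynomial (f i)) →
             IsPolynomial (λ s → ∑ (λ i → f i s))
  isPoly-∑ {fin n} h = isPoly-sumFin (λ i → h (ix i))
  isPoly-∑ {I ⊕ J} h = isPoly-+ (isPoly-∑ (λ i → h (inl i))) (isPoly-∑ (λ j → h (inr j)))
  isPoly-∑ {I ⊗ J} h = isPoly-∑ {I} (λ i → isPoly-∑ {J} (λ j → h (pr i j)))

  -- Horner's scheme: if q is the quotient of g by s - r, then that of c + s g(s) is g + r q. The
  -- degree bound falls by one.
  divide : ∀ {n f} → Polynomialᶠ (suc n) f → ∀ r →
           Σ (Carrier → Carrier) λ g → Polynomialᶠ n g × (∀ s → f s ≈ (s - r) * g s + f r)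
  divide (horner {g = g} c (null h) e) r = (λ _ → 0#) , null (λ _ → refl) , λ s → trans (at s)
      (sym (trans (+-cong (zeroʳ _) (at r)) (+-identityˡ _)))
    where
    at : ∀ s → _ ≈ c
    at s = trans (e s) (+0 (trans (*-congˡ (h s)) (zeroʳ s)))
  divide {suc n} (horner {f = f} {g = g} c p@(horner _ _ _) e) r with q , poly-q , eq ← divide p r =
    (λ s → g s + r * q s) ,
    ≡.subst (λ k → Polynomialᶠ k _) (ℕₚ.m≥n⇒m⊔n≡m (ℕₚ.n≤1+n n)) (poly-+ p (poly-scale r poly-q)) ,
    λ s → trans (e s) (trans (+-congˡ (*-congˡ (eq s)))
      (trans (solve 5 (λ c s r q gr → c :+ s :* ((s :- r) :* q :+ gr)
               := (s :- r) :* (((s :- r) :* q :+ gr) :+ r :* q) :+ (c :+ r :* gr)) refl c s r (q s) (g r))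
        (+-cong (*-congˡ (+-congʳ (sym (eq s)))) (sym (e r)))))

  -- Genericity in the parameter, tested on the integers `ι k` only. With an explicit bound, two
  -- generic conditions hold together beyond the maximum of their bounds, and `ι bound` is always a
  -- parameter at which to use them.
  record Cofinitely {p} (P : Carrier → Set p) : Set p where
    constructor _,_
    field
      bound : ℕ
      holds : ∀ k → bound ≤ k → P (ι k)

  cofinitely-∩ : ∀ {p q} {P : Carrier → Set p} {Q : Carrier → Set q} →
                 Cofinitely P → Cofinitely Q → Cofinitely (λ s → P s × Q s)
  cofinitely-∩ (M , p) (N , q) = M ℕ.⊔ N , λ k h →
    p k (ℕₚ.≤-trans (ℕₚ.m≤m⊔n M N) h) , q k (ℕₚ.≤-trans (ℕₚ.m≤n⊔m M N) h)

  cofinitely-map : ∀ {p q} {P : Carrier → Set p} {Q : Carrier → Set q} →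
                   (∀ {s} → P s → Q s) → Cofinitely P → Cofinitely Q
  cofinitely-map f (N , p) = N , λ k h → f (p k h)

  -- An integer root is divided out and the bound raised past it. The quotient is still nonzero at
  -- `s₀`, so the degree bound cannot run out before the integer roots do.
  nonzero-cofinitely : ∀ n {f} → Polynomialᶠ n f → ∀ s₀ → ¬ (f s₀ ≈ 0#) → ¬ ¬ Cofinitely (λ s → ¬ (f s ≈ 0#))
  nonzero-cofinitely zero (null h) s₀ f≉0 = contradiction (h s₀) f≉0
  nonzero-cofinitely (suc n) {f} p s₀ f≉0 = ¬¬-em {A = Σ ℕ λ k → f (ι k) ≈ 0#} >>= λ where
    (inj₂ none) → ¬¬-return (0 , λ k _ h → none (k , h))
    (inj₁ (k , root)) → let (g , q , eq) = divide p (ι k)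
                            eq′ : ∀ s → f s ≈ (s - ι k) * g s
                            eq′ s = trans (eq s) (+0 root)
      in do
        (N , h) ← nonzero-cofinitely n q s₀ (λ g≈0 → f≉0 (trans (eq′ s₀) (trans (*-congˡ g≈0) (zeroʳ _))))
        ¬¬-return (suc k ℕ.⊔ N , λ j j≥ fj≈0 → h j (ℕₚ.≤-trans (ℕₚ.m≤n⊔m (suc k) N) j≥)
          (*-cancel-≉0 (λ e → ℕₚ.<⇒≢ (ℕₚ.≤-trans (ℕₚ.m≤m⊔n (suc k) N) j≥) (≡.sym (ι-injective (x-y≈0⁻¹ e))))
            (trans (sym (eq′ (ι j))) fj≈0)))

  -- Injectivity of linear systems, by elimination

  infix 9 _∙_
  _∙_ : ∀ {n} → (Fin n → Carrier) → (Fin n → Carrier) → Carrier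
  a ∙ x = sumFin (λ j → a j * x j)

  Inj : ∀ {j q} {J : Set j} → (J → Fin q → Carrier) → Set (j ⊔ o ⊔ ℓ)
  Inj A = ∀ x → (∀ i → A i ∙ x ≈ 0#) → ∀ j → x j ≈ 0#

  -- A step of Gaussian elimination at the pivot `A i zero` by 2 × 2 minors. As nothing is divided,
  -- entries that are polynomial in a parameter stay polynomial.
  eliminate : ∀ {j q} {J : Set j} → (J → Fin (suc q) → Carrier) → J → J → Fin q → Carrier
  eliminate A i r j = A i zero * A r (suc j) - A r zero * A i (suc j)

  module _ {j q} {J : Set j} (A : J → Fin (suc q) → Carrier) (i : J) where
    ∙-eliminate : ∀ r y → eliminate A i r ∙ y ≈ A i zero * (A r ∘ suc) ∙ y - A r zero * (A i ∘ suc) ∙ y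
    ∙-eliminate r y = begin
      eliminate A i r ∙ y
        ≈⟨ sumFin-cong (λ j → solve 5 (λ a b c d y → (a :* b :- c :* d) :* y := a :* (b :* y) :- c :* (d :* y)) refl (A i zero) (A r (suc j)) (A r zero) (A i (suc j)) (y j)) ⟩
      sumFin (λ j → A i zero * (A r (suc j) * y j) - A r zero * (A i (suc j) * y j))
        ≈⟨ ∑-minus {fin q} (λ { (ix j) → A i zero * (A r (suc j) * y j) }) (λ { (ix j) → A r zero * (A i (suc j) * y j) }) ⟩
      sumFin (λ j → A i zero * (A r (suc j) * y j)) - sumFin (λ j → A r zero * (A i (suc j) * y j))
        ≈⟨ +-cong (∑-*ˡ {fin q} _ (λ { (ix j) → A r (suc j) * y j })) (-‿cong (∑-*ˡ {fin q} _ (λ { (ix j) → A i (suc j) * y j }))) ⟩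
      A i zero * (A r ∘ suc) ∙ y - A r zero * (A i ∘ suc) ∙ y ∎

    eliminate-pivot : ∀ j → eliminate A i i j ≈ 0#
    eliminate-pivot j = -‿inverseʳ _

    eliminate-inj : ¬ (A i zero ≈ 0#) → Inj A → Inj (eliminate A i)
    eliminate-inj p≉0 inj y h j with p⁻¹ , pp⁻¹≈1 ← inverse (A i zero) p≉0 = inj x Ax≈0 (suc j)
      where
      x : Fin (suc q) → Carrier
      x zero    = - (p⁻¹ * (A i ∘ suc) ∙ y)
      x (suc j) = y j
      Ax≈0 : ∀ r → A r ∙ x ≈ 0#
      Ax≈0 r = *-cancel-≉0 p≉0 (begin
        A i zero * (A r zero * (- (p⁻¹ * (A i ∘ suc) ∙ y)) + (A r ∘ suc) ∙ y)
          ≈⟨ solve 5 (λ p b c d e → p :* (b :* (:- (c :* d)) :+ e) := p :* e :- b :* ((p :* c) :* d)) refl _ _ _ _ _ ⟩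
        A i zero * (A r ∘ suc) ∙ y - A r zero * ((A i zero * p⁻¹) * (A i ∘ suc) ∙ y)
          ≈⟨ +-congˡ (-‿cong (*-congˡ (trans (*-congʳ pp⁻¹≈1) (*-identityˡ _)))) ⟩
        A i zero * (A r ∘ suc) ∙ y - A r zero * (A i ∘ suc) ∙ y
          ≈⟨ ∙-eliminate r y ⟨
        eliminate A i r ∙ y
          ≈⟨ h r ⟩
        0# ∎)

    eliminate-inj⁻¹ : ∀ {k} (rows : Fin k → J) → ¬ (A i zero ≈ 0#) → Inj (eliminate A i ∘ rows) →
                      Inj (A ∘ (i ∷ rows))
    eliminate-inj⁻¹ rows p≉0 inj x h = λ where
        zero    → *-cancel-≉0 p≉0 (trans (sym (+0 (tail≈0 i))) (h zero))
        (suc j) → y≈0 j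
      where
      y≈0 : ∀ j → x (suc j) ≈ 0#
      y≈0 = inj (x ∘ suc) (λ r → begin
        eliminate A i (rows r) ∙ (x ∘ suc)
          ≈⟨ ∙-eliminate (rows r) (x ∘ suc) ⟩
        A i zero * (A (rows r) ∘ suc) ∙ (x ∘ suc) - A (rows r) zero * (A i ∘ suc) ∙ (x ∘ suc)
          ≈⟨ solve 5 (λ p b c d x → p :* c :- b :* d := p :* (b :* x :+ c) :- b :* (p :* x :+ d)) refl _ _ _ _ (x zero) ⟩
        A i zero * (A (rows r) ∙ x) - A (rows r) zero * (A i ∙ x)
          ≈⟨ +-cong (*-congˡ (h (suc r))) (-‿cong (*-congˡ (h zero))) ⟩
        A i zero * 0# - A (rows r) zero * 0#
          ≈⟨ trans (+-cong (zeroʳ _) (-‿cong (zeroʳ _))) (-‿inverseʳ 0#) ⟩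
        0# ∎)
      tail≈0 : ∀ r → (A r ∘ suc) ∙ (x ∘ suc) ≈ 0#
      tail≈0 r = ∑-0 {fin q} {λ { (ix j) → A r (suc j) * x (suc j) }} (λ { (ix j) → trans (*-congˡ (y≈0 j)) (zeroʳ _) })

  unit : ∀ {q} → Fin (suc q) → Carrier
  unit zero    = 1#
  unit (suc _) = 0#

  ∙-unit : ∀ {q} (a : Fin (suc q) → Carrier) → a ∙ unit ≈ a zero
  ∙-unit {q} a = trans (+-cong (*-identityʳ _) (∑-zeroʳ {fin q} (λ { (ix j) → a (suc j) }))) (+-identityʳ _)

  pivot : ∀ {j q} {J : Set j} (A : J → Fin (suc q) → Carrier) → Inj A → ¬ ¬ Σ J (λ i → ¬ (A i zero ≈ 0#))
  pivot A inj none = 1≉0 (inj unit (λ i → trans (∙-unit (A i)) (stable (λ p → none (i , p)))) zero)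

  -- Rows and pivots are chosen at `s₀`. Each pivot is a polynomial in s that is nonzero at `s₀`, so
  -- the same rows serve for almost all s. For a constant family this simply extracts q rows that
  -- determine the unknowns.
  generic-rows : ∀ q {j} {J : Set j} (M : Carrier → J → Fin q → Carrier) →
                 (∀ i j → IsPolynomial (λ s → M s i j)) → ∀ s₀ → Inj (M s₀) →
                 ¬ ¬ Σ (Fin q → J) λ rows → Cofinitely (λ s → Inj (M s ∘ rows))
  generic-rows zero    M poly s₀ inj = ¬¬-return ((λ ()) , 0 , λ _ _ _ _ ())
  generic-rows (suc q) M poly s₀ inj = do
    (i , p≉0) ← pivot (M s₀) inj
    (rows , c) ← generic-rows q (λ s → eliminate (M s) i)
      (λ r j → isPoly-+ (isPoly-* (poly i zero) (poly r (suc j))) (isPoly-neg (isPoly-* (poly r zero) (poly i (suc j)))))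
      s₀ (eliminate-inj (M s₀) i p≉0 inj)
    c′ ← nonzero-cofinitely _ (proj₂ (poly i zero)) s₀ p≉0
    ¬¬-return (i ∷ rows , cofinitely-map (λ { {s} (inj′ , p) → eliminate-inj⁻¹ (M s) i rows p inj′ }) (cofinitely-∩ c c′))

  -- Elimination removes one equation and one unknown: the pivot row turns into zero, so `punchIn`
  -- may skip it.
  wide⇒¬inj : ∀ p q → p < q → (A : Fin p → Fin q → Carrier) → ¬ Inj A
  wide⇒¬inj zero    (suc q) _         A inj = 1≉0 (inj unit (λ ()) zero)
  wide⇒¬inj (suc p) (suc q) (s≤s p<q) A inj = pivot A inj λ (i , p≉0) →
    wide⇒¬inj p q p<q (eliminate A i ∘ Fin.punchIn i) λ y h →
      eliminate-inj A i p≉0 inj y (λ r → case-row i y h r (i Fin.≟ r))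
    where
    case-row : ∀ i y → (∀ r → eliminate A i (Fin.punchIn i r) ∙ y ≈ 0#) →
               ∀ r → Dec (i ≡ r) → eliminate A i r ∙ y ≈ 0#
    case-row i y h r (no i≢r) =
      trans (reflexive (≡.cong (λ r → eliminate A i r ∙ y) (≡.sym (Finₚ.punchIn-punchOut i≢r)))) (h (Fin.punchOut i≢r))
    case-row i y h r (yes ≡.refl) = ∑-0 {fin q} {λ { (ix j) → eliminate A i i j * y j }}
      (λ { (ix j) → trans (*-congʳ (eliminate-pivot A i j)) (zeroˡ _) })

  Injᴱ : ∀ {j} {J : Set j} {I : Dim} → (J → El I → Carrier) → Set (j ⊔ o ⊔ ℓ)
  Injᴱ {I = I} A = ∀ (x : El I → Carrier) → (∀ i → ∑ (λ k → A i k * x k) ≈ 0#) → ∀ k → x k ≈ 0#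

  module _ {j} {J : Set j} {I : Dim} where
    flatten : (J → El I → Carrier) → J → Fin (size I) → Carrier
    flatten A i k = A i (element I k)

    flatten-inj : ∀ {A : J → El I → Carrier} → Injᴱ A → Inj (flatten A)
    flatten-inj {A} inj x h k = trans (reflexive (≡.cong x (≡.sym (index-element I k))))
      (inj (x ∘ index) (λ i → trans (∑-flatten {I} _) (trans
        (sumFin-cong (λ k → *-congˡ (reflexive (≡.cong x (index-element I k))))) (h i))) (element I k))

    flatten-inj⁻¹ : ∀ {A : J → El I → Carrier} → Inj (flatten A) → Injᴱ A
    flatten-inj⁻¹ {A} inj x h i = trans (reflexive (≡.cong x (≡.sym (element-index i))))
      (inj (x ∘ element I) (λ r → trans (sym (∑-flatten {I} _)) (h r)) (index i))

    generic-inj : (M : Carrier → J → El I → Carrier) → (∀ i j → IsPolynomial (λ s → M s i j)) →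
                  ∀ s₀ → Injᴱ (M s₀) → ¬ ¬ Cofinitely (λ s → Injᴱ (M s))
    generic-inj M poly s₀ inj = do
      (rows , c) ← generic-rows (size I) (λ s → flatten (M s)) (λ i j → poly i (element I j)) s₀ (flatten-inj inj)
      ¬¬-return (cofinitely-map (λ {s} inj → flatten-inj⁻¹ (λ x h → inj x (λ r → h (rows r)))) c)

  wide⇒¬injᴱ : ∀ {I} d → d < size I → (A : Fin d → El I → Carrier) → ¬ Injᴱ A
  wide⇒¬injᴱ {I} d d< A inj = wide⇒¬inj d (size I) d< (flatten A) (flatten-inj inj)

  ≋δ⇒inj : ∀ {I} {A : Mtx I I} → A ≋ δ → Injᴱ A
  ≋δ⇒inj {I} e x h i = trans (sym (trans (∑-cong {I} (λ k → *-congʳ (e i k))) (∑-δˡ i x))) (h i)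

  -- The matrix (-y | A) has one more unknown than equations. If there were no solution, any (t, x)
  -- in its kernel would have t = 0, as otherwise x / t is a solution; then x = 0 since A is
  -- injective, contradicting `wide⇒¬inj`.
  solvable : ∀ {I} (A : Mtx I I) → Injᴱ A → ∀ y → ¬ ¬ Σ (El I → Carrier) λ x → ∀ i → ∑ (λ k → A i k * x k) ≈ y i
  solvable {I} A inj y none = wide⇒¬inj (size I) (suc (size I)) ℕₚ.≤-refl
    (λ r → - y (element I r) ∷ (λ k → A (element I r) (element I k))) λ x h →
      let Ax≈ty : ∀ i → ∑ (λ k → A i k * x (suc (index k))) ≈ x zero * y i
          Ax≈ty i = begin
            ∑ (λ k → A i k * x (suc (index k)))
              ≈⟨ ∑-flatten {I} _ ⟩
            sumFin (λ k → A i (element I k) * x (suc (index (element I k))))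
              ≈⟨ sumFin-cong (λ k → *-cong (reflexive (≡.cong (λ i → A i (element I k)) (≡.sym (element-index i))))
                                           (reflexive (≡.cong (λ k → x (suc k)) (index-element I k)))) ⟩
            sumFin (λ k → A (element I (index i)) (element I k) * x (suc k))
              ≈⟨ solve 3 (λ y x s → s := (((:- y) :* x) :+ s) :+ x :* y) refl _ _ _ ⟩
            (- y (element I (index i)) * x zero + sumFin (λ k → A (element I (index i)) (element I k) * x (suc k)))
              + x zero * y (element I (index i))
              ≈⟨ 0+ (h (index i)) ⟩
            x zero * y (element I (index i))
              ≈⟨ *-congˡ (reflexive (≡.cong y (element-index i))) ⟩
            x zero * y i ∎
          t≈0 : x zero ≈ 0#
          t≈0 = stable λ t≉0 → let (t⁻¹ , tt⁻¹≈1) = inverse (x zero) t≉0 in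
            none ((λ k → x (suc (index k)) * t⁻¹) , λ i → begin
              ∑ (λ k → A i k * (x (suc (index k)) * t⁻¹))
                ≈⟨ ∑-cong {I} (λ k → sym (*-assoc _ _ _)) ⟩
              ∑ (λ k → A i k * x (suc (index k)) * t⁻¹)
                ≈⟨ ∑-*ʳ {I} t⁻¹ (λ k → A i k * x (suc (index k))) ⟩
              ∑ (λ k → A i k * x (suc (index k))) * t⁻¹
                ≈⟨ *-congʳ (Ax≈ty i) ⟩
              x zero * y i * t⁻¹
                ≈⟨ solve 3 (λ t y u → t :* y :* u := (t :* u) :* y) refl _ _ _ ⟩
              (x zero * t⁻¹) * y i
                ≈⟨ trans (*-congʳ tt⁻¹≈1) (*-identityˡ _) ⟩
              y i ∎)
      in λ where
        zero    → t≈0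
        (suc k) → trans (reflexive (≡.cong (λ k → x (suc k)) (≡.sym (index-element I k))))
          (inj (λ k → x (suc (index k))) (λ i → trans (Ax≈ty i) (trans (*-congʳ t≈0) (zeroˡ _))) (element I k))

  -- The columns of a right inverse B solve for the unit vectors; A (B A - 1) = 0 and injectivity
  -- make B a left inverse as well.
  invertible : ∀ {I} (A : Mtx I I) → Injᴱ A → ¬ ¬ Σ (Mtx I I) (λ B → Inverses A B)
  invertible {I} A inj = do
    solutions ← ¬¬-choice (λ j → solvable A inj (λ i → δ i j))
    let B : Mtx I I
        B i j = proj₁ (solutions j) i
        AB≋1 : A · B ≋ δ
        AB≋1 i j = proj₂ (solutions j) i
    ¬¬-return (B , inverses AB≋1 λ i j → x-y≈0⁻¹ (inj (λ k → (B · A) k j - δ k j) (λ r → begin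
      ∑ (λ k → A r k * ((B · A) k j - δ k j))
        ≈⟨ ∑-cong {I} (λ k → solve 3 (λ a b c → a :* (b :- c) := a :* b :- a :* c) refl (A r k) ((B · A) k j) (δ k j)) ⟩
      ∑ (λ k → A r k * (B · A) k j - A r k * δ k j)
        ≈⟨ ∑-minus {I} _ _ ⟩
      (A · (B · A)) r j - (A · δ) r j
        ≈⟨ x-y≈0 (trans (sym (·-assoc A B A r j)) (trans (·-congʳ A AB≋1 r j)
             (trans (·-idˡ A r j) (sym (·-idʳ A r j))))) ⟩
      0# ∎) i))

  generic-inverse : ∀ {I} (A : Carrier → Mtx I I) → (∀ i j → IsPolynomial (λ s → A s i j)) → A 1# ≋ δ →
                    ¬ ¬ Cofinitely (λ s → ¬ ¬ Σ (Mtx I I) (λ B → Inverses (A s) B))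
  generic-inverse A poly e = do
    c ← generic-inj A poly 1# (≋δ⇒inj e)
    ¬¬-return (cofinitely-map (λ {s} → invertible (A s)) c)

  -- K has dimension at least n: fewer than n linear functionals never separate its points.
  Large : ∀ {I} → ((El I → Carrier) → Set ℓ) → ℕ → Set (o ⊔ ℓ)
  Large {I} K n = ∀ d → d < n → (C : Fin d → (El I → Carrier) → Carrier) → (∀ i → Lin (C i)) →
    ¬ (∀ x → K x → (∀ i → C i x ≈ 0#) → ∀ j → x j ≈ 0#)

  large-≅ : ∀ {D₁ D₂ D₃ E₁ E₂ E₃} {f : Form D₁ D₂ D₃} {f′ : Form E₁ E₂ E₃} {n} →
            f ≅ f′ → Large (Ker f′) n → Large (Ker f) n
  large-≅ iso large d d<n C lin h = large d d<n (λ i y → C i (extend y)) (λ i → lin-∘ (lin i) extend-linear)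
    λ y k Cy≈0 j → trans (sym (restrict-extend y j))
      (lin-zero (restrict-linear j) (h (extend y) (extend-ker k) Cy≈0))
    where open _≅_ iso

  lin-expandʳ : ∀ {I φ} → Lin {I} φ → ∀ x → ∑ (λ k → φ (δ k) * x k) ≈ φ x
  lin-expandʳ {I} {φ} p x = trans (∑-cong {I} (λ k → *-comm (φ (δ k)) (x k))) (sym (lin-expand p x))

  -- Lines of forms, and reduction of their generic members

  mix : Carrier → Carrier → Carrier → Carrier
  mix s a b = (1# - s) * a + s * b

  mix-0 : ∀ a b → mix 0# a b ≈ a
  mix-0 a b = trans (+-cong (*-congʳ (trans (+-congˡ -0#≈0#) (+-identityʳ _))) (zeroˡ b))
                    (trans (+-identityʳ _) (*-identityˡ a))

  mix-1 : ∀ a b → mix 1# a b ≈ b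
  mix-1 a b = trans (+-cong (trans (*-congʳ (-‿inverseʳ 1#)) (zeroˡ a)) (*-identityˡ b)) (+-identityˡ b)

  mix-same : ∀ s a {b} → a ≈ b → mix s a b ≈ b
  mix-same s a {b} e = trans (+-congʳ (*-congˡ e))
    (trans (solve 3 (λ i s b → (i :- s) :* b :+ s :* b := i :* b) refl 1# s b) (*-identityˡ b))

  isPoly-mix : ∀ a b → IsPolynomial (λ s → mix s a b)
  isPoly-mix a b = isPoly-+ (isPoly-* (isPoly-+ (isPoly-const 1#) (isPoly-neg isPoly-id)) (isPoly-const a))
                            (isPoly-* isPoly-id (isPoly-const b))

  module _ {D₁ D₂ D₃ : Dim} where
    pencil : Form D₁ D₂ D₃ → Form D₁ D₂ D₃ → Carrier → Form D₁ D₂ D₃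
    pencil f f⁰ s = form (λ i j → mix s (M₁ f i j) (M₁ f⁰ i j)) (λ i j → mix s (M₂ f i j) (M₂ f⁰ i j))
      (λ i j → mix s (M₃ f i j) (M₃ f⁰ i j))
      (λ i j → mix s (ξ₁ f i j) (ξ₁ f⁰ i j)) (λ i j → mix s (ξ₃ f i j) (ξ₃ f⁰ i j))

    pencil-0 : ∀ f f⁰ → pencil f f⁰ 0# ≈ᶠ f
    pencil-0 f f⁰ = form≈ (λ _ _ → mix-0 _ _) (λ _ _ → mix-0 _ _) (λ _ _ → mix-0 _ _)
                          (λ _ _ → mix-0 _ _) (λ _ _ → mix-0 _ _)

    isPoly-ad* : ∀ f f⁰ x i → IsPolynomial (λ s → ad* (pencil f f⁰ s) x i)
    isPoly-ad* f f⁰ x = λ where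
        (pP i j) → isPoly-+ (isPoly-+ (left (m M₁) (P x) j i) (left (m ξ₁) (Q x) j i)) (isPoly-neg (right (P x) (m M₁) j i))
        (pQ i j) → isPoly-+ (left (m ξ₁) (R x) j i) (isPoly-neg (right (P x) (m ξ₁) j i))
        (pR i j) → isPoly-+ (left (m M₂) (R x) j i) (isPoly-neg (isPoly-+ (right (R x) (m M₂) j i)
          (isPoly-+ (right (Q x) (m ξ₁) j i) (right (S x) (m ξ₃) j i))))
        (pS i j) → isPoly-+ (left (m ξ₃) (R x) j i) (isPoly-neg (right (T x) (m ξ₃) j i))
        (pT i j) → isPoly-+ (isPoly-+ (left (m M₃) (T x) j i) (left (m ξ₃) (S x) j i)) (isPoly-neg (right (T x) (m M₃) j i))
      where
      m : ∀ {I J} (c : Form D₁ D₂ D₃ → Mtx I J) i j → IsPolynomial (λ s → mix s (c f i j) (c f⁰ i j))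
      m c i j = isPoly-mix (c f i j) (c f⁰ i j)
      left : ∀ {I J K} {A : Carrier → Mtx I J} → (∀ i j → IsPolynomial (λ s → A s i j)) → (B : Mtx J K) →
             ∀ i k → IsPolynomial (λ s → (A s · B) i k)
      left {J = J} p B i k = isPoly-∑ {J} (λ j → isPoly-* (p i j) (isPoly-const (B j k)))
      right : ∀ {I J K} (A : Mtx I J) {B : Carrier → Mtx J K} → (∀ i j → IsPolynomial (λ s → B s i j)) →
              ∀ i k → IsPolynomial (λ s → (A · B s) i k)
      right {J = J} A p i k = isPoly-∑ {J} (λ j → isPoly-* (isPoly-const (A i j)) (p j k))

    -- The dimension of the kernel is upper semicontinuous.
    large-pencil : ∀ f f⁰ {n} → ¬ ¬ Cofinitely (λ s → Large (Ker (pencil f f⁰ s)) n) → Large (Ker f) n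
    large-pencil f f⁰ {n} cofinitely d d<n C lin h =
      -- If d functionals separate `Ker f`, the kernel equations and the functionals together form
      -- an injective system at s = 0, hence at almost all s, where the functionals then contradict
      -- `Large`.
      (do c  ← cofinitely
          c′ ← generic-inj system isPoly-system 0# inj₀
          let c″ = cofinitely-∩ c c′
              (large , inj) = Cofinitely.holds c″ (Cofinitely.bound c″) ℕₚ.≤-refl
          ¬¬-return (large d d<n C lin λ x k Cx≈0 → inj x λ where
            (inj₁ i) → trans (apply₁ (ι (Cofinitely.bound c″)) x i) (ker⇒ad* k i)
            (inj₂ i) → trans (apply₂ x i) (Cx≈0 i)))
      (λ ())
      where
      system : Carrier → El (SW D₁ D₂ D₃) ⊎ Fin d → El (SW D₁ D₂ D₃) → Carrier
      system s (inj₁ i) k = ad* (pencil f f⁰ s) (δ k) i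
      system s (inj₂ i) k = C i (δ k)
      isPoly-system : ∀ i k → IsPolynomial (λ s → system s i k)
      isPoly-system (inj₁ i) k = isPoly-ad* f f⁰ (δ k) i
      isPoly-system (inj₂ i) k = isPoly-const (C i (δ k))
      apply₁ : ∀ s x i → ∑ {SW D₁ D₂ D₃} (λ k → system s (inj₁ i) k * x k) ≈ ad* (pencil f f⁰ s) x i
      apply₁ s x i = lin-expandʳ (ad*-linear (pencil f f⁰ s) i) x
      apply₂ : ∀ x i → ∑ {SW D₁ D₂ D₃} (λ k → system 0# (inj₂ i) k * x k) ≈ C i x
      apply₂ x i = lin-expandʳ (lin i) x
      inj₀ : Injᴱ (system 0#)
      inj₀ x e = h x (Ker-congᶠ (pencil-0 f f⁰) (ad*⇒ker λ i → trans (sym (apply₁ 0# x i)) (e (inj₁ i))))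
                     (λ i → trans (sym (apply₂ x i)) (e (inj₂ i)))

  δ-central : ∀ {I J} (A : Mtx I J) → A · δ ≋ δ · A
  δ-central A = ≋-trans (·-idʳ A) (≋-sym (·-idˡ A))

  -- Every f deforms to f⁰, so it suffices to treat the nearby forms that a change of basis brings to
  -- normal form.
  large-injective : ∀ {C D₂ D₃ n} → (∀ (f : Form C D₂ D₃) → Large (Ker f) n) →
                    ∀ (f : Form (D₂ ⊕ C) D₂ D₃) → Large (Ker f) n
  large-injective {C} {D₂} {D₃} {n} ih f = large-pencil f f⁰ (do
      c ← generic-inverse g poly at-1
      ¬¬-return (cofinitely-map (λ {s} inv d d<n Cs lin h → inv λ (h₁ , i) → normal s h₁ i d d<n Cs lin h) c))
    where
    module N = Injective {C} {D₂} {D₃}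
    open Inclusion {C} {D₂}
    f⁰ : Form (D₂ ⊕ C) D₂ D₃
    f⁰ = form (M₁ f) (M₂ f) (M₃ f) ξ⁰ (ξ₃ f)
    -- The columns of ξ₁, completed by unit columns for C. This is the identity at s = 1, so
    -- generically it is a change of basis of V₁, and it takes ξ⁰ to ξ₁.
    g : Carrier → Mtx (D₂ ⊕ C) (D₂ ⊕ C)
    g s i (inl j) = ξ₁ (pencil f f⁰ s) i j
    g s i (inr j) = δ i (inr j)
    poly : ∀ i j → IsPolynomial (λ s → g s i j)
    poly i (inl j) = isPoly-mix _ _
    poly i (inr j) = isPoly-const _
    at-1 : g 1# ≋ δ
    at-1 (inl i) (inl j) = mix-1 _ _
    at-1 (inr i) (inl j) = mix-1 _ _
    at-1 i       (inr j) = refl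
    normal : ∀ s h₁ → Inverses (g s) h₁ → Large (Ker (pencil f f⁰ s)) n
    normal s h₁ i = large-≅ (conj-≅ {f = fₛ} {N.full M₁′ (M₂ fₛ) (M₃ fₛ) (ξ₃ fₛ)} i Inverses-δ Inverses-δ
        (intertwines (≋-sym (cancelˡ (Inverses-sym i) (M₁ fₛ · g s))) (δ-central (M₂ fₛ)) (δ-central (M₃ fₛ))
          ξ₁-normal (δ-central (ξ₃ fₛ))))
        (large-≅ (N.full≅reduced M₁′ (M₂ fₛ) (M₃ fₛ) (ξ₃ fₛ)) (ih _))
      where
      fₛ = pencil f f⁰ s
      M₁′ : Mtx (D₂ ⊕ C) (D₂ ⊕ C)
      M₁′ = h₁ · (M₁ fₛ · g s)
      ξ₁-normal : ξ₁ (pencil f f⁰ s) · δ ≋ g s · ξ⁰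
      ξ₁-normal i j = trans (·-idʳ (ξ₁ (pencil f f⁰ s)) i j)
        (sym (trans (+0 (∑-zeroʳ {C} _)) (∑-δʳ j (λ k → g s i (inl k)))))

  large-surjective : ∀ {D₁ Z D₃ n} → (∀ (f : Form D₁ Z D₃) → Large (Ker f) n) →
                     ∀ (f : Form D₁ (D₁ ⊕ D₃ ⊕ Z) D₃) → Large (Ker f) n
  large-surjective {D₁} {Z} {D₃} {n} ih f = large-pencil f f⁰ (do
      c ← generic-inverse h₂ poly at-1
      ¬¬-return (cofinitely-map (λ {s} inv d d<n Cs lin h → inv λ (g₂ , i) → normal s g₂ i d d<n Cs lin h) c))
    where
    module N = Surjective {D₁} {Z} {D₃}
    open Projections {D₁} {Z} {D₃}
    f⁰ : Form D₁ (D₁ ⊕ D₃ ⊕ Z) D₃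
    f⁰ = form (M₁ f) (M₂ f) (M₃ f) ξ₁⁰ ξ₃⁰
    -- The rows of ξ₁ and ξ₃, completed by unit rows for Z: in the coordinates on V₂ that they
    -- define, ξ₁ and ξ₃ are the projections.
    h₂ : Carrier → Mtx (D₁ ⊕ D₃ ⊕ Z) (D₁ ⊕ D₃ ⊕ Z)
    h₂ s (in₁ i) j = ξ₁ (pencil f f⁰ s) i j
    h₂ s (in₂ i) j = ξ₃ (pencil f f⁰ s) i j
    h₂ s (in₃ i) j = δ (in₃ i) j
    poly : ∀ i j → IsPolynomial (λ s → h₂ s i j)
    poly (in₁ i) j = isPoly-mix _ _
    poly (in₂ i) j = isPoly-mix _ _
    poly (in₃ i) j = isPoly-const _
    at-1 : h₂ 1# ≋ δ
    at-1 (in₁ i) (inl j) = mix-1 _ _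
    at-1 (in₁ i) (inr j) = mix-1 _ _
    at-1 (in₂ i) (in₁ j) = mix-1 _ _
    at-1 (in₂ i) (in₂ j) = mix-1 _ _
    at-1 (in₂ i) (in₃ j) = mix-1 _ _
    at-1 (in₃ i) j       = refl
    normal : ∀ s g₂ → Inverses (h₂ s) g₂ → Large (Ker (pencil f f⁰ s)) n
    normal s g₂ i = large-≅ (conj-≅ {f = fₛ} {N.full (M₁ fₛ) M₂′ (M₃ fₛ)} Inverses-δ (Inverses-sym i) Inverses-δ
        (intertwines⁻¹ Inverses-δ i Inverses-δ (intertwines
          (δ-central (M₁ fₛ)) (cancelʳ (Inverses-sym i) (h₂ s · M₂ fₛ)) (δ-central (M₃ fₛ))
          (λ i j → trans (ξ₁⁰· (h₂ s) i j) (sym (·-idˡ (ξ₁ fₛ) i j)))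
          (λ i j → trans (ξ₃⁰· (h₂ s) i j) (sym (·-idˡ (ξ₃ fₛ) i j))))))
      (large-≅ (N.full≅reduced (M₁ fₛ) M₂′ (M₃ fₛ)) (ih _))
      where
      fₛ = pencil f f⁰ s
      M₂′ : Mtx (D₁ ⊕ D₃ ⊕ Z) (D₁ ⊕ D₃ ⊕ Z)
      M₂′ = (h₂ s · M₂ fₛ) · g₂

  module _ {K L J : Dim} where
    private
      module N = Transverse {K} {L} {J}
    open TransverseProjections {K} {L} {J}

    -- The rows of ξ₁ and the rows `inl` of ξ₃ are exactly enough to serve as coordinates on V₂,
    -- which `large-transverse` arranges by one change of basis. The L rows of ξ₃ stay arbitrary,
    -- and straightening them takes a second deformation.
    record HalfNormal (f : Form (K ⊕ L) (K ⊕ J ⊕ L) (J ⊕ L)) : Set (o ⊔ ℓ) where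
      field
        ξ₁≋ : ξ₁ f ≋ ξ₁⁰
        ξ₃≋ : ∀ i j → ξ₃ f (inl i) j ≈ ξ₃⁰ (inl i) j
    open HalfNormal

    ξ₁⁰-rows : (∀ i j → ξ₁⁰ (inl i) j ≈ δ (in₁ i) j) × (∀ i j → ξ₁⁰ (inr i) j ≈ δ (in₃ i) j)
    ξ₁⁰-rows = (λ { i (in₁ j) → refl ; i (inr j) → refl })
             , (λ { i (in₁ j) → refl ; i (in₂ j) → refl ; i (in₃ j) → refl })

    ξ₃⁰-rows : ∀ i j → ξ₃⁰ i j ≈ δ (inr i) j
    ξ₃⁰-rows i (inl j) = refl
    ξ₃⁰-rows i (inr j) = refl

    large-halfNormal : ∀ {n} → (∀ (f : Form K L J) → Large (Ker f) n) →
                       ∀ (f : Form (K ⊕ L) (K ⊕ J ⊕ L) (J ⊕ L)) → HalfNormal f → Large (Ker f) n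
    large-halfNormal {n} ih f half = large-pencil f f⁰ (do
        c₁ ← generic-inverse h₁ poly₁ at-1₁
        c₂ ← generic-inverse h₂ poly₂ at-1₂
        c₃ ← generic-inverse h₃ poly₃ at-1₃
        ¬¬-return (cofinitely-map (λ { {s} (inv₁ , inv₂ , inv₃) d d<n Cs lin h →
            inv₁ λ (g₁ , i₁) → inv₂ λ (g₂ , i₂) → inv₃ λ (g₃ , i₃) → normal s i₁ i₂ i₃ d d<n Cs lin h })
          (cofinitely-∩ c₁ (cofinitely-∩ c₂ c₃))))
      where
      f⁰ : Form (K ⊕ L) (K ⊕ J ⊕ L) (J ⊕ L)
      f⁰ = form (M₁ f) (M₂ f) (M₃ f) ξ₁⁰ ξ₃⁰
      w : Carrier → Mtx L (K ⊕ J ⊕ L)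
      w s i j = ξ₃ (pencil f f⁰ s) (inr i) j
      w-1 : ∀ i j → w 1# i j ≈ δ (in₃ i) j
      w-1 i j = trans (mix-1 _ _) (ξ₃⁰-rows (inr i) j)
      -- Let (u, v, w) be the K, J and L parts of the L rows of ξ₃. `h₃` clears v by means of the
      -- rows `inl`, the remaining (u, 0, w) is the row `in₃` of `h₂`, and `h₁` repeats it so that
      -- ξ₁ keeps its normal form.
      h₁ : Carrier → Mtx (K ⊕ L) (K ⊕ L)
      h₁ s (inl i) j       = δ (inl i) j
      h₁ s (inr i) (inl j) = w s i (in₁ j)
      h₁ s (inr i) (inr j) = w s i (in₃ j)
      h₂ : Carrier → Mtx (K ⊕ J ⊕ L) (K ⊕ J ⊕ L)
      h₂ s (in₁ i) j       = δ (in₁ i) j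
      h₂ s (in₂ i) j       = δ (in₂ i) j
      h₂ s (in₃ i) (in₁ j) = w s i (in₁ j)
      h₂ s (in₃ i) (in₂ j) = 0#
      h₂ s (in₃ i) (in₃ j) = w s i (in₃ j)
      h₃ : Carrier → Mtx (J ⊕ L) (J ⊕ L)
      h₃ s (inl i) j       = δ (inl i) j
      h₃ s (inr i) (inl j) = - w s i (in₂ j)
      h₃ s (inr i) (inr j) = δ (inr {J} i) (inr j)
      poly₁ : ∀ i j → IsPolynomial (λ s → h₁ s i j)
      poly₁ (inl i) j       = isPoly-const _
      poly₁ (inr i) (inl j) = isPoly-mix _ _
      poly₁ (inr i) (inr j) = isPoly-mix _ _
      poly₂ : ∀ i j → IsPolynomial (λ s → h₂ s i j)
      poly₂ (in₁ i) j       = isPoly-const _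
      poly₂ (in₂ i) j       = isPoly-const _
      poly₂ (in₃ i) (in₁ j) = isPoly-mix _ _
      poly₂ (in₃ i) (in₂ j) = isPoly-const _
      poly₂ (in₃ i) (in₃ j) = isPoly-mix _ _
      poly₃ : ∀ i j → IsPolynomial (λ s → h₃ s i j)
      poly₃ (inl i) j       = isPoly-const _
      poly₃ (inr i) (inl j) = isPoly-neg (isPoly-mix _ _)
      poly₃ (inr i) (inr j) = isPoly-const _
      at-1₁ : h₁ 1# ≋ δ
      at-1₁ (inl i) j       = refl
      at-1₁ (inr i) (inl j) = w-1 i (in₁ j)
      at-1₁ (inr i) (inr j) = w-1 i (in₃ j)
      at-1₂ : h₂ 1# ≋ δ
      at-1₂ (in₁ i) j       = refl
      at-1₂ (in₂ i) j       = refl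
      at-1₂ (in₃ i) (in₁ j) = w-1 i (in₁ j)
      at-1₂ (in₃ i) (in₂ j) = refl
      at-1₂ (in₃ i) (in₃ j) = w-1 i (in₃ j)
      at-1₃ : h₃ 1# ≋ δ
      at-1₃ (inl i) j       = refl
      at-1₃ (inr i) (inl j) = trans (-‿cong (w-1 i (in₂ j))) -0#≈0#
      at-1₃ (inr i) (inr j) = refl
      module _ (s : Carrier) where
        fₛ = pencil f f⁰ s
        ξ₁-normal : ∀ i j → (ξ₁⁰ · h₂ s) i j ≈ (h₁ s · ξ₁ fₛ) i j
        ξ₁-normal i j = trans (row i j) (sym (·-congˡ (h₁ s) (λ i j → mix-same s _ (ξ₁≋ half i j)) i j))
          where
          row : ∀ i j → (ξ₁⁰ · h₂ s) i j ≈ (h₁ s · ξ₁⁰) i j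
          row (inl i) (in₁ j) = trans (ξ₁⁰·₁ (h₂ s) i (in₁ j)) (sym (·ξ₁⁰₁ (h₁ s) (inl i) j))
          row (inl i) (in₂ j) = trans (ξ₁⁰·₁ (h₂ s) i (in₂ j)) (sym (·ξ₁⁰₂ (h₁ s) (inl i) j))
          row (inl i) (in₃ j) = trans (ξ₁⁰·₁ (h₂ s) i (in₃ j)) (sym (·ξ₁⁰₃ (h₁ s) (inl i) j))
          row (inr i) (in₁ j) = trans (ξ₁⁰·₂ (h₂ s) i (in₁ j)) (sym (·ξ₁⁰₁ (h₁ s) (inr i) j))
          row (inr i) (in₂ j) = trans (ξ₁⁰·₂ (h₂ s) i (in₂ j)) (sym (·ξ₁⁰₂ (h₁ s) (inr i) j))
          row (inr i) (in₃ j) = trans (ξ₁⁰·₂ (h₂ s) i (in₃ j)) (sym (·ξ₁⁰₃ (h₁ s) (inr i) j))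
        ξ₃-top : ∀ i j → ξ₃ fₛ (inl i) j ≈ δ (in₂ i) j
        ξ₃-top i j = trans (mix-same s _ (ξ₃≋ half i j)) (ξ₃⁰-rows (inl i) j)
        ξ₃-normal : ∀ i j → (ξ₃⁰ · h₂ s) i j ≈ (h₃ s · ξ₃ fₛ) i j
        ξ₃-normal i j = trans (ξ₃⁰· (h₂ s) i j) (sym (row i j))
          where
          row : ∀ i j → (h₃ s · ξ₃ fₛ) i j ≈ h₂ s (inr i) j
          row (inl i) j = trans (+-cong (∑-δˡ i (λ k → ξ₃ fₛ (inl k) j)) (∑-zeroˡ {L} _))
                                (trans (+-identityʳ _) (ξ₃-top i j))
          row (inr i) j = trans (+-cong (∑-cong {J} (λ k → *-congˡ (ξ₃-top k j))) (∑-δˡ i (λ k → ξ₃ fₛ (inr k) j))) (last j)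
            where
            last : ∀ j → ∑ {J} (λ k → - w s i (in₂ k) * δ (in₂ k) j) + w s i j ≈ h₂ s (in₃ i) j
            last (in₁ j) = 0+ (∑-zeroʳ {J} _)
            last (in₂ j) = trans (+-congʳ (∑-δʳ j (λ k → - w s i (in₂ k)))) (-‿inverseˡ _)
            last (in₃ j) = 0+ (∑-zeroʳ {J} _)
        normal : ∀ {g₁ g₂ g₃} → Inverses (h₁ s) g₁ → Inverses (h₂ s) g₂ → Inverses (h₃ s) g₃ → Large (Ker fₛ) n
        normal {g₁} {g₂} {g₃} i₁ i₂ i₃ = large-≅ (conj-≅ {f = fₛ} {N.full M₁′ M₂′ M₃′}
            (Inverses-sym i₁) (Inverses-sym i₂) (Inverses-sym i₃)
            (intertwines⁻¹ i₁ i₂ i₃ (intertwines (cancelʳ (Inverses-sym i₁) (h₁ s · M₁ fₛ))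
              (cancelʳ (Inverses-sym i₂) (h₂ s · M₂ fₛ)) (cancelʳ (Inverses-sym i₃) (h₃ s · M₃ fₛ))
              ξ₁-normal ξ₃-normal)))
          (large-≅ (N.full≅reduced M₁′ M₂′ M₃′) (ih _))
          where
          M₁′ = (h₁ s · M₁ fₛ) · g₁
          M₂′ = (h₂ s · M₂ fₛ) · g₂
          M₃′ = (h₃ s · M₃ fₛ) · g₃

    large-transverse : ∀ {n} → (∀ (f : Form K L J) → Large (Ker f) n) →
                       ∀ (f : Form (K ⊕ L) (K ⊕ J ⊕ L) (J ⊕ L)) → Large (Ker f) n
    large-transverse {n} ih f = large-pencil f f⁰ (do
        c ← generic-inverse h₂ poly at-1
        ¬¬-return (cofinitely-map (λ {s} inv d d<n Cs lin h → inv λ (g₂ , i) → half s g₂ i d d<n Cs lin h) c))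
      where
      f⁰ : Form (K ⊕ L) (K ⊕ J ⊕ L) (J ⊕ L)
      f⁰ = form (M₁ f) (M₂ f) (M₃ f) ξ₁⁰ ξ₃⁰
      h₂ : Carrier → Mtx (K ⊕ J ⊕ L) (K ⊕ J ⊕ L)
      h₂ s (in₁ i) j = ξ₁ (pencil f f⁰ s) (inl i) j
      h₂ s (in₂ i) j = ξ₃ (pencil f f⁰ s) (inl i) j
      h₂ s (in₃ i) j = ξ₁ (pencil f f⁰ s) (inr i) j
      poly : ∀ i j → IsPolynomial (λ s → h₂ s i j)
      poly (in₁ i) j = isPoly-mix _ _
      poly (in₂ i) j = isPoly-mix _ _
      poly (in₃ i) j = isPoly-mix _ _
      at-1 : h₂ 1# ≋ δ
      at-1 (in₁ i) j = trans (mix-1 _ _) (proj₁ ξ₁⁰-rows i j)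
      at-1 (in₂ i) j = trans (mix-1 _ _) (ξ₃⁰-rows (inl i) j)
      at-1 (in₃ i) j = trans (mix-1 _ _) (proj₂ ξ₁⁰-rows i j)
      half : ∀ s g₂ → Inverses (h₂ s) g₂ → Large (Ker (pencil f f⁰ s)) n
      half s g₂ i = large-≅ (conj-≅ {f = fₛ} {f′} Inverses-δ (Inverses-sym i) Inverses-δ (intertwines
          (δ-central (M₁ fₛ)) (≋-sym (cancelˡ i (M₂ fₛ · g₂))) (δ-central (M₃ fₛ))
          (≋-sym (·-idˡ (ξ₁ fₛ · g₂))) (≋-sym (·-idˡ (ξ₃ fₛ · g₂)))))
        (large-halfNormal ih f′ (record
          { ξ₁≋ = λ { (inl k) j → trans (gh≋1 i (in₁ k) j) (sym (proj₁ ξ₁⁰-rows k j))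
                    ; (inr k) j → trans (gh≋1 i (in₃ k) j) (sym (proj₂ ξ₁⁰-rows k j)) }
          ; ξ₃≋ = λ k j → trans (gh≋1 i (in₂ k) j) (sym (ξ₃⁰-rows (inl k) j)) }))
        where
        fₛ = pencil f f⁰ s
        f′ = form (M₁ fₛ) (h₂ s · (M₂ fₛ · g₂)) (M₃ fₛ) (ξ₁ fₛ · g₂) (ξ₃ fₛ · g₂)

  -- Cyclic vectors, and centralisers in the base case

  indicator : ℕ → ℕ → Carrier
  indicator zero    zero    = 1#
  indicator zero    (suc n) = 0#
  indicator (suc m) zero    = 0#
  indicator (suc m) (suc n) = indicator m n

  indicator-δ : ∀ {n} (i j : Fin n) → indicator (toℕ i) (toℕ j) ≈ δᶠ i j
  indicator-δ zero    zero    = refl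
  indicator-δ zero    (suc j) = refl
  indicator-δ (suc i) zero    = refl
  indicator-δ (suc i) (suc j) = indicator-δ i j

  module _ {n : ℕ} where
    origin : Mtx (fin n) (fin 1)
    origin (ix i) _ = indicator (toℕ i) 0

    -- The nilpotent Jordan block for which `origin` is a cyclic vector; its Krylov matrix is the
    -- identity.
    shift : Mtx (fin n) (fin n)
    shift (ix i) (ix j) = indicator (toℕ i) (suc (toℕ j))

    power : Mtx (fin n) (fin n) → ℕ → Mtx (fin n) (fin n)
    power M zero    = δ
    power M (suc k) = M · power M k

    krylov : Mtx (fin n) (fin n) → ℕ → Mtx (fin n) (fin 1)
    krylov M zero    = origin
    krylov M (suc k) = M · krylov M k

    power-origin : ∀ M k → power M k · origin ≋ krylov M k
    power-origin M zero    = ·-idˡ origin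
    power-origin M (suc k) = ≋-trans (·-assoc M (power M k) origin) (·-congˡ M (power-origin M k))

    power-commutes : ∀ M k → M · power M k ≋ power M k · M
    power-commutes M zero    = ≋-trans (·-idʳ M) (≋-sym (·-idˡ M))
    power-commutes M (suc k) = ≋-trans (·-congˡ M (power-commutes M k)) (≋-sym (·-assoc M (power M k) M))

    krylov-cong : ∀ {M N} → M ≋ N → ∀ k → krylov M k ≋ krylov N k
    krylov-cong e zero    = ≋-refl
    krylov-cong e (suc k) = ·-cong e (krylov-cong e k)

    isPoly-krylov : ∀ {M : Carrier → Mtx (fin n) (fin n)} → (∀ i j → IsPolynomial (λ s → M s i j)) →
                    ∀ k i j → IsPolynomial (λ s → krylov (M s) k i j)
    isPoly-krylov p zero    i j = isPoly-const _
    isPoly-krylov p (suc k) i j = isPoly-sumFin (λ l → isPoly-* (p i (ix l)) (isPoly-krylov p k (ix l) j))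

  krylov-shift : ∀ {n} k (i : Fin n) → krylov shift k (ix i) (ix zero) ≈ indicator (toℕ i) k
  krylov-shift zero    i = refl
  krylov-shift {n} (suc k) i = trans
    (∑-cong {fin n} {λ j → shift (ix i) j * krylov shift k j (ix zero)}
                    {λ { (ix j) → indicator (toℕ i) (suc (toℕ j)) * indicator (toℕ j) k }}
                    (λ { (ix j) → *-congˡ (krylov-shift k j) }))
    (row i)
    where
    row : ∀ {n} (i : Fin n) → sumFin {n} (λ j → indicator (toℕ i) (suc (toℕ j)) * indicator (toℕ j) k) ≈ indicator (toℕ i) (suc k)
    row {n} zero        = ∑-0 {fin n} {λ { (ix j) → 0# * indicator (toℕ j) k }} (λ { (ix j) → zeroˡ _ })
    -- `inject₁` moves i into `Fin (suc n)`, where the indicator becomes a δ that collapses the sum.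
    row {suc n} (suc i) = begin
      sumFin {suc n} (λ j → indicator (toℕ i) (toℕ j) * indicator (toℕ j) k)
        ≈⟨ sumFin-cong {suc n} (λ j → *-congʳ {indicator (toℕ j) k} (trans
             (reflexive (≡.cong (λ m → indicator m (toℕ j)) (≡.sym (Finₚ.toℕ-inject₁ i)))) (indicator-δ (Fin.inject₁ i) j))) ⟩
      sumFin {suc n} (λ j → δᶠ (Fin.inject₁ i) j * indicator (toℕ j) k)
        ≈⟨ ∑-δˡ {fin (suc n)} (ix (Fin.inject₁ i)) (λ { (ix j) → indicator (toℕ j) k }) ⟩
      indicator (toℕ (Fin.inject₁ i)) k
        ≈⟨ reflexive (≡.cong (λ m → indicator m k) (Finₚ.toℕ-inject₁ i)) ⟩
      indicator (toℕ i) k ∎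

  krylovMatrix : ∀ {n} → Mtx (fin n) (fin n) → Mtx (fin n) (fin n)
  krylovMatrix M i (ix j) = krylov M (toℕ j) i (ix zero)

  krylovMatrix-shift : ∀ {n} → krylovMatrix (shift {n}) ≋ δ
  krylovMatrix-shift (ix i) (ix j) = trans (krylov-shift (toℕ j) i) (indicator-δ i j)

  -- The Krylov matrix has entries polynomial in s and is the identity at s = 1.
  generic-cyclic : ∀ {n} (M : Mtx (fin n) (fin n)) →
    ¬ ¬ Cofinitely (λ s → Injᴱ (krylovMatrix {n} (λ i j → mix s (M i j) (shift i j))))
  generic-cyclic {n} M = generic-inj (λ s → krylovMatrix (λ i j → mix s (M i j) (shift i j)))
    (λ { i (ix j) → isPoly-krylov (λ i j → isPoly-mix (M i j) (shift i j)) (toℕ j) i (ix zero) }) 1#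
    (≋δ⇒inj {A = krylovMatrix (λ i j → mix 1# (M i j) (shift i j))} (λ { i (ix j) → trans (krylov-cong (λ i j → mix-1 (M i j) (shift i j)) (toℕ j) i (ix zero)) (krylovMatrix-shift i (ix j)) }))

  ker-lincomb : ∀ {D₁ D₂ D₃ I} {f : Form D₁ D₂ D₃} (c : El I → Carrier) {v : El I → Seaweed D₁ D₂ D₃} →
                (∀ k → Ker f (v k)) → Ker f (λ i → ∑ {I} (λ k → c k * v k i))
  ker-lincomb {I = I} {f} c {v} h = ad*⇒ker λ i → trans (lin-lincomb (ad*-linear f i) c v)
    (∑-0 {I} (λ k → trans (*-congˡ (ker⇒ad* (h k) i)) (zeroʳ _)))

  module _ {c b : ℕ} where
    private
      G = fin c ⊕ fin b
      zeros : ∀ {I J} → Mtx I J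
      zeros _ _ = 0#

    powers : Form (fin c) (fin 0) (fin b) → El G → Seaweed (fin c) (fin 0) (fin b)
    powers f (inl (ix j)) = blocks (power (M₁ f) (toℕ j)) zeros zeros zeros zeros
    powers f (inr (ix j)) = blocks zeros zeros zeros zeros (power (M₃ f) (toℕ j))

    powers-ker : ∀ f v → Ker f (powers f v)
    powers-ker f (inl (ix j)) = ker (λ i k → trans (+-identityʳ _) (power-commutes (M₁ f) (toℕ j) i k))
      (λ { i (ix ()) }) (λ { (ix ()) }) (λ { i (ix ()) })
      (λ i k → trans (+-identityʳ _) (trans (∑-zeroʳ {fin b} (M₃ f i)) (sym (∑-zeroˡ {fin b} (λ l → M₃ f l k)))))
    powers-ker f (inr (ix j)) = ker
      (λ i k → trans (+-identityʳ _) (trans (∑-zeroʳ {fin c} (M₁ f i)) (sym (∑-zeroˡ {fin c} (λ l → M₁ f l k)))))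
      (λ { i (ix ()) }) (λ { (ix ()) }) (λ { i (ix ()) })
      (λ i k → trans (+-identityʳ _) (power-commutes (M₃ f) (toℕ j) i k))

    -- A relation among powers of M, applied to the first basis vector, becomes one among Krylov
    -- vectors.
    combination-at-origin : ∀ {n} (M : Mtx (fin n) (fin n)) (x : Fin n → Carrier) →
      (∀ i k → sumFin (λ j → x j * power M (toℕ j) i k) ≈ 0#) →
      ∀ i → sumFin (λ j → krylov M (toℕ j) i (ix zero) * x j) ≈ 0#
    combination-at-origin {n} M x h i = begin
      sumFin (λ j → krylov M (toℕ j) i (ix zero) * x j)
        ≈⟨ sumFin-cong (λ j → trans (*-comm _ (x j)) (*-congˡ (sym (power-origin M (toℕ j) i (ix zero))))) ⟩
      sumFin (λ j → x j * (power M (toℕ j) · origin) i (ix zero))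
        ≈⟨ sumFin-cong (λ j → sym (trans (∑-cong {fin n} (λ k → *-assoc (x j) (power M (toℕ j) i k) (origin k (ix zero))))
             (∑-*ˡ {fin n} (x j) (λ k → power M (toℕ j) i k * origin k (ix zero))))) ⟩
      sumFin (λ j → ∑ {fin n} (λ k → x j * power M (toℕ j) i k * origin k (ix zero)))
        ≈⟨ ∑-swap {fin n} {fin n} (λ { (ix j) k → x j * power M (toℕ j) i k * origin k (ix zero) }) ⟩
      ∑ {fin n} (λ k → sumFin (λ j → x j * power M (toℕ j) i k * origin k (ix zero)))
        ≈⟨ ∑-0 {fin n} (λ k → trans (∑-*ʳ {fin n} (origin k (ix zero)) (λ { (ix j) → x j * power M (toℕ j) i k }))
             (trans (*-congʳ (h i k)) (zeroˡ _))) ⟩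
      0# ∎

    -- The values of d < c + b functionals on the c + b powers form a matrix too wide to be
    -- injective. Separation would make it injective: a combination of powers killed by all
    -- functionals is zero, and by cyclicity its coefficients vanish.
    cyclic⇒large : ∀ f → Injᴱ (krylovMatrix (M₁ f)) → Injᴱ (krylovMatrix (M₃ f)) → Large (Ker f) (c ℕ.+ b)
    cyclic⇒large f cyclic₁ cyclic₃ d d<n C lin h = wide⇒¬injᴱ {G} d d<n (λ i v → C i (powers f v)) λ x e →
      let z : ∀ i → ∑ {G} (λ v → x v * powers f v i) ≈ 0#
          z = h (λ i → ∑ {G} (λ v → x v * powers f v i)) (ker-lincomb {I = G} {f} x (powers-ker f))
                (λ i → trans (lin-lincomb (lin i) x (powers f))
                  (trans (∑-cong {G} (λ v → *-comm (x v) (C i (powers f v)))) (e i)))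
      in λ where
        (inl j) → cyclic₁ (λ j → x (inl j)) (combination-at-origin (M₁ f) (λ j → x (inl (ix j)))
                    (λ i k → trans (sym (+0 (∑-zeroʳ {fin b} (λ v → x (inr v))))) (z (pP i k)))) j
        (inr j) → cyclic₃ (λ j → x (inr j)) (combination-at-origin (M₃ f) (λ j → x (inr (ix j)))
                    (λ i k → trans (sym (0+ (∑-zeroʳ {fin c} (λ v → x (inl v))))) (z (pT i k)))) j

    large-base : ∀ (f : Form (fin c) (fin 0) (fin b)) → Large (Ker f) (c ℕ.+ b)
    large-base f = large-pencil f (form shift zeros shift zeros zeros) (do
      c₁ ← generic-cyclic (M₁ f)
      c₃ ← generic-cyclic (M₃ f)
      ¬¬-return (cofinitely-map (λ (i₁ , i₃) → cyclic⇒large _ i₁ i₃) (cofinitely-∩ c₁ c₃)))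

  kernel-large : ∀ {D₁ D₂ D₃ G} → Red D₁ D₂ D₃ G → ∀ (f : Form D₁ D₂ D₃) → Large (Ker f) (size G)
  kernel-large (base c b)     = large-base
  kernel-large (swap r)       = λ f → large-≅ (swap-≅ f) (kernel-large r _)
  kernel-large (injective r)  = large-injective (kernel-large r)
  kernel-large (surjective r) = large-surjective (kernel-large r)
  kernel-large (transverse r) = large-transverse (kernel-large r)

-- Block coordinates on the seaweeds in 𝔰𝔩(n)

module Coordinates {o ℓ : Level} (F : CharZeroField o ℓ) where
  open UpperBound F public
  open Over F public using (Mat; _≈ₘ_; 0ₘ; _+ₘ_; _·ₘ_; _*ₘ_; ⁅_,_⁆; trace; lincomb; HasDim; InSeaweed; Dual; KerB; SeaweedIndex)

  tr : ∀ {I} → Mtx I I → Carrier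
  tr A = ∑ (λ i → A i i)

  infix 9 _∶_
  -- The trace of A · B, summed in the order of the entries of B, so that `⟨ coefficients f , y ⟩`
  -- is by definition a sum of such pairings, one for each block.
  _∶_ : ∀ {I J} → Mtx J I → Mtx I J → Carrier
  _∶_ {I} {J} A B = ∑ {I} (λ i → ∑ {J} (λ j → A j i * B i j))

  ∶-+ˡ : ∀ {I J} (A A′ : Mtx J I) (B : Mtx I J) → (λ j i → A j i + A′ j i) ∶ B ≈ A ∶ B + A′ ∶ B
  ∶-+ˡ {I} {J} A A′ B = trans (∑-cong {I} (λ i → trans (∑-cong {J} (λ j → distribʳ _ _ _)) (∑-+ {J} _ _))) (∑-+ {I} _ _)

  ∶-+ʳ : ∀ {I J} (A : Mtx J I) (B B′ : Mtx I J) → A ∶ (λ i j → B i j + B′ i j) ≈ A ∶ B + A ∶ B′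
  ∶-+ʳ {I} {J} A B B′ = trans (∑-cong {I} (λ i → trans (∑-cong {J} (λ j → distribˡ _ _ _)) (∑-+ {J} _ _))) (∑-+ {I} _ _)

  ∶-minusˡ : ∀ {I J} (A A′ : Mtx J I) (B : Mtx I J) → (λ j i → A j i - A′ j i) ∶ B ≈ A ∶ B - A′ ∶ B
  ∶-minusˡ {I} {J} A A′ B = trans (∑-cong {I} (λ i → trans (∑-cong {J} (λ j →
      solve 3 (λ a a′ b → (a :- a′) :* b := a :* b :- a′ :* b) refl (A j i) (A′ j i) (B i j))) (∑-minus {J} _ _))) (∑-minus {I} _ _)

  ∶-minusʳ : ∀ {I J} (A : Mtx J I) (B B′ : Mtx I J) → A ∶ (λ i j → B i j - B′ i j) ≈ A ∶ B - A ∶ B′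
  ∶-minusʳ {I} {J} A B B′ = trans (∑-cong {I} (λ i → trans (∑-cong {J} (λ j →
      solve 3 (λ a b b′ → a :* (b :- b′) := a :* b :- a :* b′) refl (A j i) (B i j) (B′ i j))) (∑-minus {J} _ _))) (∑-minus {I} _ _)

  ∶-·ˡ : ∀ {I J K} (A : Mtx J I) (X : Mtx I K) (Y : Mtx K J) → A ∶ (X · Y) ≈ (A · X) ∶ Y
  ∶-·ˡ {I} {J} {K} A X Y = begin
    ∑ {I} (λ i → ∑ {J} (λ j → A j i * ∑ {K} (λ k → X i k * Y k j)))
      ≈⟨ ∑-cong {I} (λ i → ∑-cong {J} (λ j → trans (sym (∑-*ˡ {K} _ _)) (∑-cong {K} (λ k → sym (*-assoc _ _ _))))) ⟩
    ∑ {I} (λ i → ∑ {J} (λ j → ∑ {K} (λ k → A j i * X i k * Y k j)))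
      ≈⟨ ∑-cong {I} (λ i → ∑-swap {J} {K} _) ⟩
    ∑ {I} (λ i → ∑ {K} (λ k → ∑ {J} (λ j → A j i * X i k * Y k j)))
      ≈⟨ ∑-swap {I} {K} _ ⟩
    ∑ {K} (λ k → ∑ {I} (λ i → ∑ {J} (λ j → A j i * X i k * Y k j)))
      ≈⟨ ∑-cong {K} (λ k → trans (∑-swap {I} {J} _) (∑-cong {J} (λ j → ∑-*ʳ {I} (Y k j) _))) ⟩
    ∑ {K} (λ k → ∑ {J} (λ j → ∑ {I} (λ i → A j i * X i k) * Y k j)) ∎

  ∶-·ʳ : ∀ {I J K} (A : Mtx J I) (Y : Mtx I K) (X : Mtx K J) → A ∶ (Y · X) ≈ (X · A) ∶ Y
  ∶-·ʳ {I} {J} {K} A Y X = begin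
    ∑ {I} (λ i → ∑ {J} (λ j → A j i * ∑ {K} (λ k → Y i k * X k j)))
      ≈⟨ ∑-cong {I} (λ i → ∑-cong {J} (λ j → trans (sym (∑-*ˡ {K} _ _)) (∑-cong {K} (λ k →
           solve 3 (λ a y x → a :* (y :* x) := (x :* a) :* y) refl (A j i) (Y i k) (X k j))))) ⟩
    ∑ {I} (λ i → ∑ {J} (λ j → ∑ {K} (λ k → X k j * A j i * Y i k)))
      ≈⟨ ∑-cong {I} (λ i → trans (∑-swap {J} {K} _) (∑-cong {K} (λ k → ∑-*ʳ {J} (Y i k) _))) ⟩
    ∑ {I} (λ i → ∑ {K} (λ k → ∑ {J} (λ j → X k j * A j i) * Y i k)) ∎

  tr-comm : ∀ {I J} (A : Mtx I J) (B : Mtx J I) → tr (A · B) ≈ tr (B · A)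
  tr-comm {I} {J} A B = trans (∑-swap {I} {J} _) (∑-cong {J} (λ j → ∑-cong {I} (λ i → *-comm _ _)))

  module _ {D₁ D₂ D₃ : Dim} where
    private
      V = D₁ ⊕ D₂ ⊕ D₃
      n = size V
      c = size D₁
      a = size D₁ ℕ.+ size D₂

    mul : Seaweed D₁ D₂ D₃ → Seaweed D₁ D₂ D₃ → Seaweed D₁ D₂ D₃
    mul x y = blocks (P x · P y) (λ i j → (Q x · P y) i j + (R x · Q y) i j) (R x · R y)
                     (λ i j → (R x · S y) i j + (S x · T y) i j) (T x · T y)

    bracket : Seaweed D₁ D₂ D₃ → Seaweed D₁ D₂ D₃ → Seaweed D₁ D₂ D₃
    bracket x y i = mul x y i - mul y x i

    ⟨_,_⟩ : Seaweed D₁ D₂ D₃ → Seaweed D₁ D₂ D₃ → Carrier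
    ⟨ φ , y ⟩ = ∑ {SW D₁ D₂ D₃} (λ i → φ i * y i)

    ⟨⟩-lin : ∀ φ → Lin ⟨ φ ,_⟩
    ⟨⟩-lin φ = lin-∑ {J = SW D₁ D₂ D₃} (λ i → lin-*ˡ (φ i) (lin-at i))

    coefficients : Form D₁ D₂ D₃ → Seaweed D₁ D₂ D₃
    coefficients f = blocks (M₁ f ᵀ) (ξ₁ f ᵀ) (M₂ f ᵀ) (ξ₃ f ᵀ) (M₃ f ᵀ)

    toForm : Seaweed D₁ D₂ D₃ → Form D₁ D₂ D₃
    toForm φ = form (P φ ᵀ) (R φ ᵀ) (T φ ᵀ) (Q φ ᵀ) (S φ ᵀ)

    coefficients-toForm : ∀ φ i → coefficients (toForm φ) i ≈ φ i
    coefficients-toForm φ = by-blocks {x = coefficients (toForm φ)} {φ} ≋-refl ≋-refl ≋-refl ≋-refl ≋-refl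

    -- Cyclic invariance of the trace: `∶-·ˡ` and `∶-·ʳ` isolate the block of y in each product, and
    -- the fourteen terms are regrouped by that block.
    ad*-adjoint : ∀ f x y → ⟨ coefficients f , bracket x y ⟩ ≈ ⟨ ad* f x , y ⟩
    ad*-adjoint f x y = begin
      ⟨ coefficients f , bracket x y ⟩
        ≈⟨ +-cong (trans (∶-minusʳ (M₁ f) (P x · P y) (P y · P x))
                         (+-cong (∶-·ˡ (M₁ f) (P x) (P y)) (-‿cong (∶-·ʳ (M₁ f) (P y) (P x)))))
          (+-cong (trans (∶-minusʳ (ξ₁ f) _ _)
                    (+-cong (trans (∶-+ʳ (ξ₁ f) _ _) (+-cong (∶-·ˡ (ξ₁ f) (Q x) (P y)) (∶-·ˡ (ξ₁ f) (R x) (Q y))))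
                      (-‿cong (trans (∶-+ʳ (ξ₁ f) _ _) (+-cong (∶-·ʳ (ξ₁ f) (Q y) (P x)) (∶-·ʳ (ξ₁ f) (R y) (Q x)))))))
          (+-cong (trans (∶-minusʳ (M₂ f) (R x · R y) (R y · R x))
                         (+-cong (∶-·ˡ (M₂ f) (R x) (R y)) (-‿cong (∶-·ʳ (M₂ f) (R y) (R x)))))
          (+-cong (trans (∶-minusʳ (ξ₃ f) _ _)
                    (+-cong (trans (∶-+ʳ (ξ₃ f) _ _) (+-cong (∶-·ˡ (ξ₃ f) (R x) (S y)) (∶-·ˡ (ξ₃ f) (S x) (T y))))
                      (-‿cong (trans (∶-+ʳ (ξ₃ f) _ _) (+-cong (∶-·ʳ (ξ₃ f) (R y) (S x)) (∶-·ʳ (ξ₃ f) (S y) (T x)))))))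
                  (trans (∶-minusʳ (M₃ f) (T x · T y) (T y · T x))
                         (+-cong (∶-·ˡ (M₃ f) (T x) (T y)) (-‿cong (∶-·ʳ (M₃ f) (T y) (T x)))))))) ⟩
      _ ≈⟨ solve 14 (λ m₁p pm₁ x₁q x₁r px₁ qx₁ m₂r rm₂ x₃r x₃s sx₃ tx₃ m₃t tm₃ →
             (m₁p :- pm₁) :+ (((x₁q :+ x₁r) :- (px₁ :+ qx₁)) :+ ((m₂r :- rm₂) :+ (((x₃r :+ x₃s) :- (sx₃ :+ tx₃)) :+ (m₃t :- tm₃))))
             := ((m₁p :+ x₁q) :- pm₁) :+ ((x₁r :- px₁) :+ ((m₂r :- (rm₂ :+ (qx₁ :+ sx₃))) :+ ((x₃r :- tx₃) :+ ((m₃t :+ x₃s) :- tm₃)))))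
             refl _ _ _ _ _ _ _ _ _ _ _ _ _ _ ⟩
      _ ≈⟨ +-cong (trans (∶-minusˡ _ _ (P y)) (+-congʳ (∶-+ˡ _ _ (P y))))
          (+-cong (∶-minusˡ _ _ (Q y))
          (+-cong (trans (∶-minusˡ (M₂ f · R x) _ (R y)) (+-congˡ (-‿cong (trans (∶-+ˡ (R x · M₂ f) _ (R y)) (+-congˡ (∶-+ˡ _ _ (R y)))))))
          (+-cong (∶-minusˡ _ _ (S y)) (trans (∶-minusˡ _ _ (T y)) (+-congʳ (∶-+ˡ _ _ (T y))))))) ⟨
      ⟨ ad* f x , y ⟩ ∎

    identity : Seaweed D₁ D₂ D₃
    identity = blocks δ (λ _ _ → 0#) δ (λ _ _ → 0#) δ

    mul-identityʳ : ∀ x i → mul x identity i ≈ x i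
    mul-identityʳ x = by-blocks {x = mul x identity} {x} (·-idʳ (P x))
      (λ i j → trans (+-cong (·-idʳ (Q x) i j) (∑-zeroʳ {D₂} _)) (+-identityʳ _)) (·-idʳ (R x))
      (λ i j → trans (+-cong (∑-zeroʳ {D₂} _) (·-idʳ (S x) i j)) (+-identityˡ _)) (·-idʳ (T x))

    mul-identityˡ : ∀ x i → mul identity x i ≈ x i
    mul-identityˡ x = by-blocks {x = mul identity x} {x} (·-idˡ (P x))
      (λ i j → trans (+-cong (∑-zeroˡ {D₁} _) (·-idˡ (Q x) i j)) (+-identityˡ _)) (·-idˡ (R x))
      (λ i j → trans (+-cong (·-idˡ (S x) i j) (∑-zeroˡ {D₃} _)) (+-identityʳ _)) (·-idˡ (T x))

    identity-bracket : ∀ x i → bracket identity x i ≈ 0#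
    identity-bracket x i = x-y≈0 (trans (mul-identityˡ x i) (sym (mul-identityʳ x i)))

    bracket-identity : ∀ x i → bracket x identity i ≈ 0#
    bracket-identity x i = x-y≈0 (trans (mul-identityʳ x i) (sym (mul-identityˡ x i)))

    identity-ker : ∀ f → Ker f identity
    identity-ker f = ad*⇒ker λ i → begin
      ad* f identity i
        ≈⟨ ∑-δʳ i (ad* f identity) ⟨
      ⟨ ad* f identity , (λ j → δ j i) ⟩
        ≈⟨ ad*-adjoint f identity (λ j → δ j i) ⟨
      ⟨ coefficients f , bracket identity (λ j → δ j i) ⟩
        ≈⟨ lin-zero (⟨⟩-lin (coefficients f)) (identity-bracket (λ j → δ j i)) ⟩
      0# ∎

    matrix : Seaweed D₁ D₂ D₃ → Mtx V V
    matrix x (in₁ i) (in₁ j) = P x i j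
    matrix x (in₁ i) (inr j) = 0#
    matrix x (in₂ i) (in₁ j) = Q x i j
    matrix x (in₂ i) (in₂ j) = R x i j
    matrix x (in₂ i) (in₃ j) = S x i j
    matrix x (in₃ i) (in₁ j) = 0#
    matrix x (in₃ i) (in₂ j) = 0#
    matrix x (in₃ i) (in₃ j) = T x i j

    matrix-lin : ∀ i j → Lin (λ x → matrix x i j)
    matrix-lin (in₁ i) (in₁ j) = lin-P i j
    matrix-lin (in₁ i) (inr j) = lin-0
    matrix-lin (in₂ i) (in₁ j) = lin-Q i j
    matrix-lin (in₂ i) (in₂ j) = lin-R i j
    matrix-lin (in₂ i) (in₃ j) = lin-S i j
    matrix-lin (in₃ i) (in₁ j) = lin-0
    matrix-lin (in₃ i) (in₂ j) = lin-0
    matrix-lin (in₃ i) (in₃ j) = lin-T i j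

    matrix-mul : ∀ x y → matrix x · matrix y ≋ matrix (mul x y)
    matrix-mul x y (in₁ i) (in₁ j) = +0 (trans (+-cong (∑-zeroˡ {D₂} _) (∑-zeroˡ {D₃} _)) (+-identityʳ _))
    matrix-mul x y (in₁ i) (inr j) = trans (+-cong (∑-zeroʳ {D₁} _) (trans (+-cong (∑-zeroˡ {D₂} _) (∑-zeroˡ {D₃} _)) (+-identityʳ _))) (+-identityʳ _)
    matrix-mul x y (in₂ i) (in₁ j) = +-congˡ (+0 (∑-zeroʳ {D₃} _))
    matrix-mul x y (in₂ i) (in₂ j) = trans (0+ (∑-zeroʳ {D₁} _)) (+0 (∑-zeroʳ {D₃} _))
    matrix-mul x y (in₂ i) (in₃ j) = 0+ (∑-zeroʳ {D₁} _)
    matrix-mul x y (in₃ i) (in₁ j) = trans (+-cong (∑-zeroˡ {D₁} _) (trans (+-cong (∑-zeroˡ {D₂} _) (∑-zeroʳ {D₃} _)) (+-identityʳ _))) (+-identityʳ _)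
    matrix-mul x y (in₃ i) (in₂ j) = trans (+-cong (∑-zeroˡ {D₁} _) (trans (+-cong (∑-zeroˡ {D₂} _) (∑-zeroʳ {D₃} _)) (+-identityʳ _))) (+-identityʳ _)
    matrix-mul x y (in₃ i) (in₃ j) = trans (0+ (∑-zeroˡ {D₁} _)) (0+ (∑-zeroˡ {D₂} _))

    matrix-bracket : ∀ x y i j → (matrix x · matrix y) i j - (matrix y · matrix x) i j ≈ matrix (bracket x y) i j
    matrix-bracket x y i j = trans (+-cong (matrix-mul x y i j) (-‿cong (matrix-mul y x i j)))
      (sym (trans (add-lin (matrix-lin i j) (mul x y) (λ i → - mul y x i)) (+-congˡ
        (trans (cong-lin (matrix-lin i j) (λ i → -≈-1* _)) (trans (scale-lin (matrix-lin i j) (- 1#) (mul y x)) (sym (-≈-1* _)))))))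

    entries : Mat n → Mtx V V
    entries X u v = X (index u) (index v)

    coords : Mat n → Seaweed D₁ D₂ D₃
    coords X = blocks (λ i j → entries X (in₁ i) (in₁ j)) (λ i j → entries X (in₂ i) (in₁ j))
      (λ i j → entries X (in₂ i) (in₂ j)) (λ i j → entries X (in₂ i) (in₃ j)) (λ i j → entries X (in₃ i) (in₃ j))

    coords-cong : ∀ X Y → entries X ≋ entries Y → ∀ i → coords X i ≈ coords Y i
    coords-cong X Y h = by-blocks {x = coords X} {coords Y} (λ i j → h (in₁ i) (in₁ j)) (λ i j → h (in₂ i) (in₁ j))
      (λ i j → h (in₂ i) (in₂ j)) (λ i j → h (in₂ i) (in₃ j)) (λ i j → h (in₃ i) (in₃ j))

    embed : Seaweed D₁ D₂ D₃ → Mat n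
    embed x i j = matrix x (element V i) (element V j)

    embed-lin : ∀ i j → Lin (λ x → embed x i j)
    embed-lin i j = matrix-lin (element V i) (element V j)

    entries-embed : ∀ x → entries (embed x) ≋ matrix x
    entries-embed x u v = reflexive (≡.cong₂ (matrix x) (element-index u) (element-index v))

    coords-embed : ∀ x i → coords (embed x) i ≈ x i
    coords-embed x = by-blocks {x = coords (embed x)} {x}
      (λ i j → entries-embed x (in₁ i) (in₁ j)) (λ i j → entries-embed x (in₂ i) (in₁ j))
      (λ i j → entries-embed x (in₂ i) (in₂ j)) (λ i j → entries-embed x (in₂ i) (in₃ j))
      (λ i j → entries-embed x (in₃ i) (in₃ j))

    from-entries : ∀ (X Y : Mat n) → entries X ≋ entries Y → X ≈ₘ Y
    from-entries X Y h i j = trans (reflexive (≡.cong₂ X (≡.sym (index-element V i)) (≡.sym (index-element V j))))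
      (trans (h (element V i) (element V j)) (reflexive (≡.cong₂ Y (index-element V i) (index-element V j))))

    traceˢ : Seaweed D₁ D₂ D₃ → Carrier
    traceˢ x = tr (P x) + (tr (R x) + tr (T x))

    traceˢ-lin : Lin traceˢ
    traceˢ-lin = lin-+ (lin-∑ {J = D₁} (λ i → lin-P i i)) (lin-+ (lin-∑ {J = D₂} (λ i → lin-R i i)) (lin-∑ {J = D₃} (λ i → lin-T i i)))

    trace-coords : ∀ X → trace X ≈ traceˢ (coords X)
    trace-coords X = sumFin-index {V} (λ i → X i i)

    traceˢ-bracket : ∀ x y → traceˢ (bracket x y) ≈ 0#
    traceˢ-bracket x y = trans (+-cong (zero-block (P x) (P y)) (+-cong (zero-block (R x) (R y)) (zero-block (T x) (T y))))
                               (trans (+-identityˡ _) (+-identityˡ _))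
      where
      zero-block : ∀ {I} (A B : Mtx I I) → ∑ {I} (λ i → (A · B) i i - (B · A) i i) ≈ 0#
      zero-block {I} A B = trans (∑-minus {I} _ _) (x-y≈0 (tr-comm A B))

    -- The two invariance conditions of `InSeaweed` without the trace: no entries outside the five
    -- blocks.
    Supported : Mat n → Set ℓ
    Supported X = entries X ≋ matrix (coords X)

    toℕ-in₁ : ∀ (i : El D₁) → toℕ (index {V} (in₁ i)) < c
    toℕ-in₁ i = ≡.subst (_< c) (≡.sym (Finₚ.toℕ-↑ˡ (index i) _)) (Finₚ.toℕ<n (index i))

    toℕ-inr : ∀ (v : El (D₂ ⊕ D₃)) → toℕ (index {V} (inr v)) ≡ c ℕ.+ toℕ (index v)
    toℕ-inr v = Finₚ.toℕ-↑ʳ c (index v)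

    toℕ-inr≥ : ∀ (v : El (D₂ ⊕ D₃)) → c ≤ toℕ (index {V} (inr v))
    toℕ-inr≥ v = ≡.subst (c ≤_) (≡.sym (toℕ-inr v)) (ℕₚ.m≤m+n c _)

    toℕ-in₂ : ∀ (i : El D₂) → toℕ (index {V} (in₂ i)) < a
    toℕ-in₂ i = ≡.subst (_< a) (≡.sym (≡.trans (toℕ-inr (inl i)) (≡.cong (c ℕ.+_) (Finₚ.toℕ-↑ˡ (index i) _))))
                        (ℕₚ.+-monoʳ-< c (Finₚ.toℕ<n (index i)))

    toℕ-in₃ : ∀ (i : El D₃) → a ≤ toℕ (index {V} (in₃ i))
    toℕ-in₃ i = ≡.subst (a ≤_) (≡.sym (≡.trans (toℕ-inr (inr i)) (≡.cong (c ℕ.+_) (Finₚ.toℕ-↑ʳ (size D₂) (index i)))))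
                        (ℕₚ.+-monoʳ-≤ c (ℕₚ.m≤m+n (size D₂) _))

    seaweed-supported : ∀ X → InSeaweed n a c X → Supported X
    seaweed-supported X (lift (lower-zero , upper-zero , _)) = λ where
        (in₁ i) (in₁ j) → refl
        (in₁ i) (inr j) → upper-zero _ _ (toℕ-inr≥ j) (toℕ-in₁ i)
        (in₂ i) (in₁ j) → refl
        (in₂ i) (in₂ j) → refl
        (in₂ i) (in₃ j) → refl
        (in₃ i) (in₁ j) → lower-zero _ _ (ℕₚ.≤-trans (toℕ-in₁ j) (ℕₚ.m≤m+n c _)) (toℕ-in₃ i)
        (in₃ i) (in₂ j) → lower-zero _ _ (toℕ-in₂ j) (toℕ-in₃ i)
        (in₃ i) (in₃ j) → refl

    seaweed-trace : ∀ X → InSeaweed n a c X → traceˢ (coords X) ≈ 0#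
    seaweed-trace X (lift (_ , _ , t)) = trans (sym (trace-coords X)) t

    supported-embed : ∀ X → Supported X → X ≈ₘ embed (coords X)
    supported-embed X h = from-entries X (embed (coords X)) (λ u v → trans (h u v) (sym (entries-embed (coords X) u v)))

    in-seaweed : ∀ X → Supported X → traceˢ (coords X) ≈ 0# → InSeaweed n a c X
    in-seaweed X h t = lift (lower-zero , upper-zero , trans (trace-coords X) t)
      where
      at : ∀ i j → X i j ≈ matrix (coords X) (element V i) (element V j)
      at = supported-embed X h
      index< : ∀ {u : El V} {i} → element V i ≡ u → toℕ i ≡ toℕ (index u)
      index< {i = i} e = ≡.cong toℕ (≡.trans (≡.sym (index-element V i)) (≡.cong index e))
      lower-zero : ∀ i j → toℕ j < a → a ≤ toℕ i → X i j ≈ 0#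
      lower-zero i j j<a a≤i with element V i in eᵢ | element V j in eⱼ | at i j
      ... | in₁ k | _     | _ = contradiction (ℕₚ.≤-trans (≡.subst (_< c) (≡.sym (index< eᵢ)) (toℕ-in₁ k)) (ℕₚ.m≤m+n c _)) (ℕₚ.≤⇒≯ a≤i)
      ... | in₂ k | _     | _ = contradiction (≡.subst (_< a) (≡.sym (index< eᵢ)) (toℕ-in₂ k)) (ℕₚ.≤⇒≯ a≤i)
      ... | in₃ k | in₁ l | z = z
      ... | in₃ k | in₂ l | z = z
      ... | in₃ k | in₃ l | _ = contradiction (≡.subst (a ≤_) (≡.sym (index< eⱼ)) (toℕ-in₃ l)) (ℕₚ.<⇒≱ j<a)
      upper-zero : ∀ i j → c ≤ toℕ j → toℕ i < c → X i j ≈ 0#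
      upper-zero i j c≤j i<c with element V i in eᵢ | element V j in eⱼ | at i j
      ... | inr k | _     | _ = contradiction (≡.subst (c ≤_) (≡.sym (index< eᵢ)) (toℕ-inr≥ k)) (ℕₚ.<⇒≱ i<c)
      ... | in₁ k | in₁ l | _ = contradiction (≡.subst (_< c) (≡.sym (index< eⱼ)) (toℕ-in₁ l)) (ℕₚ.≤⇒≯ c≤j)
      ... | in₁ k | inr l | z = z

    supported-embedding : ∀ x → Supported (embed x)
    supported-embedding x u v = trans (entries-embed x u v) (sym (cong-lin (matrix-lin u v) (coords-embed x)))

    embed-seaweed : ∀ x → traceˢ x ≈ 0# → InSeaweed n a c (embed x)
    embed-seaweed x t = in-seaweed (embed x) (supported-embedding x) (trans (cong-lin traceˢ-lin (coords-embed x)) t)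

    entries-⁅⁆ : ∀ X Y → Supported X → Supported Y → entries ⁅ X , Y ⁆ ≋ matrix (bracket (coords X) (coords Y))
    entries-⁅⁆ X Y hX hY u v = trans
      (+-cong (trans (sumFin-index {V} (λ k → X (index u) k * Y k (index v))) (·-cong hX hY u v)) (-‿cong (trans (sumFin-index {V} (λ k → Y (index u) k * X k (index v))) (·-cong hY hX u v))))
      (matrix-bracket (coords X) (coords Y) u v)

    coords-⁅⁆ : ∀ X Y → Supported X → Supported Y → ∀ i → coords ⁅ X , Y ⁆ i ≈ bracket (coords X) (coords Y) i
    coords-⁅⁆ X Y hX hY i = trans (coords-cong ⁅ X , Y ⁆ (embed (bracket (coords X) (coords Y))) (λ u v → trans (entries-⁅⁆ X Y hX hY u v) (sym (entries-embed (bracket (coords X) (coords Y)) u v))) i)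
                                      (coords-embed (bracket (coords X) (coords Y)) i)

    ⁅⁆-seaweed : ∀ X Y → Supported X → Supported Y → InSeaweed n a c ⁅ X , Y ⁆
    ⁅⁆-seaweed X Y hX hY = in-seaweed ⁅ X , Y ⁆
      (λ u v → trans (entries-⁅⁆ X Y hX hY u v) (sym (cong-lin (matrix-lin u v) (coords-⁅⁆ X Y hX hY))))
      (trans (cong-lin traceˢ-lin (coords-⁅⁆ X Y hX hY)) (traceˢ-bracket (coords X) (coords Y)))

-- Splitting off the identity matrix

module Traceless {o ℓ : Level} (F : CharZeroField o ℓ) where
  open Coordinates F public

  ∑-1 : ∀ I → ∑ {I} (λ _ → 1#) ≈ ι (size I)
  ∑-1 (fin zero)    = refl
  ∑-1 (fin (suc n)) = +-congˡ (∑-1 (fin n))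
  ∑-1 (I ⊕ J)       = trans (+-cong (∑-1 I) (∑-1 J)) (sym (ι-+ (size I) (size J)))
  ∑-1 (I ⊗ J)       = trans (∑-cong {I} (λ i → trans (∑-1 J) (sym (*-identityˡ _))))
    (trans (∑-*ʳ {I} (ι (size J)) (λ _ → 1#)) (trans (*-congʳ (∑-1 I)) (sym (ι-* (size I) (size J)))))

  module _ {D₁ D₂ D₃ : Dim} (n≢0 : size (D₁ ⊕ D₂ ⊕ D₃) ≢ 0) where
    private
      V = D₁ ⊕ D₂ ⊕ D₃
      n = size V
      c = size D₁
      a = size D₁ ℕ.+ size D₂
      one : Seaweed D₁ D₂ D₃
      one = identity

    1/n : Σ Carrier (λ r → ι n * r ≈ 1#)
    1/n = inverse (ι n) (λ h → n≢0 (ι-injective h))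

    meanDiagonal : Seaweed D₁ D₂ D₃ → Carrier
    meanDiagonal x = traceˢ x * proj₁ 1/n

    meanDiagonal-lin : Lin meanDiagonal
    meanDiagonal-lin = lin-*ʳ (proj₁ 1/n) traceˢ-lin

    traceˢ-identity : traceˢ one ≈ ι n
    traceˢ-identity = trans (+-cong (∑-cong {D₁} δ-refl) (+-cong (∑-cong {D₂} δ-refl) (∑-cong {D₃} δ-refl))) (∑-1 V)

    meanDiagonal-identity : meanDiagonal one ≈ 1#
    meanDiagonal-identity = trans (*-congʳ traceˢ-identity) (proj₂ 1/n)

    -- The projection to trace zero along the identity; dividing by n is possible in characteristic
    -- zero.
    traceless : Seaweed D₁ D₂ D₃ → Seaweed D₁ D₂ D₃
    traceless x i = x i - meanDiagonal x * one i

    traceless-lin : Linear traceless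
    traceless-lin i = lin-minus (lin-at i) (lin-*ʳ (one i) meanDiagonal-lin)

    lin-traceless : ∀ {φ : Seaweed D₁ D₂ D₃ → Carrier} → Lin φ → ∀ x → φ (traceless x) ≈ φ x - meanDiagonal x * φ one
    lin-traceless {φ} p x = begin
      φ (traceless x)                             ≈⟨ add-lin p x _ ⟩
      φ x + φ (λ i → - (meanDiagonal x * one i))  ≈⟨ +-congˡ (trans (cong-lin p (λ i → -‿distribˡ-* _ _)) (scale-lin p _ one)) ⟩
      φ x + - meanDiagonal x * φ one              ≈⟨ +-congˡ (-‿distribˡ-* _ _) ⟨
      φ x - meanDiagonal x * φ one                ∎

    traceˢ-traceless : ∀ x → traceˢ (traceless x) ≈ 0#
    traceˢ-traceless x = trans (lin-traceless traceˢ-lin x) (x-y≈0 (sym (begin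
      traceˢ x * proj₁ 1/n * traceˢ one   ≈⟨ *-congˡ traceˢ-identity ⟩
      traceˢ x * proj₁ 1/n * ι n          ≈⟨ solve 3 (λ t r m → t :* r :* m := (m :* r) :* t) refl _ _ _ ⟩
      (ι n * proj₁ 1/n) * traceˢ x        ≈⟨ trans (*-congʳ (proj₂ 1/n)) (*-identityˡ _) ⟩
      traceˢ x                            ∎)))

    meanDiagonal-0 : ∀ x → traceˢ x ≈ 0# → meanDiagonal x ≈ 0#
    meanDiagonal-0 x h = trans (*-congʳ h) (zeroˡ _)

    traceless-id : ∀ x → traceˢ x ≈ 0# → ∀ i → traceless x i ≈ x i
    traceless-id x h i = trans (+-congˡ (trans (-‿cong (trans (*-congʳ (meanDiagonal-0 x h)) (zeroˡ _))) -0#≈0#)) (+-identityʳ _)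

    dual : Form D₁ D₂ D₃ → Dual n a c
    dual f = record
      { fun         = λ Y → ⟨ coefficients f , coords Y ⟩
      ; cong     = λ X Y _ _ h → cong-lin l (coords-cong {D₁} {D₂} {D₃} X Y (λ u v → h (index u) (index v)))
      ; additive = λ X Y _ _ → trans (cong-lin l (by-blocks {x = coords (X +ₘ Y)} {λ i → coords X i + coords Y i} ≋-refl ≋-refl ≋-refl ≋-refl ≋-refl))
                                        (add-lin l (coords X) (coords Y))
      ; homogeneous = λ r X _ → trans (cong-lin l (by-blocks {x = coords (r ·ₘ X)} {λ i → r * coords X i} ≋-refl ≋-refl ≋-refl ≋-refl ≋-refl))
                                      (scale-lin l r (coords X)) }
      where l = ⟨⟩-lin (coefficients f)

    dual-bracket : ∀ f X Y → Supported X → Supported Y →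
                   Dual.fun (dual f) ⁅ X , Y ⁆ ≈ ⟨ ad* f (coords X) , coords Y ⟩
    dual-bracket f X Y hX hY = trans (cong-lin (⟨⟩-lin (coefficients f)) (coords-⁅⁆ {D₁} {D₂} {D₃} X Y hX hY))
                                     (ad*-adjoint f (coords X) (coords Y))

    ⟨⟩-zeroˡ : ∀ {φ : Seaweed D₁ D₂ D₃} → (∀ i → φ i ≈ 0#) → ∀ y → ⟨ φ , y ⟩ ≈ 0#
    ⟨⟩-zeroˡ h y = ∑-0 {SW D₁ D₂ D₃} (λ i → trans (*-congʳ (h i)) (zeroˡ (y i)))

    ker⇒kerB : ∀ f X → InSeaweed n a c X → Ker f (coords X) → KerB (dual f) X
    ker⇒kerB f X sX k = sX , λ Y sY → trans (dual-bracket f X Y (seaweed-supported {D₁} {D₂} {D₃} X sX) (seaweed-supported {D₁} {D₂} {D₃} Y sY))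
      (⟨⟩-zeroˡ (ker⇒ad* k) (coords Y))

    -- `KerB` tests traceless matrices only, but any y differs from its traceless part by a multiple
    -- of the identity, whose bracket with X vanishes.
    kerB⇒ker : ∀ f X → KerB (dual f) X → Ker f (coords X)
    kerB⇒ker f X (sX , k) = ad*⇒ker λ i →
      let e = traceless (λ j → δ j i)
          sE = embed-seaweed e (traceˢ-traceless (λ j → δ j i))
          l = ⟨⟩-lin (ad* f (coords X))
      in begin
        ad* f (coords X) i
          ≈⟨ ∑-δʳ i (ad* f (coords X)) ⟨
        ⟨ ad* f (coords X) , (λ j → δ j i) ⟩
          ≈⟨ +-identityʳ _ ⟨
        ⟨ ad* f (coords X) , (λ j → δ j i) ⟩ + 0#
          ≈⟨ +-congˡ (trans (-‿cong (trans (*-congˡ (trans (sym (ad*-adjoint f (coords X) one))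
               (lin-zero (⟨⟩-lin (coefficients f)) (bracket-identity (coords X))))) (zeroʳ (meanDiagonal (λ j → δ j i))))) -0#≈0#) ⟨
        ⟨ ad* f (coords X) , (λ j → δ j i) ⟩ - meanDiagonal (λ j → δ j i) * ⟨ ad* f (coords X) , one ⟩
          ≈⟨ lin-traceless l (λ j → δ j i) ⟨
        ⟨ ad* f (coords X) , e ⟩
          ≈⟨ cong-lin l (coords-embed e) ⟨
        ⟨ ad* f (coords X) , coords (embed e) ⟩
          ≈⟨ dual-bracket f X (embed e) (seaweed-supported {D₁} {D₂} {D₃} X sX) (seaweed-supported {D₁} {D₂} {D₃} (embed e) sE) ⟨
        Dual.fun (dual f) ⁅ X , embed e ⁆
          ≈⟨ k (embed e) sE ⟩
        0# ∎

    ker-traceless : ∀ {f x} → Ker f x → Ker f (traceless x)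
    ker-traceless {f} {x} k = ad*⇒ker λ i → trans (lin-traceless (ad*-linear f i) x)
      (trans (+-cong (ker⇒ad* k i) (trans (-‿cong (trans (*-congˡ (ker⇒ad* (identity-ker f) i)) (zeroʳ _))) -0#≈0#)) (+-identityʳ 0#))

    diag-lin : ∀ u → Lin {SW D₁ D₂ D₃} (λ x → diag x u)
    diag-lin (in₁ i) = lin-P i i
    diag-lin (in₂ i) = lin-R i i
    diag-lin (in₃ i) = lin-T i i

    diag-identity : ∀ u → diag one u ≈ 1#
    diag-identity (in₁ i) = δ-refl i
    diag-identity (in₂ i) = δ-refl i
    diag-identity (in₃ i) = δ-refl i

    -- The vector `v zero` is dropped and the others are made traceless. A multiple of the identity
    -- is then detected by the coordinate `p zero`, at which the remaining `v` vanish.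
    kerB-dimension : ∀ {g} {f : Form D₁ D₂ D₃} → DiagonalCoordinates f (fin (suc g)) → HasDim (KerB (dual f)) g
    kerB-dimension {g} {f} co =
      (λ k → embed (w k)) ,
      (λ k → ker⇒kerB f (embed (w k)) (embed-seaweed (w k) (traceˢ-traceless (v (suc k))))
        (Ker-congˣ (λ i → sym (coords-embed (w k) i)) (ker-traceless (vector-ker co (ix (suc k)))))) ,
      independent ,
      spanning
      where
      open DiagonalCoordinates
      v : Fin (suc g) → Seaweed D₁ D₂ D₃
      v k = vector co (ix k)
      w : Fin g → Seaweed D₁ D₂ D₃
      w k = traceless (v (suc k))
      p : Fin (suc g) → El V
      p k = position co (ix k)

      comb : (Fin g → Carrier) → (Fin g → Seaweed D₁ D₂ D₃) → Seaweed D₁ D₂ D₃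
      comb c u i = sumFin (λ k → c k * u k i)

      lin-comb : ∀ {φ : Seaweed D₁ D₂ D₃ → Carrier} → Lin φ → ∀ c u → φ (comb c u) ≈ sumFin (λ k → c k * φ (u k))
      lin-comb l c u = lin-lincomb l {fin g} (λ { (ix k) → c k }) (λ { (ix k) → u k })

      comb-w : ∀ c i → comb c w i ≈ comb c (v ∘ suc) i - sumFin (λ k → c k * meanDiagonal (v (suc k))) * one i
      comb-w c i = begin
        sumFin (λ k → c k * (v (suc k) i - meanDiagonal (v (suc k)) * one i))
          ≈⟨ sumFin-cong (λ k → solve 4 (λ c v m o → c :* (v :- m :* o) := c :* v :- (c :* m) :* o) refl (c k) (v (suc k) i) (meanDiagonal (v (suc k))) (one i)) ⟩
        sumFin (λ k → c k * v (suc k) i - (c k * meanDiagonal (v (suc k))) * one i)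
          ≈⟨ ∑-minus {fin g} (λ { (ix k) → c k * v (suc k) i }) (λ { (ix k) → (c k * meanDiagonal (v (suc k))) * one i }) ⟩
        comb c (v ∘ suc) i - sumFin (λ k → (c k * meanDiagonal (v (suc k))) * one i)
          ≈⟨ +-congˡ (-‿cong (∑-*ʳ {fin g} (one i) (λ { (ix k) → c k * meanDiagonal (v (suc k)) }))) ⟩
        comb c (v ∘ suc) i - sumFin (λ k → c k * meanDiagonal (v (suc k))) * one i ∎

      diag-comb-0 : ∀ c → diag (comb c (v ∘ suc)) (p zero) ≈ 0#
      diag-comb-0 c = trans (lin-comb (diag-lin (p zero)) c (v ∘ suc))
        (∑-0 {fin g} {λ { (ix k) → c k * diag (v (suc k)) (p zero) }}
          (λ { (ix k) → trans (*-congˡ (vector-diag co (ix (suc k)) (ix zero))) (zeroʳ (c k)) }))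

      diag-comb-suc : ∀ c j → diag (comb c (v ∘ suc)) (p (suc j)) ≈ c j
      diag-comb-suc c j = trans (lin-comb (diag-lin (p (suc j))) c (v ∘ suc))
        (trans (sumFin-cong (λ k → *-congˡ (vector-diag co (ix (suc k)) (ix (suc j)))))
               (∑-δʳ {fin g} (ix j) (λ { (ix k) → c k })))

      independent : ∀ c → lincomb c (λ k → embed (w k)) ≈ₘ 0ₘ → ∀ k → c k ≈ 0#
      -- The relation says that the combination of the `v` is s times the identity. Its entry at
      -- `p zero` gives s = 0, and then the one at `p (suc j)` gives cⱼ = 0.
      independent c h j = begin
        c j                                              ≈⟨ diag-comb-suc c j ⟨
        diag (comb c (v ∘ suc)) (p (suc j))              ≈⟨ x-y≈0⁻¹ (at (p (suc j))) ⟩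
        s                                                ≈⟨ x-y≈0⁻¹ (at (p zero)) ⟨
        diag (comb c (v ∘ suc)) (p zero)                 ≈⟨ diag-comb-0 c ⟩
        0# ∎
        where
        s = sumFin (λ k → c k * meanDiagonal (v (suc k)))
        vanishes : ∀ i → comb c w i ≈ 0#
        vanishes i = begin
          comb c w i                                       ≈⟨ sumFin-cong (λ k → *-congˡ (sym (coords-embed (w k) i))) ⟩
          sumFin (λ k → c k * coords (embed (w k)) i)      ≈⟨ by-blocks {x = λ i → sumFin (λ k → c k * coords (embed (w k)) i)} {λ _ → 0#}
                                                               (λ i j → h (index {V} (in₁ i)) (index {V} (in₁ j))) (λ i j → h (index {V} (in₂ i)) (index {V} (in₁ j)))
                                                               (λ i j → h (index {V} (in₂ i)) (index {V} (in₂ j))) (λ i j → h (index {V} (in₂ i)) (index {V} (in₃ j)))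
                                                               (λ i j → h (index {V} (in₃ i)) (index {V} (in₃ j))) i ⟩
          0# ∎
        at : ∀ u → diag (comb c (v ∘ suc)) u - s ≈ 0#
        at u = begin
          diag (comb c (v ∘ suc)) u - s                    ≈⟨ +-congˡ (-‿cong (sym (trans (*-congˡ (diag-identity u)) (*-identityʳ s)))) ⟩
          diag (comb c (v ∘ suc)) u - s * diag one u       ≈⟨ +-congˡ (trans (-‿distribˡ-* _ _) (sym (scale-lin (diag-lin u) (- s) one))) ⟩
          diag (comb c (v ∘ suc)) u + diag (λ i → - s * one i) u
                                                           ≈⟨ add-lin (diag-lin u) (comb c (v ∘ suc)) (λ i → - s * one i) ⟨
          diag (λ i → comb c (v ∘ suc) i + - s * one i) u  ≈⟨ lin-zero (diag-lin u) (λ i → trans (+-congˡ (sym (-‿distribˡ-* s (one i))))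
                                                                (trans (sym (comb-w c i)) (vanishes i))) ⟩
          0# ∎

      spanning : ∀ X → KerB (dual f) X → Σ (Fin g → Carrier) λ α → X ≈ₘ lincomb α (λ k → embed (w k))
      spanning X k@(sX , _) = α , λ i j → begin
          X i j                             ≈⟨ supported-embed {D₁} {D₂} {D₃} X (seaweed-supported {D₁} {D₂} {D₃} X sX) i j ⟩
          embed x i j                       ≈⟨ cong-lin (embed-lin i j) x≈ ⟩
          embed (comb α w) i j              ≈⟨ lin-comb (embed-lin i j) α w ⟩
          lincomb α (λ k → embed (w k)) i j ∎
        where
        x = coords X
        d : El V → Carrier
        d = diag x
        α : Fin g → Carrier
        -- Subtracting `d (p zero)` times the identity from `x` makes the coordinate at `p zero`
        -- vanish and turns the others into α.
        α k = d (p (suc k)) - d (p zero)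
        s = sumFin (λ k → α k * meanDiagonal (v (suc k)))
        y : Seaweed D₁ D₂ D₃
        y i = x i + (- comb α (v ∘ suc) i + - d (p zero) * one i)
        lin-y : ∀ {φ : Seaweed D₁ D₂ D₃ → Carrier} → Lin φ → φ y ≈ φ x - (φ (comb α (v ∘ suc)) + d (p zero) * φ one)
        lin-y {φ} l = trans (add-lin l x _) (trans (+-congˡ (trans (add-lin l _ _)
            (+-cong (trans (cong-lin l (λ i → -≈-1* _)) (scale-lin l (- 1#) (comb α (v ∘ suc)))) (scale-lin l (- d (p zero)) one))))
          (trans (+-congˡ (+-congʳ (sym (-≈-1* _)))) (solve 4 (λ x a d o → x :+ (:- a :+ (:- d) :* o) := x :- (a :+ d :* o)) refl _ _ _ _)))
        y-ker : Ker f y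
        y-ker = ad*⇒ker λ i → trans (lin-y (ad*-linear f i)) (trans
          (+-cong (ker⇒ad* (kerB⇒ker f X k) i) (-‿cong (+-cong
            (trans (lin-comb (ad*-linear f i) α (v ∘ suc)) (∑-0 {fin g} {λ { (ix k) → α k * ad* f (v (suc k)) i }}
              (λ { (ix k) → trans (*-congˡ (ker⇒ad* (vector-ker co (ix (suc k))) i)) (zeroʳ (α k)) })))
            (trans (*-congˡ (ker⇒ad* (identity-ker f) i)) (zeroʳ _)))))
          (trans (+-identityˡ _) (trans (-‿cong (+-identityˡ 0#)) -0#≈0#)))
        y-diag : ∀ k → diag y (position co k) ≈ 0#
        y-diag (ix zero) = trans (lin-y (diag-lin (p zero))) (trans
          (+-congˡ (-‿cong (+-cong (diag-comb-0 α) (trans (*-congˡ (diag-identity (p zero))) (*-identityʳ _)))))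
          (trans (+-congˡ (-‿cong (+-identityˡ _))) (-‿inverseʳ _)))
        y-diag (ix (suc j)) = trans (lin-y (diag-lin (p (suc j)))) (trans
          (+-congˡ (-‿cong (+-cong (diag-comb-suc α j) (trans (*-congˡ (diag-identity (p (suc j)))) (*-identityʳ _)))))
          (solve 2 (λ a b → a :- ((a :- b) :+ b) := :0) refl _ _))
        y≈0 : ∀ i → y i ≈ 0#
        y≈0 = diag-zero co y-ker y-diag
        -- Taking mean diagonals in `y≈0`: that of `x` is 0, which fixes the multiple of the
        -- identity.
        d≈-s : d (p zero) ≈ - s
        d≈-s = begin
          d (p zero)                                           ≈⟨ solve 3 (λ m s d → d := (m :- (m :- (s :+ d))) :- s) refl (meanDiagonal x) s (d (p zero)) ⟩
          (meanDiagonal x - (meanDiagonal x - (s + d (p zero)))) - s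
            ≈⟨ +-congʳ (+-cong (meanDiagonal-0 x (seaweed-trace {D₁} {D₂} {D₃} X sX)) (-‿cong (trans
                 (+-congˡ (-‿cong (+-cong (sym (lin-comb meanDiagonal-lin α (v ∘ suc)))
                   (sym (trans (*-congˡ meanDiagonal-identity) (*-identityʳ _))))))
                 (trans (sym (lin-y meanDiagonal-lin)) (lin-zero meanDiagonal-lin y≈0))))) ⟩
          (0# - 0#) - s                                        ≈⟨ trans (+-congʳ (-‿inverseʳ 0#)) (+-identityˡ _) ⟩
          - s                                                  ∎
        x≈ : ∀ i → x i ≈ comb α w i
        x≈ i = begin
          x i                                         ≈⟨ x-y≈0⁻¹ (trans (solve 4 (λ x a d o → x :- (a :+ d :* o) := x :+ (:- a :+ (:- d) :* o)) refl
                                                            (x i) (comb α (v ∘ suc) i) (d (p zero)) (one i)) (y≈0 i)) ⟩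
          comb α (v ∘ suc) i + d (p zero) * one i     ≈⟨ +-congˡ (trans (*-congʳ d≈-s) (sym (-‿distribˡ-* s (one i)))) ⟩
          comb α (v ∘ suc) i - s * one i              ≈⟨ comb-w α i ⟨
          comb α w i                                  ∎

-- The same field with doubly negated equality

module _ {o ℓ : Level} (F : CharZeroField o ℓ) where
  open CharZeroField F hiding (zero)

  private
    infix 4 _≈¬¬_
    _≈¬¬_ : Carrier → Carrier → Set ℓ
    x ≈¬¬ y = ¬ ¬ (x ≈ y)

    stableRing : CommutativeRing o ℓ
    stableRing = record
      { Carrier = Carrier ; _≈_ = _≈¬¬_ ; _+_ = _+_ ; _*_ = _*_ ; -_ = -_ ; 0# = 0# ; 1# = 1#
      ; isCommutativeRing = record
        { isRing = record
          { +-isAbelianGroup = record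
            { isGroup = record
              { isMonoid = record
                { isSemigroup = record
                  { isMagma = record
                    { isEquivalence = record
                      { refl  = ¬¬-return refl
                      ; sym   = λ p → p >>= λ p → ¬¬-return (sym p)
                      ; trans = λ p q → p >>= λ p → q >>= λ q → ¬¬-return (trans p q) }
                    ; ∙-cong = λ p q → p >>= λ p → q >>= λ q → ¬¬-return (+-cong p q) }
                  ; assoc = λ x y z → ¬¬-return (+-assoc x y z) }
                ; identity = (λ x → ¬¬-return (+-identityˡ x)) , (λ x → ¬¬-return (+-identityʳ x)) }
              ; inverse = (λ x → ¬¬-return (-‿inverseˡ x)) , (λ x → ¬¬-return (-‿inverseʳ x))
              ; ⁻¹-cong = λ p → p >>= λ p → ¬¬-return (-‿cong p) }
            ; comm = λ x y → ¬¬-return (+-comm x y) }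
          ; *-cong = λ p q → p >>= λ p → q >>= λ q → ¬¬-return (*-cong p q)
          ; *-assoc = λ x y z → ¬¬-return (*-assoc x y z)
          ; *-identity = (λ x → ¬¬-return (*-identityˡ x)) , (λ x → ¬¬-return (*-identityʳ x))
          ; distrib = (λ x y z → ¬¬-return (distribˡ x y z)) , (λ x y z → ¬¬-return (distribʳ x y z)) }
        ; *-comm = λ x y → ¬¬-return (*-comm x y) } }

    ringFromℕ-stable : ∀ n → ringFromℕ stableRing n ≡ ringFromℕ cring n
    ringFromℕ-stable zero    = ≡.refl
    ringFromℕ-stable (suc n) = ≡.cong (1# +_) (ringFromℕ-stable n)

  -- Equality in a field need not be decidable. Its double negation is stable, which is all that the
  -- elimination arguments for the lower bound require, since their conclusion k ≤ d is decidable.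
  stabilise : CharZeroField o ℓ
  stabilise = record
    { cring   = stableRing
    ; 1≉0     = λ h → h 1≉0
    ; inverse = λ x x≉0 → proj₁ (inverse x (λ h → x≉0 (¬¬-return h)))
                        , ¬¬-return (proj₂ (inverse x (λ h → x≉0 (¬¬-return h))))
    ; char0   = λ n h → h (λ h → char0 n (trans (reflexive (≡.sym (ringFromℕ-stable (suc n)))) h)) }

  stabilise-stable : Stable stabilise
  stabilise-stable h k = h (λ h → h k)

-- The lower bound for forms on the traceless seaweed

module IndexLowerBound {o ℓ : Level} (F : CharZeroField o ℓ) where
  open Traceless F
  module St = LowerBound (stabilise F) (stabilise-stable F)

  -- The two fields share their operations and differ only in `_≈_`, but `sumFin` has the whole
  -- field as a parameter, so the sums agree by induction and not by definition.
  sumFin-agrees : ∀ {n} (f : Fin n → Carrier) → Over.sumFin (stabilise F) f ≡ sumFin f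
  sumFin-agrees {zero}  f = ≡.refl
  sumFin-agrees {suc n} f = ≡.cong (f zero +_) (sumFin-agrees (f ∘ suc))

  ∑-agrees : ∀ {I} (f : El I → Carrier) → St.∑ f ≈ ∑ f
  ∑-agrees {fin n} f = reflexive (sumFin-agrees (λ i → f (ix i)))
  ∑-agrees {I ⊕ J} f = +-cong (∑-agrees (λ i → f (inl i))) (∑-agrees (λ j → f (inr j)))
  ∑-agrees {I ⊗ J} f = trans (∑-agrees {I} (λ i → St.∑ {J} (λ j → f (pr i j)))) (∑-cong {I} (λ i → ∑-agrees {J} (λ j → f (pr i j))))

  module _ {D₁ D₂ D₃ : Dim} where
    stableForm : Form D₁ D₂ D₃ → St.Form D₁ D₂ D₃
    stableForm f = St.form (M₁ f) (M₂ f) (M₃ f) (ξ₁ f) (ξ₃ f)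

    ·-agrees : ∀ {I J K} (A : Mtx I J) (B : Mtx J K) i k → (A St.· B) i k ≈ (A · B) i k
    ·-agrees {J = J} A B i k = ∑-agrees {J} (λ j → A i j * B j k)

    ad*-agrees : ∀ f x i → St.ad* {D₁} {D₂} {D₃} (stableForm f) x i ≈ ad* f x i
    ad*-agrees f x (pP i j) =
      +-cong (+-cong (·-agrees (M₁ f) (P x) j i) (·-agrees (ξ₁ f) (Q x) j i)) (-‿cong (·-agrees (P x) (M₁ f) j i))
    ad*-agrees f x (pQ i j) = +-cong (·-agrees (ξ₁ f) (R x) j i) (-‿cong (·-agrees (P x) (ξ₁ f) j i))
    ad*-agrees f x (pR i j) = +-cong (·-agrees (M₂ f) (R x) j i)
      (-‿cong (+-cong (·-agrees (R x) (M₂ f) j i) (+-cong (·-agrees (Q x) (ξ₁ f) j i) (·-agrees (S x) (ξ₃ f) j i))))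
    ad*-agrees f x (pS i j) = +-cong (·-agrees (ξ₃ f) (R x) j i) (-‿cong (·-agrees (T x) (ξ₃ f) j i))
    ad*-agrees f x (pT i j) =
      +-cong (+-cong (·-agrees (M₃ f) (T x) j i) (·-agrees (ξ₃ f) (S x) j i)) (-‿cong (·-agrees (T x) (M₃ f) j i))

  module _ {D₁ D₂ D₃ : Dim} (n≢0 : size (D₁ ⊕ D₂ ⊕ D₃) ≢ 0) where
    private
      V = D₁ ⊕ D₂ ⊕ D₃
      n = size V
      c = size D₁
      a = size D₁ ℕ.+ size D₂

    module _ (f : Dual n a c) where
      open Dual f renaming (cong to fun-cong)

      tl : Seaweed D₁ D₂ D₃ → Mat n
      tl x = embed (traceless n≢0 x)

      tl-seaweed : ∀ x → InSeaweed n a c (tl x)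
      tl-seaweed x = embed-seaweed (traceless n≢0 x) (traceˢ-traceless n≢0 x)

      tl-lin : ∀ i j → Lin (λ x → tl x i j)
      tl-lin i j = lin-∘ (embed-lin i j) (traceless-lin n≢0)

      -- f extended to the gl-seaweed so as to vanish on the identity matrix.
      extension : Seaweed D₁ D₂ D₃ → Carrier
      extension x = fun (tl x)

      extension-lin : Lin extension
      extension-lin .cong-lin {x} {y} h = fun-cong (tl x) (tl y) (tl-seaweed x) (tl-seaweed y) (λ i j → cong-lin (tl-lin i j) h)
      extension-lin .add-lin x y = trans
        (fun-cong (tl (λ i → x i + y i)) (tl x +ₘ tl y) (tl-seaweed (λ i → x i + y i)) (+-seaweed (tl x) (tl y) (tl-seaweed x) (tl-seaweed y)) (λ i j → add-lin (tl-lin i j) x y))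
        (additive (tl x) (tl y) (tl-seaweed x) (tl-seaweed y))
        where
        +-seaweed : ∀ X Y → InSeaweed n a c X → InSeaweed n a c Y → InSeaweed n a c (X +ₘ Y)
        +-seaweed X Y (lift (l , u , t)) (lift (l′ , u′ , t′)) = lift
          ( (λ i j p q → trans (+-cong (l i j p q) (l′ i j p q)) (+-identityˡ 0#))
          , (λ i j p q → trans (+-cong (u i j p q) (u′ i j p q)) (+-identityˡ 0#))
          , trans (∑-+ {fin n} (λ { (ix i) → X i i }) (λ { (ix i) → Y i i })) (trans (+-cong t t′) (+-identityˡ 0#)) )
      extension-lin .scale-lin r x = trans
        (fun-cong (tl (λ i → r * x i)) (r ·ₘ tl x) (tl-seaweed (λ i → r * x i)) (·-seaweed (tl x) (tl-seaweed x)) (λ i j → scale-lin (tl-lin i j) r x))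
        (homogeneous r (tl x) (tl-seaweed x))
        where
        ·-seaweed : ∀ X → InSeaweed n a c X → InSeaweed n a c (r ·ₘ X)
        ·-seaweed X (lift (l , u , t)) = lift
          ( (λ i j p q → trans (*-congˡ (l i j p q)) (zeroʳ r))
          , (λ i j p q → trans (*-congˡ (u i j p q)) (zeroʳ r))
          , trans (∑-*ˡ {fin n} r (λ { (ix i) → X i i })) (trans (*-congˡ t) (zeroʳ r)) )

      φᶠ : Seaweed D₁ D₂ D₃
      φᶠ i = extension (δ i)

      formᶠ : Form D₁ D₂ D₃
      formᶠ = toForm φᶠ

      extension-pairing : ∀ x → extension x ≈ ⟨ coefficients formᶠ , x ⟩
      extension-pairing x = trans (lin-expand extension-lin x)
        (∑-cong {SW D₁ D₂ D₃} (λ i → trans (*-comm (x i) (φᶠ i)) (*-congʳ (sym (coefficients-toForm φᶠ i)))))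

      fun-extension : ∀ X → InSeaweed n a c X → fun X ≈ extension (coords X)
      fun-extension X sX = fun-cong X (tl (coords X)) sX (tl-seaweed (coords X)) λ i j →
        trans (supported-embed {D₁} {D₂} {D₃} X (seaweed-supported {D₁} {D₂} {D₃} X sX) i j)
          (sym (cong-lin (embed-lin {D₁} {D₂} {D₃} i j) (traceless-id n≢0 (coords X) (seaweed-trace {D₁} {D₂} {D₃} X sX))))

      ker⇒kerBᶠ : ∀ x → traceˢ x ≈ 0# → Ker formᶠ x → KerB f (embed x)
      ker⇒kerBᶠ x t k = sX , λ Y sY → begin
        fun ⁅ X , Y ⁆
          ≈⟨ fun-extension ⁅ X , Y ⁆ (⁅⁆-seaweed {D₁} {D₂} {D₃} X Y hX (hY Y sY)) ⟩
        extension (coords ⁅ X , Y ⁆)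
          ≈⟨ cong-lin extension-lin (λ i → coords-⁅⁆ {D₁} {D₂} {D₃} X Y hX (hY Y sY) i) ⟩
        extension (bracket (coords X) (coords Y))
          ≈⟨ extension-pairing (bracket (coords X) (coords Y)) ⟩
        ⟨ coefficients formᶠ , bracket (coords X) (coords Y) ⟩
          ≈⟨ ad*-adjoint formᶠ (coords X) (coords Y) ⟩
        ⟨ ad* formᶠ (coords X) , coords Y ⟩
          ≈⟨ ⟨⟩-zeroˡ n≢0 (ker⇒ad* (Ker-congˣ (λ i → sym (coords-embed x i)) k)) (coords Y) ⟩
        0# ∎
        where
        X = embed x
        sX = embed-seaweed x t
        hX = supported-embedding x
        hY : ∀ Y → InSeaweed n a c Y → Supported {D₁} {D₂} {D₃} Y
        hY Y = seaweed-supported {D₁} {D₂} {D₃} Y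

    private
      stable-traceˢ : Seaweed D₁ D₂ D₃ → Carrier
      stable-traceˢ x = St.∑ (λ i → P x i i) + (St.∑ (λ i → R x i i) + St.∑ (λ i → T x i i))

      stable-traceˢ-lin : St.Lin stable-traceˢ
      stable-traceˢ-lin = St.lin-+ (St.lin-∑ {J = D₁} (λ i → St.lin-at (pP i i)))
        (St.lin-+ (St.lin-∑ {J = D₂} (λ i → St.lin-at (pR i i))) (St.lin-∑ {J = D₃} (λ i → St.lin-at (pT i i))))

      stable-traceˢ-agrees : ∀ x → stable-traceˢ x ≈ traceˢ x
      stable-traceˢ-agrees x = +-cong (∑-agrees {D₁} (λ i → P x i i)) (+-cong (∑-agrees {D₂} (λ i → R x i i)) (∑-agrees {D₃} (λ i → T x i i)))

    module _ (f : Dual n a c) {d : ℕ} (v : Fin d → Mat n) (v-seaweed : ∀ k → InSeaweed n a c (v k)) where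
      entry : El (SW D₁ D₂ D₃) → Fin d → Carrier
      entry i k = coords (v k) i

      lincomb-embed : ∀ α i j → lincomb α v i j ≈ embed (λ l → sumFin (λ k → α k * entry l k)) i j
      lincomb-embed α i j = trans
        (sumFin-cong (λ k → *-congˡ (supported-embed {D₁} {D₂} {D₃} (v k) (seaweed-supported {D₁} {D₂} {D₃} (v k) (v-seaweed k)) i j)))
        (sym (lin-lincomb (embed-lin {D₁} {D₂} {D₃} i j) {fin d} (λ { (ix k) → α k }) (λ { (ix k) → coords (v k) })))

      coords-lincomb : ∀ α i → coords (lincomb α v) i ≈ sumFin (λ k → α k * entry i k)
      coords-lincomb α i = by-blocks {x = coords (lincomb α v)} {λ i → sumFin (λ k → α k * entry i k)} ≋-refl ≋-refl ≋-refl ≋-refl ≋-refl i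

      stable-∙ : ∀ (α : Fin d → Carrier) i → entry i St.∙ α ≈ sumFin (λ k → α k * entry i k)
      stable-∙ α i = trans (reflexive (sumFin-agrees (λ k → entry i k * α k))) (sumFin-cong (λ k → *-comm (entry i k) (α k)))

      -- Independence passes to ¬¬-equality because the finitely many doubly negated equations can
      -- be collected before `independent` is applied.
      entry-inj : (∀ α → lincomb α v ≈ₘ 0ₘ → ∀ k → α k ≈ 0#) → St.Inj entry
      entry-inj independent α h j = ¬¬-choice h >>= λ h′ → ¬¬-return (independent α (λ i k →
        trans (lincomb-embed α i k) (lin-zero (embed-lin {D₁} {D₂} {D₃} i k) (λ l → trans (sym (stable-∙ α l)) (h′ l)))) j)

      -- The trace is added to d chosen coordinates to make up for the identity matrix, which lies
      -- in the kernel of every form on the seaweed in 𝔤𝔩(n).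
      functionals : (Fin d → El (SW D₁ D₂ D₃)) → Fin (suc d) → Seaweed D₁ D₂ D₃ → Carrier
      functionals rows zero    x = stable-traceˢ x
      functionals rows (suc k) x = x (rows k)

      functionals-lin : ∀ rows i → St.Lin (functionals rows i)
      functionals-lin rows zero    = stable-traceˢ-lin
      functionals-lin rows (suc k) = St.lin-at (rows k)

      stable-ker : ∀ (g : Form D₁ D₂ D₃) (x : Seaweed D₁ D₂ D₃) → St.Ker (stableForm g) x → ¬ ¬ Ker g x
      stable-ker g x k = ¬¬-choice {B = λ i → ad* g x i ≈ 0#} ad*≈0 >>= λ h → ¬¬-return (ad*⇒ker h)
        where
        ad*≈0 : ∀ i → ¬ ¬ (ad* g x i ≈ 0#)
        ad*≈0 i = St.ker⇒ad* k i >>= λ e → ¬¬-return (trans (sym (ad*-agrees g x i)) e)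

      -- Trace zero puts `x` into `KerB f`, so it is a combination of the `v`, and the chosen rows
      -- force the coefficients to vanish.
      functionals-separate : (∀ X → KerB f X → Σ (Fin d → Carrier) λ α → X ≈ₘ lincomb α v) →
        ∀ rows → St.Inj (entry ∘ rows) →
        ∀ x → St.Ker (stableForm (formᶠ f)) x → (∀ i → ¬ ¬ (functionals rows i x ≈ 0#)) → ∀ j → ¬ ¬ (x j ≈ 0#)
      functionals-separate spanning rows rows-inj x k Cx≈0 j =
        stable-ker (formᶠ f) x k >>= λ k′ →
        Cx≈0 zero >>= λ t →
        in-kernel (spanning (embed x) (ker⇒kerBᶠ f x (trans (sym (stable-traceˢ-agrees x)) t) k′))
        where
        in-kernel : Σ (Fin d → Carrier) (λ α → embed x ≈ₘ lincomb α v) → ¬ ¬ (x j ≈ 0#)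
        in-kernel (α , X≈) = ¬¬-choiceᶠ {B = λ k → α k ≈ 0#} (rows-inj α α-rows) >>= λ α≈0 →
          ¬¬-return (trans (x≈ j) (∑-0 {fin d} {λ { (ix k) → α k * entry j k }}
            (λ { (ix k) → trans (*-congʳ (α≈0 k)) (zeroˡ (entry j k)) })))
          where
          x≈ : ∀ i → x i ≈ sumFin (λ k → α k * entry i k)
          x≈ i = trans (sym (coords-embed x i)) (trans
            (coords-cong {D₁} {D₂} {D₃} (embed x) (lincomb α v) (λ u w → X≈ (index u) (index w)) i) (coords-lincomb α i))
          α-rows : ∀ r → ¬ ¬ (entry (rows r) St.∙ α ≈ 0#)
          α-rows r = Cx≈0 (suc r) >>= λ x≈0 → ¬¬-return (trans (stable-∙ α (rows r)) (trans (sym (x≈ (rows r))) x≈0))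

    kerB-dimension-≥ : ∀ {G g} → Red D₁ D₂ D₃ G → size G ≡ suc g →
                       ∀ (f : Dual n a c) d → HasDim (KerB f) d → g ≤ d
    kerB-dimension-≥ {G} {g} red size≡ f d (v , v-ker , independent , spanning) with g ℕ.≤? d
    ... | yes g≤d = g≤d
    -- Only a contradiction is wanted here, so doubly negated results may be used. The family given
    -- to `generic-rows` is constant: d rows of `entry` are selected.
    ... | no  g≰d = contradiction {A = ⊤} _ λ _ →
      St.generic-rows d (λ _ → entry f v sv) (λ i k → St.isPoly-const (entry f v sv i k)) 0# (entry-inj f v sv independent)
        λ (rows , c′) → St.kernel-large red (stableForm (formᶠ f)) (suc d)
          (≡.subst (suc d <_) (≡.sym size≡) (s≤s (ℕₚ.≰⇒> g≰d)))
          (functionals f v sv rows) (functionals-lin f v sv rows)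
          (functionals-separate f v sv spanning rows (St.Cofinitely.holds c′ (St.Cofinitely.bound c′) ℕₚ.≤-refl))
      where
      sv : ∀ k → InSeaweed n a c (v k)
      sv k = proj₁ (v-ker k)

-- The index of a seaweed

gcd[m+n,n] : ∀ m n → gcd (m ℕ.+ n) n ≡ gcd m n
gcd[m+n,n] m n = ∣-antisym
  (gcd-greatest (∣m+n∣m⇒∣n (≡.subst (gcd (m ℕ.+ n) n ∣_) (ℕₚ.+-comm m n) (gcd[m,n]∣m (m ℕ.+ n) n)) (gcd[m,n]∣n (m ℕ.+ n) n))
                (gcd[m,n]∣n (m ℕ.+ n) n))
  (gcd-greatest (∣m∣n⇒∣m+n (gcd[m,n]∣m m n) (gcd[m,n]∣n m n)) (gcd[m,n]∣n m n))

gcd[m,n+m] : ∀ m n → gcd m (n ℕ.+ m) ≡ gcd m n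
gcd[m,n+m] m n = ≡.trans (gcd-comm m (n ℕ.+ m)) (≡.trans (gcd[m+n,n] n m) (gcd-comm n m))

record Reduction (c m b : ℕ) : Set where
  field
    {D₁ D₂ D₃ G} : Dim
    red   : Red D₁ D₂ D₃ G
    size₁ : size D₁ ≡ c
    size₂ : size D₂ ≡ m
    size₃ : size D₃ ≡ b
    sizeᴳ : size G ≡ gcd (c ℕ.+ b) m

private
  injective-step : ∀ {c m b} → Reduction c m b → Reduction (m ℕ.+ c) m b
  injective-step {c} {m} {b} r = record
    { red = injective red ; size₁ = ≡.cong₂ ℕ._+_ size₂ size₁ ; size₂ = size₂ ; size₃ = size₃
    ; sizeᴳ = ≡.trans sizeᴳ (≡.trans (≡.sym (gcd[m+n,n] (c ℕ.+ b) m))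
        (≡.cong (λ k → gcd k m) (≡.trans (ℕₚ.+-comm (c ℕ.+ b) m) (≡.sym (ℕₚ.+-assoc m c b))))) }
    where open Reduction r

  swap-step : ∀ {c m b} → Reduction c m b → Reduction b m c
  swap-step {c} {m} {b} r = record
    { red = swap red ; size₁ = size₃ ; size₂ = size₂ ; size₃ = size₁
    ; sizeᴳ = ≡.trans sizeᴳ (≡.cong (λ k → gcd k m) (ℕₚ.+-comm c b)) }
    where open Reduction r

  surjective-step : ∀ {c m b} → Reduction c m b → Reduction c (c ℕ.+ (b ℕ.+ m)) b
  surjective-step {c} {m} {b} r = record
    { red = surjective red ; size₁ = size₁ ; size₃ = size₃
    ; size₂ = ≡.cong₂ ℕ._+_ size₁ (≡.cong₂ ℕ._+_ size₃ size₂)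
    ; sizeᴳ = ≡.trans sizeᴳ (≡.trans (≡.sym (gcd[m,n+m] (c ℕ.+ b) m))
        (≡.cong (gcd (c ℕ.+ b)) (≡.trans (ℕₚ.+-comm m (c ℕ.+ b)) (ℕₚ.+-assoc c b m)))) }
    where open Reduction r

  -- Two Euclidean subtractions at once: with m = k + j + l, gcd(k + j, l) = gcd(m, l) = gcd(l + m,
  -- m).
  transverse-step : ∀ {k l j} → Reduction k l j → Reduction (k ℕ.+ l) (k ℕ.+ (j ℕ.+ l)) (j ℕ.+ l)
  transverse-step {k} {l} {j} r = record
    { red = transverse red ; size₁ = ≡.cong₂ ℕ._+_ size₁ size₂ ; size₃ = ≡.cong₂ ℕ._+_ size₃ size₂
    ; size₂ = ≡.cong₂ ℕ._+_ size₁ (≡.cong₂ ℕ._+_ size₃ size₂)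
    ; sizeᴳ = ≡.trans sizeᴳ (≡.trans (≡.sym (gcd[m+n,n] (k ℕ.+ j) l)) (≡.trans (gcd-comm (k ℕ.+ j ℕ.+ l) l)
        (≡.trans (≡.sym (gcd[m+n,n] l (k ℕ.+ j ℕ.+ l)))
          (≡.cong₂ gcd (solve 3 (λ k j l → l :+ (k :+ j :+ l) := k :+ l :+ (j :+ l)) ≡.refl k j l) (ℕₚ.+-assoc k j l))))) }
    where
    open Reduction r
    open +-*-Solver

-- N is fuel above the sum of the dimensions. `0 < c + b` makes the surjective step shrink that sum;
-- once this step is excluded, m < c + b keeps `0 < c + b` true after an injective one.
reduce : ∀ N c m b → c ℕ.+ m ℕ.+ b < N → 0 < c ℕ.+ b → Reduction c m b
reduce (suc N) c zero b bound pos = record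
  { red = base c b ; size₁ = ≡.refl ; size₂ = ≡.refl ; size₃ = ≡.refl ; sizeᴳ = ≡.sym (gcd-identityʳ (c ℕ.+ b)) }
reduce (suc N) c m@(suc _) b bound pos with c ℕ.+ b ℕ.≤? m | m ℕ.≤? c | m ℕ.≤? b
... | yes c+b≤m | _ | _ = ≡.subst (λ m → Reduction c m b) m≡
        (surjective-step (reduce N c (m ∸ (c ℕ.+ b)) b
          (ℕₚ.<-≤-trans (ℕₚ.+-monoˡ-< b (ℕₚ.+-monoʳ-< c (ℕₚ.∸-monoʳ-< pos c+b≤m))) (ℕₚ.≤-pred bound)) pos))
  where
  m≡ : c ℕ.+ (b ℕ.+ (m ∸ (c ℕ.+ b))) ≡ m
  m≡ = ≡.trans (≡.sym (ℕₚ.+-assoc c b _)) (ℕₚ.m+[n∸m]≡n c+b≤m)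
... | no c+b≰m | yes m≤c | _ = ≡.subst (λ c → Reduction c m b) (ℕₚ.m+[n∸m]≡n m≤c)
        (injective-step (reduce N (c ∸ m) m b
          (ℕₚ.<-≤-trans (ℕₚ.+-monoˡ-< b (ℕₚ.+-monoˡ-< m (ℕₚ.∸-monoʳ-< (s≤s z≤n) m≤c))) (ℕₚ.≤-pred bound))
          (≡.subst (0 <_) (ℕₚ.+-∸-comm b m≤c) (ℕₚ.m<n⇒0<n∸m (ℕₚ.≰⇒> c+b≰m)))))
... | no c+b≰m | no m≰c | yes m≤b = swap-step (≡.subst (λ b → Reduction b m c) (ℕₚ.m+[n∸m]≡n m≤b)
        (injective-step (swap-step (reduce N c m (b ∸ m)
          (ℕₚ.<-≤-trans (ℕₚ.+-monoʳ-< (c ℕ.+ m) (ℕₚ.∸-monoʳ-< (s≤s z≤n) m≤b)) (ℕₚ.≤-pred bound))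
          (≡.subst (0 <_) (ℕₚ.+-∸-assoc c m≤b) (ℕₚ.m<n⇒0<n∸m (ℕₚ.≰⇒> c+b≰m)))))))
... | no c+b≰m | no m≰c | no m≰b = ≡.subst₂ (λ c m → Reduction c m b) c≡ m≡
        (≡.subst (λ b → Reduction (k ℕ.+ l) (k ℕ.+ b) b) b≡ (transverse-step (reduce N k l j
          (ℕₚ.<-≤-trans klj<  (ℕₚ.≤-pred bound)) (ℕₚ.<-≤-trans (ℕₚ.m<n⇒0<n∸m (ℕₚ.≰⇒> m≰b)) (ℕₚ.m≤m+n k j)))))
  where
  -- The dimensions of ker ξ₃, of ker ξ₁ and of a complement to their sum, for ξ₁ and ξ₃ in general
  -- position. They add up to m, so the sum of the dimensions drops by c + b.
  k = m ∸ b
  j = m ∸ c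
  l = c ℕ.+ b ∸ m
  c<m = ℕₚ.≰⇒> m≰c
  b<m = ℕₚ.≰⇒> m≰b
  m<c+b = ℕₚ.≰⇒> c+b≰m
  b≡ : j ℕ.+ l ≡ b
  b≡ = ℕₚ.+-cancelˡ-≡ c _ _ (≡.trans (≡.sym (ℕₚ.+-assoc c j l))
         (≡.trans (≡.cong (ℕ._+ l) (ℕₚ.m+[n∸m]≡n (ℕₚ.<⇒≤ c<m))) (ℕₚ.m+[n∸m]≡n (ℕₚ.<⇒≤ m<c+b))))
  c≡ : k ℕ.+ l ≡ c
  c≡ = ℕₚ.+-cancelˡ-≡ b _ _ (≡.trans (≡.sym (ℕₚ.+-assoc b k l))
         (≡.trans (≡.cong (ℕ._+ l) (ℕₚ.m+[n∸m]≡n (ℕₚ.<⇒≤ b<m))) (≡.trans (ℕₚ.m+[n∸m]≡n (ℕₚ.<⇒≤ m<c+b)) (ℕₚ.+-comm c b))))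
  m≡ : k ℕ.+ b ≡ m
  m≡ = ℕₚ.m∸n+n≡m (ℕₚ.<⇒≤ b<m)
  klj< : k ℕ.+ l ℕ.+ j < c ℕ.+ m ℕ.+ b
  klj< = ≡.subst (_< c ℕ.+ m ℕ.+ b) (≡.sym (≡.trans (≡.cong (ℕ._+ j) c≡) (ℕₚ.m+[n∸m]≡n (ℕₚ.<⇒≤ c<m))))
    (≡.subst (m <_) (≡.trans (ℕₚ.+-comm m (c ℕ.+ b)) (≡.trans (ℕₚ.+-assoc c b m) (≡.trans (≡.cong (c ℕ.+_) (ℕₚ.+-comm b m)) (≡.sym (ℕₚ.+-assoc c m b)))))
      (ℕₚ.m<m+n m pos))

module Index {o ℓ : Level} (F : CharZeroField o ℓ) where
  open IndexLowerBound F
  open Traceless F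

  enumerate-coordinates : ∀ {D₁ D₂ D₃ G} {f : Form D₁ D₂ D₃} →
                          DiagonalCoordinates f G → DiagonalCoordinates f (fin (size G))
  enumerate-coordinates {G = G} co = record
    { position = λ { (ix k) → position (element G k) }
    ; vector = λ { (ix k) → vector (element G k) }
    ; vector-ker = λ { (ix k) → vector-ker (element G k) }
    ; vector-diag = λ { (ix k) (ix l) → trans (vector-diag (element G k) (element G l))
        (δ-⇔ (element G k) (element G l) (ix k) (ix l)
          (λ e → ≡.cong ix (≡.trans (≡.sym (index-element G k)) (≡.trans (≡.cong index e) (index-element G l))))
          (λ { ≡.refl → ≡.refl })) }
    ; diag-zero = λ {x} k h → diag-zero k (λ v → ≡.subst (λ v → diag x (position v) ≈ 0#) (element-index v) (h (ix (index v)))) }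
    where open DiagonalCoordinates co

  reduction-index : ∀ {c m b g} (r : Reduction c m b) → gcd (c ℕ.+ b) m ≡ suc g → 0 < c →
                    SeaweedIndex (c ℕ.+ (m ℕ.+ b)) (c ℕ.+ m) c g
  reduction-index {g = g} record { red = red ; size₁ = ≡.refl ; size₂ = ≡.refl ; size₃ = ≡.refl ; sizeᴳ = sizeᴳ } gcd≡ 0<c =
    (dual n≢0 (proj₁ (good-form red)) ,
     kerB-dimension n≢0 (≡.subst (λ k → DiagonalCoordinates (proj₁ (good-form red)) (fin k)) size≡
       (enumerate-coordinates (proj₂ (good-form red))))) ,
    kerB-dimension-≥ n≢0 red size≡
    where
    size≡ = ≡.trans sizeᴳ gcd≡
    n≢0 = λ e → ℕₚ.<⇒≢ (ℕₚ.<-≤-trans 0<c (ℕₚ.m≤m+n _ _)) (≡.sym e)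

  index-≥ : ∀ {n a c g} → c ≤ a → a < n → 0 < c → gcd n (a ∸ c) ≡ suc g → SeaweedIndex n a c g
  index-≥ {n} {a} {c} {g} c≤a a<n 0<c gcd≡ = ≡.subst₂ (λ n a → SeaweedIndex n a c g) n≡ (ℕₚ.m+[n∸m]≡n c≤a)
    (reduction-index (reduce _ c m b ℕₚ.≤-refl (ℕₚ.<-≤-trans 0<c (ℕₚ.m≤m+n c b))) gcd≡′ 0<c)
    where
    m = a ∸ c
    b = n ∸ a
    n≡ : c ℕ.+ (m ℕ.+ b) ≡ n
    n≡ = ≡.trans (≡.sym (ℕₚ.+-assoc c m b)) (≡.trans (≡.cong (ℕ._+ b) (ℕₚ.m+[n∸m]≡n c≤a)) (ℕₚ.m+[n∸m]≡n (ℕₚ.<⇒≤ a<n)))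
    gcd≡′ : gcd (c ℕ.+ b) m ≡ suc g
    gcd≡′ = ≡.trans (≡.sym (gcd[m+n,n] (c ℕ.+ b) m)) (≡.trans (≡.cong (λ k → gcd k m)
      (≡.trans (ℕₚ.+-assoc c b m) (≡.trans (≡.cong (c ℕ.+_) (ℕₚ.+-comm b m)) n≡))) gcd≡)

-- Transposition, and the index for arbitrary a and c

module _ {o ℓ : Level} (F : CharZeroField o ℓ) where
  open Index F
  open IndexLowerBound F
  open Traceless F

  private
    module _ {n : ℕ} where
      infixl 30 _†
      _† : Mat n → Mat n
      (X †) i j = X j i

  module _ {n a c : ℕ} where
    private
      Sw : Mat n → Set (o ⊔ ℓ)
      Sw = InSeaweed n a c

    seaweed-resp : ∀ {X Y} → X ≈ₘ Y → Sw X → Sw Y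
    seaweed-resp h (lift (l , u , t)) = lift ((λ i j p q → trans (sym (h i j)) (l i j p q)) ,
      (λ i j p q → trans (sym (h i j)) (u i j p q)) , trans (sumFin-cong (λ i → sym (h i i))) t)

    product-lower : ∀ {X Y} → Sw X → Sw Y → ∀ i j → toℕ j < a → a ≤ toℕ i → (X *ₘ Y) i j ≈ 0#
    product-lower {X} {Y} (lift (lX , _)) (lift (lY , _)) i j j<a a≤i =
      ∑-0 {fin n} {λ { (ix k) → X i k * Y k j }} λ { (ix k) → term k (toℕ k ℕ.<? a) }
      where
      term : ∀ k → Dec (toℕ k < a) → X i k * Y k j ≈ 0#
      term k (yes k<a) = trans (*-congʳ (lX i k k<a a≤i)) (zeroˡ _)
      term k (no k≮a)  = trans (*-congˡ (lY k j j<a (ℕₚ.≮⇒≥ k≮a))) (zeroʳ _)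

    product-upper : ∀ {X Y} → Sw X → Sw Y → ∀ i j → c ≤ toℕ j → toℕ i < c → (X *ₘ Y) i j ≈ 0#
    product-upper {X} {Y} (lift (_ , uX , _)) (lift (_ , uY , _)) i j c≤j i<c =
      ∑-0 {fin n} {λ { (ix k) → X i k * Y k j }} λ { (ix k) → term k (toℕ k ℕ.<? c) }
      where
      term : ∀ k → Dec (toℕ k < c) → X i k * Y k j ≈ 0#
      term k (yes k<c) = trans (*-congˡ (uY k j c≤j k<c)) (zeroʳ _)
      term k (no k≮c)  = trans (*-congʳ (uX i k (ℕₚ.≮⇒≥ k≮c) i<c)) (zeroˡ _)

    -- Argued entrywise, for arbitrary a and c: the block description presupposes c ≤ a, which one
    -- of the two transposed sides may violate.
    bracket-seaweed : ∀ X Y → Sw X → Sw Y → Sw ⁅ X , Y ⁆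
    bracket-seaweed X Y sX sY = lift
      ( (λ i j p q → x-y≈0 (trans (product-lower {X} {Y} sX sY i j p q) (sym (product-lower {Y} {X} sY sX i j p q))))
      , (λ i j p q → x-y≈0 (trans (product-upper {X} {Y} sX sY i j p q) (sym (product-upper {Y} {X} sY sX i j p q))))
      , trans (∑-minus {fin n} (λ { (ix i) → (X *ₘ Y) i i }) (λ { (ix i) → (Y *ₘ X) i i }))
              (x-y≈0 (tr-comm {fin n} {fin n} (λ { (ix i) (ix j) → X i j }) (λ { (ix i) (ix j) → Y i j }))) )

    †-seaweed : ∀ X → Sw X → InSeaweed n c a (X †)
    †-seaweed X (lift (l , u , t)) = lift ((λ i j p q → u j i q p) , (λ i j p q → l j i q p) , t)

    ·ₘ-seaweed : ∀ r X → Sw X → Sw (r ·ₘ X)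
    ·ₘ-seaweed r X (lift (l , u , t)) = lift
      ( (λ i j p q → trans (*-congˡ (l i j p q)) (zeroʳ r))
      , (λ i j p q → trans (*-congˡ (u i j p q)) (zeroʳ r))
      , trans (∑-*ˡ {fin n} r (λ { (ix i) → X i i })) (trans (*-congˡ t) (zeroʳ r)) )

  module _ {n a c : ℕ} where
    †-dual : Dual n a c → Dual n c a
    †-dual f = record
      { fun = λ X → fun (X †)
      ; cong = λ X Y sX sY h → fun-cong (X †) (Y †) (†-seaweed X sX) (†-seaweed Y sY) (λ i j → h j i)
      ; additive = λ X Y sX sY → additive (X †) (Y †) (†-seaweed X sX) (†-seaweed Y sY)
      ; homogeneous = λ r X sX → homogeneous r (X †) (†-seaweed X sX) }
      where open Dual f renaming (cong to fun-cong)

    -- Transposition reverses brackets.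
    †-kerB : ∀ (f : Dual n a c) X → KerB f X → KerB (†-dual f) (X †)
    †-kerB f X (sX , k) = †-seaweed X sX , λ Y sY →
      let sY† = †-seaweed Y sY
          sZ = bracket-seaweed X (Y †) sX sY†
          reversed : ((- 1#) ·ₘ ⁅ X , Y † ⁆) ≈ₘ (⁅ X † , Y ⁆ †)
          reversed = λ i j → trans (sym (-≈-1* _)) (trans
            (solve 2 (λ a b → :- (a :- b) := b :- a) refl _ _)
            (+-cong (sumFin-cong (λ k → *-comm (Y k i) (X k j))) (-‿cong (sumFin-cong (λ k → *-comm (X i k) (Y j k))))))
      in begin
        fun (⁅ X † , Y ⁆ †)
          ≈⟨ fun-cong _ _ (·ₘ-seaweed (- 1#) _ sZ) (seaweed-resp reversed (·ₘ-seaweed (- 1#) _ sZ)) reversed ⟨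
        fun ((- 1#) ·ₘ ⁅ X , Y † ⁆)
          ≈⟨ homogeneous (- 1#) _ sZ ⟩
        - 1# * fun ⁅ X , Y † ⁆
          ≈⟨ trans (*-congˡ (k (Y †) sY†)) (zeroʳ _) ⟩
        0# ∎
      where open Dual f renaming (cong to fun-cong)

  †-hasDim : ∀ {n a c} (f : Dual n a c) d → HasDim (KerB f) d → HasDim (KerB (†-dual f)) d
  †-hasDim f d (v , v-ker , independent , spanning) =
    (λ k → v k †) , (λ k → †-kerB f (v k) (v-ker k)) , (λ α h → independent α (λ i j → h j i)) ,
    λ X k → let (α , X≈) = spanning (X †) (†-kerB (†-dual f) X k) in α , (λ i j → X≈ j i)

  †-index : ∀ {n a c k} → SeaweedIndex n a c k → SeaweedIndex n c a k
  †-index ((f , dim) , least) = (†-dual f , †-hasDim f _ dim) , λ f′ d dim′ → least (†-dual f′) d (†-hasDim f′ d dim′)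

  seaweed-index : ∀ {n a c g} → 1 ≤ a → a < n → 1 ≤ c → c < n → gcd n ℕ.∣ a - c ∣ ≡ suc g → SeaweedIndex n a c g
  seaweed-index {n} {a} {c} 1≤a a<n 1≤c c<n e with ℕₚ.≤-total c a
  ... | inj₁ c≤a = index-≥ c≤a a<n 1≤c (≡.trans (≡.cong (gcd n) (≡.sym (ℕₚ.m≤n⇒∣n-m∣≡n∸m c≤a))) e)
  ... | inj₂ a≤c = †-index (index-≥ a≤c c<n 1≤a (≡.trans (≡.cong (gcd n) (≡.sym (ℕₚ.m≤n⇒∣m-n∣≡n∸m a≤c))) e))

  index-unique : ∀ {n a c k l} → SeaweedIndex n a c k → SeaweedIndex n a c l → k ≡ l
  index-unique ((f , dim) , least) ((g , dim′) , least′) = ℕₚ.≤-antisym (least g _ dim′) (least′ f _ dim)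

-- Counting pairs of compositions

private module NS = +-*-Solver

S : ℕ → (ℕ → ℕ) → ℕ
S zero    f = 0
S (suc n) f = f 0 ℕ.+ S n (f ∘ suc)

S-cong : ∀ n {f g} → (∀ i → i < n → f i ≡ g i) → S n f ≡ S n g
S-cong zero    h = ≡.refl
S-cong (suc n) h = ≡.cong₂ ℕ._+_ (h 0 z<s) (S-cong n (λ i i<n → h (suc i) (s<s i<n)))

S-+ : ∀ m n f → S (m ℕ.+ n) f ≡ S m f ℕ.+ S n (λ i → f (m ℕ.+ i))
S-+ zero    n f = ≡.refl
S-+ (suc m) n f = ≡.trans (≡.cong (f 0 ℕ.+_) (S-+ m n (f ∘ suc))) (≡.sym (ℕₚ.+-assoc (f 0) _ _))

S-last : ∀ n f → S (suc n) f ≡ S n f ℕ.+ f n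
S-last zero    f = ℕₚ.+-comm (f 0) 0
S-last (suc n) f = ≡.trans (≡.cong (f 0 ℕ.+_) (S-last n (f ∘ suc))) (≡.sym (ℕₚ.+-assoc (f 0) _ _))

S-distrib : ∀ n f g → S n (λ i → f i ℕ.+ g i) ≡ S n f ℕ.+ S n g
S-distrib zero    f g = ≡.refl
S-distrib (suc n) f g = ≡.trans (≡.cong (f 0 ℕ.+ g 0 ℕ.+_) (S-distrib n (f ∘ suc) (g ∘ suc)))
  (NS.solve 4 (λ a b c d → a NS.:+ b NS.:+ (c NS.:+ d) NS.:= a NS.:+ c NS.:+ (b NS.:+ d)) ≡.refl (f 0) (g 0) _ _)

S-const : ∀ n c → S n (λ _ → c) ≡ n ℕ.* c
S-const zero    c = ≡.refl
S-const (suc n) c = ≡.cong (c ℕ.+_) (S-const n c)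

S-zero : ∀ n {f} → (∀ i → i < n → f i ≡ 0) → S n f ≡ 0
S-zero n h = ≡.trans (S-cong n h) (≡.trans (S-const n 0) (ℕₚ.*-zeroʳ n))

S-blocks : ∀ t K f → S (t ℕ.* K) f ≡ S t (λ s → S K (λ j → f (s ℕ.* K ℕ.+ j)))
S-blocks zero    K f = ≡.refl
S-blocks (suc t) K f = ≡.trans (S-+ K (t ℕ.* K) f) (≡.cong (S K f ℕ.+_)
  (≡.trans (S-blocks t K (λ i → f (K ℕ.+ i)))
    (S-cong t (λ s _ → S-cong K (λ j _ → ≡.cong f (≡.sym (ℕₚ.+-assoc K (s ℕ.* K) j)))))))

χ : ∀ {p} {A : Set p} → Dec A → ℕ
χ (yes _) = 1
χ (no _)  = 0

χ-⇔ : ∀ {p q} {A : Set p} {B : Set q} (a? : Dec A) (b? : Dec B) → (A → B) → (B → A) → χ a? ≡ χ b?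
χ-⇔ (yes a) (yes b) f g = ≡.refl
χ-⇔ (yes a) (no ¬b) f g = contradiction (f a) ¬b
χ-⇔ (no ¬a) (yes b) f g = contradiction (g b) ¬a
χ-⇔ (no ¬a) (no ¬b) f g = ≡.refl

χ-no : ∀ {p} {A : Set p} (a? : Dec A) → ¬ A → χ a? ≡ 0
χ-no (yes a) ¬a = contradiction a ¬a
χ-no (no _)  ¬a = ≡.refl

length-filter-applyUpTo : ∀ {p} {A : Set} {P : A → Set p} (P? : ∀ x → Dec (P x)) (g : ℕ → A) n →
  length (filter P? (applyUpTo g n)) ≡ S n (λ i → χ (P? (g i)))
length-filter-applyUpTo P? g zero    = ≡.refl
length-filter-applyUpTo P? g (suc n) with P? (g 0)
... | yes _ = ≡.cong suc (length-filter-applyUpTo P? (g ∘ suc) n)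
... | no _  = length-filter-applyUpTo P? (g ∘ suc) n

length-filter-cartesianProduct : ∀ {p} {P : ℕ × ℕ → Set p} (P? : ∀ x → Dec (P x)) (f g : ℕ → ℕ) m n →
  length (filter P? (cartesianProduct (applyUpTo f m) (applyUpTo g n))) ≡ S m (λ i → S n (λ j → χ (P? (f i , g j))))
length-filter-cartesianProduct P? f g zero    n = ≡.refl
length-filter-cartesianProduct P? f g (suc m) n = ≡.trans
  (≡.cong length (filter-++ P? (map (f 0 ,_) (applyUpTo g n)) _))
  (≡.trans (length-++ (filter P? (map (f 0 ,_) (applyUpTo g n))))
    (≡.cong₂ ℕ._+_
      (≡.trans (≡.cong (length ∘ filter P?) (map-applyUpTo g (f 0 ,_) n)) (length-filter-applyUpTo P? (λ j → f 0 , g j) n))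
      (length-filter-cartesianProduct P? (f ∘ suc) g m n)))

gcd[m,m∸n] : ∀ m n → n ≤ m → gcd m (m ∸ n) ≡ gcd m n
gcd[m,m∸n] m n n≤m = ≡.trans (≡.cong (λ k → gcd k (m ∸ n)) (≡.sym (ℕₚ.m+[n∸m]≡n n≤m)))
  (≡.trans (gcd[m+n,n] n (m ∸ n)) (≡.trans (≡.sym (gcd[m,n+m] n (m ∸ n)))
    (≡.trans (≡.cong (gcd n) (ℕₚ.m∸n+n≡m n≤m)) (gcd-comm n m))))

module Counting (n₁ K : ℕ) where
  n : ℕ
  n = suc n₁

  -- Index k means gcd k + 1, and `K` will be `suc k`; so `h` marks the differences a - c that
  -- count.
  h : ℕ → ℕ
  h r = χ (gcd n r ℕ.≟ K)

  h-symmetric : ∀ r → r ≤ n → h (n ∸ r) ≡ h r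
  h-symmetric r r≤n = ≡.cong (λ g → χ (g ℕ.≟ K)) (gcd[m,m∸n] n r r≤n)

  H : ℕ
  H = S n h

  -- For fixed a = i + 1, the differences a − c modulo n run over all residues except a itself.
  row : ∀ i → i < n₁ → S n₁ (λ j → h ℕ.∣ i - j ∣) ℕ.+ h (suc i) ≡ H
  row i i<n₁ with q , n₁≡ ← ℕₚ.m≤n⇒∃[o]m+o≡n i<n₁ = begin
      S n₁ (λ j → h ℕ.∣ i - j ∣) ℕ.+ h (suc i)
        ≡⟨ ≡.cong (λ m → S m (λ j → h ℕ.∣ i - j ∣) ℕ.+ h (suc i)) (≡.trans (≡.sym n₁≡) (≡.sym (ℕₚ.+-suc i q))) ⟩
      S (i ℕ.+ suc q) (λ j → h ℕ.∣ i - j ∣) ℕ.+ h (suc i)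
        ≡⟨ ≡.cong (ℕ._+ h (suc i)) (S-+ i (suc q) (λ j → h ℕ.∣ i - j ∣)) ⟩
      S i (λ j → h ℕ.∣ i - j ∣) ℕ.+ S (suc q) (λ j → h ℕ.∣ i - i ℕ.+ j ∣) ℕ.+ h (suc i)
        ≡⟨ ≡.cong₂ (λ a b → a ℕ.+ b ℕ.+ h (suc i)) (S-cong i below) (S-cong (suc q) (λ j _ → ≡.cong h (ℕₚ.∣m-m+n∣≡n i j))) ⟩
      S i (λ j → h (suc (suc q) ℕ.+ j)) ℕ.+ S (suc q) h ℕ.+ h (suc i)
        ≡⟨ ≡.cong (S i (λ j → h (suc (suc q) ℕ.+ j)) ℕ.+ S (suc q) h ℕ.+_) middle ⟩
      S i (λ j → h (suc (suc q) ℕ.+ j)) ℕ.+ S (suc q) h ℕ.+ h (suc q)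
        ≡⟨ NS.solve 3 (λ a b c → a NS.:+ b NS.:+ c NS.:= b NS.:+ c NS.:+ a) ≡.refl (S i _) (S (suc q) h) (h (suc q)) ⟩
      S (suc q) h ℕ.+ h (suc q) ℕ.+ S i (λ j → h (suc (suc q) ℕ.+ j))
        ≡⟨ ≡.cong (ℕ._+ S i (λ j → h (suc (suc q) ℕ.+ j))) (S-last (suc q) h) ⟨
      S (suc (suc q)) h ℕ.+ S i (λ j → h (suc (suc q) ℕ.+ j))
        ≡⟨ S-+ (suc (suc q)) i h ⟨
      S (suc (suc q) ℕ.+ i) h
        ≡⟨ ≡.cong (λ m → S m h) n≡ ⟨
      H ∎
    where
    open ≡.≡-Reasoning
    n≡ : n ≡ suc (suc q) ℕ.+ i
    n≡ = ≡.cong suc (≡.trans (≡.sym n₁≡) (≡.cong suc (ℕₚ.+-comm i q)))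
    middle : h (suc i) ≡ h (suc q)
    middle = ≡.trans (≡.cong h (≡.sym (≡.trans (≡.cong (_∸ suc q) n≡)
      (≡.trans (≡.cong (_∸ suc q) (≡.sym (ℕₚ.+-suc (suc q) i))) (ℕₚ.m+n∸m≡n (suc q) (suc i))))))
                     (h-symmetric (suc q) (≡.subst (suc q ≤_) (≡.sym n≡) (ℕₚ.m≤n⇒m≤1+n (ℕₚ.m≤m+n (suc q) i))))
    -- For j < i the difference is replaced by its negative n - (i - j) = q + 2 + j. The row then
    -- covers 0, ..., q and q + 2, ..., n - 1, missing only q + 1 = n - (i + 1).
    below : ∀ j → j < i → h ℕ.∣ i - j ∣ ≡ h (suc (suc q) ℕ.+ j)
    below j j<i = ≡.trans (≡.cong h (ℕₚ.m≤n⇒∣n-m∣≡n∸m (ℕₚ.<⇒≤ j<i)))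
      (≡.trans (≡.sym (h-symmetric (i ∸ j) (ℕₚ.≤-trans (ℕₚ.m∸n≤m i j) (ℕₚ.≤-trans (ℕₚ.<⇒≤ i<n₁) (ℕₚ.n≤1+n n₁)))))
        (≡.cong h (≡.trans (≡.cong (_∸ (i ∸ j)) n≡) (≡.trans (ℕₚ.+-∸-assoc (suc (suc q)) (ℕₚ.m∸n≤m i j))
          (≡.cong (suc (suc q) ℕ.+_) (ℕₚ.m∸[m∸n]≡n (ℕₚ.<⇒≤ j<i)))))))

  total : ℕ
  total = S n₁ (λ i → S n₁ (λ j → h ℕ.∣ i - j ∣))

  -- The residues missing from the rows are 1, ..., n - 1, which contribute `H` less `h 0`; terms
  -- are moved across to avoid subtraction.
  total-count : total ℕ.+ H ≡ n₁ ℕ.* H ℕ.+ h 0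
  total-count = begin
    total ℕ.+ (h 0 ℕ.+ S n₁ (h ∘ suc))
      ≡⟨ NS.solve 3 (λ a b c → a NS.:+ (b NS.:+ c) NS.:= a NS.:+ c NS.:+ b) ≡.refl total (h 0) (S n₁ (h ∘ suc)) ⟩
    total ℕ.+ S n₁ (h ∘ suc) ℕ.+ h 0
      ≡⟨ ≡.cong (ℕ._+ h 0) (S-distrib n₁ (λ i → S n₁ (λ j → h ℕ.∣ i - j ∣)) (h ∘ suc)) ⟨
    S n₁ (λ i → S n₁ (λ j → h ℕ.∣ i - j ∣) ℕ.+ h (suc i)) ℕ.+ h 0
      ≡⟨ ≡.cong (ℕ._+ h 0) (≡.trans (S-cong n₁ row) (S-const n₁ H)) ⟩
    n₁ ℕ.* H ℕ.+ h 0 ∎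
    where open ≡.≡-Reasoning

  pairs : List (ℕ × ℕ)
  pairs = filter (λ (a , c) → gcd n ℕ.∣ a - c ∣ ℕ.≟ K) (cartesianProduct (applyUpTo suc n₁) (applyUpTo suc n₁))

  length-pairs : length pairs ≡ total
  length-pairs = length-filter-cartesianProduct (λ (a , c) → gcd n ℕ.∣ a - c ∣ ℕ.≟ K) suc suc n₁ n₁

  unique-pairs : Unique pairs
  unique-pairs = filter⁺ _ (cartesianProduct⁺ range range)
    where
    range : Unique (applyUpTo suc n₁)
    range = applyUpTo⁺₁ suc n₁ (λ i<j _ e → ℕₚ.<⇒≢ i<j (ℕₚ.suc-injective e))

  ∈-pairs⁺ : ∀ {a c} → 1 ≤ a → a < n → 1 ≤ c → c < n → gcd n ℕ.∣ a - c ∣ ≡ K → (a , c) ∈ pairs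
  ∈-pairs⁺ {suc a} {suc c} _ a<n _ c<n e = ∈-filter⁺ _
    (∈-cartesianProduct⁺ (∈-applyUpTo⁺ suc (ℕₚ.≤-pred a<n)) (∈-applyUpTo⁺ suc (ℕₚ.≤-pred c<n))) e

  ∈-pairs⁻ : ∀ {a c} → (a , c) ∈ pairs → 1 ≤ a × a < n × 1 ≤ c × c < n × gcd n ℕ.∣ a - c ∣ ≡ K
  ∈-pairs⁻ p with p∈ , e ← ∈-filter⁻ (λ (a , c) → gcd n ℕ.∣ a - c ∣ ℕ.≟ K) {xs = cartesianProduct (applyUpTo suc n₁) (applyUpTo suc n₁)} p
    with a∈ , c∈ ← ∈-cartesianProduct⁻ (applyUpTo suc n₁) (applyUpTo suc n₁) p∈
    with i , i<n₁ , ≡.refl ← ∈-applyUpTo⁻ suc a∈ | j , j<n₁ , ≡.refl ← ∈-applyUpTo⁻ suc c∈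
    = s≤s z≤n , s≤s i<n₁ , s≤s z≤n , s≤s j<n₁ , e

-- Only multiples of K can have gcd K with n = t K, and gcd(t K, s K) = K gcd(t, s). Of each of the
-- t blocks of length K in 1, ..., n just the last entry s K is left, and it counts when s is
-- coprime to t.
totient-count : ∀ t k n₁ → suc n₁ ≡ t ℕ.* suc k → Counting.H n₁ (suc k) ≡ φ t
totient-count t k n₁ n≡ = begin
    S (suc n₁) h
      ≡⟨ ℕₚ.+-cancelˡ-≡ (h 0) _ _ shift ⟩
    S (suc n₁) (h ∘ suc)
      ≡⟨ ≡.cong (λ m → S m (h ∘ suc)) n≡ ⟩
    S (t ℕ.* K) (h ∘ suc)
      ≡⟨ S-blocks t K (h ∘ suc) ⟩
    S t (λ s → S K (λ j → h (suc (s ℕ.* K ℕ.+ j))))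
      ≡⟨ S-cong t (λ s _ → block s) ⟩
    S t (λ s → χ (coprime? (suc s) t))
      ≡⟨ length-filter-applyUpTo (λ m → coprime? m t) suc t ⟨
    length (filter (λ m → coprime? m t) (applyUpTo suc t))
      ≡⟨ ≡.cong (length ∘ filter (λ m → coprime? m t)) (map-applyUpTo id suc t) ⟨
    φ t ∎
  where
  open ≡.≡-Reasoning
  open Counting n₁ (suc k)
  K = suc k
  -- `H` runs over 0, ..., n - 1 but φ over 1, ..., t; the ends 0 and n have the same gcd with n.
  shift : h 0 ℕ.+ S (suc n₁) h ≡ h 0 ℕ.+ S (suc n₁) (h ∘ suc)
  shift = ≡.trans (ℕₚ.+-comm (h 0) _) (≡.trans (≡.cong (S (suc n₁) h ℕ.+_) (≡.sym (h-symmetric 0 z≤n)))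
            (≡.sym (S-last (suc n₁) h)))
  gcd-multiple : ∀ s → gcd (suc n₁) (s ℕ.* K) ≡ K ℕ.* gcd t s
  gcd-multiple s = ≡.trans (≡.cong₂ gcd (≡.trans n≡ (ℕₚ.*-comm t K)) (ℕₚ.*-comm s K)) (≡.sym (c*gcd[m,n]≡gcd[cm,cn] K t s))
  block : ∀ s → S K (λ j → h (suc (s ℕ.* K ℕ.+ j))) ≡ χ (coprime? (suc s) t)
  block s = ≡.trans (S-last k _) (≡.cong₂ ℕ._+_ (S-zero k non-multiple) last)
    where
    last : h (suc (s ℕ.* K ℕ.+ k)) ≡ χ (coprime? (suc s) t)
    last = ≡.trans (≡.cong h (≡.trans (≡.sym (ℕₚ.+-suc (s ℕ.* K) k)) (ℕₚ.+-comm (s ℕ.* K) K)))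
      (χ-⇔ _ _
        (λ e → gcd≡1⇒coprime (≡.trans (gcd-comm (suc s) t) (ℕₚ.*-cancelˡ-≡ (gcd t (suc s)) 1 K
          (≡.trans (≡.sym (gcd-multiple (suc s))) (≡.trans e (≡.sym (ℕₚ.*-identityʳ K)))))))
        (λ c → ≡.trans (gcd-multiple (suc s)) (≡.trans (≡.cong (K ℕ.*_) (≡.trans (gcd-comm t (suc s)) (coprime⇒gcd≡1 c))) (ℕₚ.*-identityʳ K))))
    non-multiple : ∀ j → j < k → h (suc (s ℕ.* K ℕ.+ j)) ≡ 0
    non-multiple j j<k = χ-no _ λ e → >⇒∤ (s≤s j<k)
      (∣m+n∣m⇒∣n (≡.subst₂ _∣_ e (≡.sym (ℕₚ.+-suc (s ℕ.* K) j)) (gcd[m,n]∣n (suc n₁) (suc (s ℕ.* K ℕ.+ j)))) (n∣m*n s))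

-- The two counts

module _ {o ℓ : Level} (F : CharZeroField o ℓ) where
  open Over F using (C22≡; SeaweedIndex)

  seaweed-count : ∀ n₁ k → C22≡ (suc n₁) k (Counting.total n₁ (suc k))
  seaweed-count n₁ k = pairs , unique-pairs , length-pairs , λ a c → mk⇔
    (λ p → let (1≤a , a<n , 1≤c , c<n , e) = ∈-pairs⁻ p in
      1≤a , a<n , 1≤c , c<n , seaweed-index F 1≤a a<n 1≤c c<n e)
    (λ (1≤a , a<n , 1≤c , c<n , ind) → ∈-pairs⁺ 1≤a a<n 1≤c c<n (gcd≡ 1≤a a<n 1≤c c<n ind))
    where
    open Counting n₁ (suc k)
    gcd≡ : ∀ {a c} → 1 ≤ a → a < n → 1 ≤ c → c < n → SeaweedIndex n a c k → gcd n ℕ.∣ a - c ∣ ≡ suc k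
    gcd≡ {a} {c} 1≤a a<n 1≤c c<n ind with gcd n ℕ.∣ a - c ∣ in e
    ... | zero  = contradiction (gcd[m,n]≡0⇒m≡0 {n} {ℕ.∣ a - c ∣} e) λ ()
    ... | suc g = ≡.cong suc (index-unique F (seaweed-index F 1≤a a<n 1≤c c<n e) ind)

  count-> : ∀ t k → 1 < t → C22≡ (t ℕ.+ t ℕ.* k) k ((t ℕ.+ t ℕ.* k ∸ 2) ℕ.* φ t)
  count-> (suc zero) k (s≤s ())
  count-> t@(suc (suc u)) k _ = ≡.subst (C22≡ n k) total≡ (seaweed-count n₁ k)
    where
    n₁ = suc u ℕ.+ t ℕ.* k
    open Counting n₁ (suc k)
    n≡ : n ≡ t ℕ.* suc k
    n≡ = ≡.sym (ℕₚ.*-suc t k)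
    -- gcd(n, 0) = n = t K exceeds K for t > 1, so pairs with a = c do not count.
    h0≡0 : h 0 ≡ 0
    h0≡0 = χ-no _ λ e → ℕₚ.<⇒≢ (≡.subst (suc k <_) (ℕₚ.*-comm (suc k) t) (ℕₚ.m<m*n (suc k) t (s≤s (s≤s z≤n)))) (≡.sym (≡.trans (≡.sym n≡) (≡.trans (≡.sym (gcd-identityʳ n)) e)))
    total≡ : total ≡ (n ∸ 2) ℕ.* φ t
    total≡ = ≡.trans (ℕₚ.+-cancelʳ-≡ H total ((n ∸ 2) ℕ.* H) (≡.trans total-count
      (≡.trans (≡.cong (n₁ ℕ.* H ℕ.+_) h0≡0) (≡.trans (ℕₚ.+-identityʳ _) (ℕₚ.+-comm H _)))))
      (≡.cong ((n ∸ 2) ℕ.*_) (totient-count t k n₁ n≡))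

  count-1 : ∀ k → C22≡ (1 ℕ.+ 1 ℕ.* k) k (1 ℕ.+ 1 ℕ.* k ∸ 1)
  count-1 k = ≡.subst (C22≡ n k) total≡ (seaweed-count n₁ k)
    where
    n₁ = 1 ℕ.* k
    open Counting n₁ (suc k)
    n≡ : n ≡ suc k
    n≡ = ≡.cong suc (ℕₚ.*-identityˡ k)
    H≡1 : H ≡ 1
    -- `φ 1` computes to 1.
    H≡1 = totient-count 1 k n₁ (≡.trans n≡ (≡.sym (ℕₚ.*-identityˡ (suc k))))
    h0≡1 : h 0 ≡ 1
    -- Now n = K, so the residue 0 is the only one that counts. It is never the residue missing from
    -- a row, whence n - 1 in place of n - 2.
    h0≡1 = χ-⇔ {B = 0 ≡ 0} (gcd n 0 ℕ.≟ suc k) (yes ≡.refl) (λ _ → ≡.refl) (λ _ → ≡.trans (gcd-identityʳ n) n≡)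
    total≡ : total ≡ n₁
    total≡ = ℕₚ.+-cancelʳ-≡ 1 total n₁ (≡.trans (≡.cong (total ℕ.+_) (≡.sym H≡1)) (≡.trans total-count
      (≡.cong₂ ℕ._+_ (≡.trans (≡.cong (n₁ ℕ.*_) H≡1) (ℕₚ.*-identityʳ n₁)) h0≡1)))

open import Data.Nat using (_+_; _*_)

theorem4p5 : ∀ {o ℓ} (F : CharZeroField o ℓ) →
    ((t k : ℕ) → 1 < t → Over.C22≡ F (t + t * k) k ((t + t * k ∸ 2) * φ t))
    × ((k : ℕ) → Over.C22≡ F (1 + 1 * k) k (1 + 1 * k ∸ 1))
theorem4p5 F = count-> F , count-1 F
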